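{- Let $k\ge 1$ be a fixed integer, $R$ a fixed finite abelian group, $\omega(n)$ a function with $\omega(n)\to\infty$, and $p=\frac{k\log n+\omega(n)}{n}$. Then $$\sum_{\phi \in \mathcal{G}_n} (1-p)^{b(\phi)} =o(1) \quad (n\to\infty).$$
   Context: $\log$ is the natural logarithm. $\Delta_{n-1}$ is the simplex on vertex set $[n]$; $\Delta_{n-1}(j)$ denotes its set of $j$-dimensional faces. For $j\ge 0$, $C^j(\Delta_{n-1})$ is the group of $R$-valued skew-symmetric functions on ordered $j$-simplices, with coboundary $d_j\phi([v_0,\dots,v_{j+1}])=\sum_{i=0}^{j+1}(-1)^i\phi([v_0,\dots,\widehat{v_i},\dots,v_{j+1}])$; in addition $C^{ -1}=R$ with $d_{ -1}a(v)=a$. For $\phi\in C^{k-1}(\Delta_{n-1})$: $\mathrm{supp}(\phi)=\{\sigma\in\Delta_{n-1}(k-1):\phi(\sigma)\ne 0\}$ (viewed as a family of $k$-subsets of $[n]$); $b(\phi)=|\{\tau\in\Delta_{n-1}(k): d_{k-1}\phi(\tau)\neq 0\}|$; and the weight is $w(\phi)=\min\{|\mathrm{supp}(\phi+d_{k-2}\psi)|:\psi\in C^{k-2}(\Delta_{n-1})\}$. A family $\mathcal{F}\subset\binom{[n]}{k}$ is connected if for any $\sigma,\tau\in\mathcal{F}$ there is a sequence $\sigma=\sigma_0,\dots,\sigma_t=\tau$ in $\mathcal{F}$ with $|\sigma_i\cap\sigma_{i-1}|=k-1$ for all $i$. Finally $\mathcal{G}_n=\{0\ne\phi\in C^{k-1}(\Delta_{n-1}):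 \mathrm{supp}(\phi)\text{ is connected and } w(\phi)=|\mathrm{supp}(\phi)|\}$.
   Formalization: Adds the assumption that p ≤ 1 for all sufficiently large n (p is meant as a probability); without it the claim fails, e.g. k=1, R=Z/2, ω(n)=10n, where for odd n all exponents b are even and the sum tends to infinity. -}

module Defs where

open import Algebra.Bundles using (AbelianGroup)
import Algebra.Definitions.RawMonoid as RawMonoid
open import Data.Bool.Base using (if_then_else_)
open import Data.Fin.Base using (Fin; toℕ)
import Data.Fin.Base as Fin
import Data.Fin.Properties as Fin
open import Data.Fin.Subset using (Subset; ⁅_⁆; _∪_; _∩_; ∣_∣)
import Data.Fin.Subset as Subset
open import Data.Integer.Base using (+_)
import Data.Integer.Base as ℤ
import Data.Integer.Properties as ℤ
open import Data.List.Base as List using (List; []; _∷_; cartesianProductWith; allFin)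
import Data.List.Extrema.Nat as Extrema
open import Data.List.Membership.Propositional using (_∈_)
open import Data.List.Membership.Propositional.Properties
  using (∈-cartesianProductWith⁺; ∈-allFin)
import Data.List.Relation.Unary.All as ListAll
open import Data.List.Relation.Unary.Any as Any using (Any; here; there)
open import Data.Nat.Base as ℕ using (ℕ; zero; suc; pred; _∸_; NonZero)
import Data.Nat.Properties as ℕ
open import Data.Product.Base using (Σ; ∃-syntax; _×_; _,_; proj₁; proj₂)
open import Data.Rational.Base as ℚ using (ℚ; 0ℚ; 1ℚ; ½; _/_)
import Data.Rational.Properties as ℚ
open import Data.Integer.Solver using () renaming (module +-*-Solver to ℤSolver)
open import Data.Rational.Solver using (module +-*-Solver)
import Data.Rational.Unnormalised.Base as ℚᵘ
import Data.Rational.Unnormalised.Properties as ℚᵘ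
open import Data.Sum.Base using (_⊎_; inj₁; inj₂)
open import Data.Vec.Base as Vec using (Vec; []; _∷_; _[_]≔_; lookup; removeAt)
import Data.Vec.Properties as Vec
import Data.Vec.Relation.Unary.All as All
import Data.Vec.Relation.Unary.AllPairs as AllPairs
open import Data.Vec.Relation.Unary.AllPairs using (AllPairs; []; _∷_)
open import Data.Vec.Relation.Unary.Unique.Propositional using (Unique)
open import Function.Base using (_∘_; const; flip)
open import Function.Bundles using (Inverse)
open import Level using (Level; 0ℓ; _⊔_) renaming (suc to lsuc)
open import Relation.Binary.Core using (Rel)
open import Relation.Binary.Construct.Closure.ReflexiveTransitive
  using (Star; ε; _◅_; _◅◅_)
open import Relation.Binary.Definitions using (Decidable; DecidableEquality)
open import Relation.Binary.PropositionalEquality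
  using (_≡_; _≢_; _≗_; refl; sym; trans; cong; cong₂; subst; setoid)
open import Relation.Nullary.Decidable
  using (Dec; yes; no; does; map′; ¬?; _×-dec_; _⊎-dec_; _→-dec_)
open import Relation.Nullary.Negation using (¬_; contradiction-irr)
import Relation.Unary as U

Cauchy : (ℕ → ℚ) → Set
Cauchy x = ∀ e .{{_ : ℚ.Positive e}} →
  ∃[ N ] ∀ m n → N ℕ.≤ m → N ℕ.≤ n → ℚ.∣ x m ℚ.- x n ∣ ℚ.≤ e

record ℝ : Set where
  constructor mkℝ
  field
    seq    : ℕ → ℚ
    cauchy : Cauchy seq

open ℝ public

infix 4 _≤ℝ_
_≤ℝ_ : Rel ℝ 0ℓ
x ≤ℝ y = ∀ e .{{_ : ℚ.Positive e}} →
  ∃[ N ] ∀ n → N ℕ.≤ n → seq x n ℚ.≤ seq y n ℚ.+ e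

module CauchyLemmas where

  private module ℚ≤ = ℚ.≤-Reasoning

  ½-positive : ∀ e .{{_ : ℚ.Positive e}} → ℚ.Positive (½ ℚ.* e)
  ½-positive e = ℚ.pos*pos⇒pos ½ e

  halves : ∀ e → ½ ℚ.* e ℚ.+ ½ ℚ.* e ≡ e
  halves e = trans (sym (ℚ.*-distribʳ-+ e ½ ½)) (ℚ.*-identityˡ e)

  ∣∣-cauchy : ∀ {p q e} → p ℚ.≤ q ℚ.+ e → q ℚ.≤ p ℚ.+ e → ℚ.∣ p ℚ.- q ∣ ℚ.≤ e
  ∣∣-cauchy {p} {q} {e} p≤ q≤ with ℚ.∣p∣≡p∨∣p∣≡-p (p ℚ.- q)
  ... | inj₁ eq = ℚ≤.begin
    ℚ.∣ p ℚ.- q ∣        ℚ≤.≡⟨ eq ⟩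
    p ℚ.- q              ℚ≤.≤⟨ ℚ.+-monoˡ-≤ (ℚ.- q) p≤ ⟩
    (q ℚ.+ e) ℚ.- q      ℚ≤.≡⟨ solve 2 (λ b c → (b :+ c) :- b := c) refl q e ⟩
    e                    ℚ≤.∎
    where open +-*-Solver
  ... | inj₂ eq = ℚ≤.begin
    ℚ.∣ p ℚ.- q ∣        ℚ≤.≡⟨ eq ⟩
    ℚ.- (p ℚ.- q)        ℚ≤.≡⟨ solve 2 (λ a b → :- (a :- b) := b :- a) refl p q ⟩
    q ℚ.- p              ℚ≤.≤⟨ ℚ.+-monoˡ-≤ (ℚ.- p) q≤ ⟩
    (p ℚ.+ e) ℚ.- p      ℚ≤.≡⟨ solve 2 (λ b c → (b :+ c) :- b := c) refl p e ⟩
    e                    ℚ≤.∎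
    where open +-*-Solver

  ∣p∣≤∣p-q∣+∣q∣ : ∀ p q → ℚ.∣ p ∣ ℚ.≤ ℚ.∣ p ℚ.- q ∣ ℚ.+ ℚ.∣ q ∣
  ∣p∣≤∣p-q∣+∣q∣ p q = ℚ≤.begin
    ℚ.∣ p ∣                         ℚ≤.≡⟨ cong ℚ.∣_∣ (solve 2 (λ a b → a := (a :- b) :+ b) refl p q) ⟩
    ℚ.∣ (p ℚ.- q) ℚ.+ q ∣           ℚ≤.≤⟨ ℚ.∣p+q∣≤∣p∣+∣q∣ (p ℚ.- q) q ⟩
    ℚ.∣ p ℚ.- q ∣ ℚ.+ ℚ.∣ q ∣       ℚ≤.∎
    where open +-*-Solver

  swap-∣-∣ : ∀ p q → ℚ.∣ q ℚ.- p ∣ ≡ ℚ.∣ p ℚ.- q ∣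
  swap-∣-∣ p q = trans (cong ℚ.∣_∣ (solve 2 (λ a b → b :- a := :- (a :- b)) refl p q))
                       (ℚ.∣-p∣≡∣p∣ (p ℚ.- q))
    where open +-*-Solver

  const-cauchy : ∀ q → Cauchy (const q)
  const-cauchy q e = 0 , λ _ _ _ _ → ℚ≤.begin
    ℚ.∣ q ℚ.- q ∣   ℚ≤.≡⟨ cong ℚ.∣_∣ (ℚ.+-inverseʳ q) ⟩
    0ℚ              ℚ≤.≤⟨ ℚ.<⇒≤ (ℚ.positive⁻¹ e) ⟩
    e               ℚ≤.∎

  +-cauchy : ∀ {x y} → Cauchy x → Cauchy y → Cauchy (λ n → x n ℚ.+ y n)
  +-cauchy {x} {y} cx cy e =
    let instance _ = ½-positive e
        (M , p) = cx (½ ℚ.* e)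
        (N , q) = cy (½ ℚ.* e)
    in M ℕ.⊔ N , λ m n ≤m ≤n → ℚ≤.begin
      ℚ.∣ (x m ℚ.+ y m) ℚ.- (x n ℚ.+ y n) ∣
        ℚ≤.≡⟨ cong ℚ.∣_∣ (solve 4 (λ a b c d → (a :+ b) :- (c :+ d) := (a :- c) :+ (b :- d))
                refl (x m) (y m) (x n) (y n)) ⟩
      ℚ.∣ (x m ℚ.- x n) ℚ.+ (y m ℚ.- y n) ∣
        ℚ≤.≤⟨ ℚ.∣p+q∣≤∣p∣+∣q∣ (x m ℚ.- x n) (y m ℚ.- y n) ⟩
      ℚ.∣ x m ℚ.- x n ∣ ℚ.+ ℚ.∣ y m ℚ.- y n ∣
        ℚ≤.≤⟨ ℚ.+-mono-≤
                (p m n (ℕ.≤-trans (ℕ.m≤m⊔n M N) ≤m) (ℕ.≤-trans (ℕ.m≤m⊔n M N) ≤n))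
                (q m n (ℕ.≤-trans (ℕ.m≤n⊔m M N) ≤m) (ℕ.≤-trans (ℕ.m≤n⊔m M N) ≤n)) ⟩
      ½ ℚ.* e ℚ.+ ½ ℚ.* e
        ℚ≤.≡⟨ halves e ⟩
      e ℚ≤.∎
    where open +-*-Solver

  neg-cauchy : ∀ {x} → Cauchy x → Cauchy (λ n → ℚ.- x n)
  neg-cauchy {x} cx e = let (N , p) = cx e in N , λ m n ≤m ≤n → ℚ≤.begin
    ℚ.∣ (ℚ.- x m) ℚ.- (ℚ.- x n) ∣
      ℚ≤.≡⟨ cong ℚ.∣_∣ (solve 2 (λ a b → (:- a) :- (:- b) := b :- a) refl (x m) (x n)) ⟩
    ℚ.∣ x n ℚ.- x m ∣  ℚ≤.≡⟨ swap-∣-∣ (x m) (x n) ⟩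
    ℚ.∣ x m ℚ.- x n ∣  ℚ≤.≤⟨ p m n ≤m ≤n ⟩
    e ℚ≤.∎
    where open +-*-Solver

  abs-cauchy : ∀ {x} → Cauchy x → Cauchy (λ n → ℚ.∣ x n ∣)
  abs-cauchy {x} cx e = let (N , p) = cx e in N , λ m n ≤m ≤n → ∣∣-cauchy
    (half (x m) (x n) (p m n ≤m ≤n)) (half (x n) (x m) (p n m ≤n ≤m))
    where
    half : ∀ a b → ℚ.∣ a ℚ.- b ∣ ℚ.≤ e → ℚ.∣ a ∣ ℚ.≤ ℚ.∣ b ∣ ℚ.+ e
    half a b h = ℚ≤.begin
      ℚ.∣ a ∣                      ℚ≤.≤⟨ ∣p∣≤∣p-q∣+∣q∣ a b ⟩
      ℚ.∣ a ℚ.- b ∣ ℚ.+ ℚ.∣ b ∣    ℚ≤.≤⟨ ℚ.+-monoˡ-≤ ℚ.∣ b ∣ h ⟩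
      e ℚ.+ ℚ.∣ b ∣                ℚ≤.≡⟨ ℚ.+-comm e ℚ.∣ b ∣ ⟩
      ℚ.∣ b ∣ ℚ.+ e                ℚ≤.∎

  bounded : ∀ {x} → Cauchy x →
    ∃[ N ] Σ ℚ λ B → ℚ.Positive B × (∀ n → N ℕ.≤ n → ℚ.∣ x n ∣ ℚ.≤ B)
  bounded {x} cx = let (N , p) = cx 1ℚ in
    N , 1ℚ ℚ.+ ℚ.∣ x N ∣ ,
    ℚ.pos+nonNeg⇒pos 1ℚ ℚ.∣ x N ∣ {{ℚ.∣-∣-nonNeg (x N)}} ,
    λ n ≤n → ℚ≤.begin
      ℚ.∣ x n ∣                        ℚ≤.≤⟨ ∣p∣≤∣p-q∣+∣q∣ (x n) (x N) ⟩
      ℚ.∣ x n ℚ.- x N ∣ ℚ.+ ℚ.∣ x N ∣  ℚ≤.≤⟨ ℚ.+-monoˡ-≤ ℚ.∣ x N ∣ (p n N ≤n ℕ.≤-refl) ⟩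
      1ℚ ℚ.+ ℚ.∣ x N ∣                 ℚ≤.∎

  scaled : ∀ B .{{_ : ℚ.Positive B}} e .{{_ : ℚ.Positive e}} →
    Σ ℚ λ d → ℚ.Positive d × B ℚ.* d ≡ ½ ℚ.* e
  scaled B e =
    ℚ.1/ B ℚ.* (½ ℚ.* e) ,
    ℚ.pos*pos⇒pos (ℚ.1/ B) {{ℚ.1/pos⇒pos B}} (½ ℚ.* e) {{½-positive e}} ,
    trans (sym (ℚ.*-assoc B (ℚ.1/ B) (½ ℚ.* e)))
      (trans (cong (ℚ._* (½ ℚ.* e)) (ℚ.*-inverseʳ B)) (ℚ.*-identityˡ (½ ℚ.* e)))
    where instance _ = ℚ.pos⇒nonZero B

  *-bound : ∀ a b {B d} .{{_ : ℚ.Positive B}} →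
    ℚ.∣ a ∣ ℚ.≤ B → ℚ.∣ b ∣ ℚ.≤ d → ℚ.∣ a ℚ.* b ∣ ℚ.≤ B ℚ.* d
  *-bound a b {B} {d} a≤ b≤ = ℚ≤.begin
    ℚ.∣ a ℚ.* b ∣          ℚ≤.≡⟨ ℚ.∣p*q∣≡∣p∣*∣q∣ a b ⟩
    ℚ.∣ a ∣ ℚ.* ℚ.∣ b ∣    ℚ≤.≤⟨ ℚ.*-monoʳ-≤-nonNeg ℚ.∣ b ∣ {{ℚ.∣-∣-nonNeg b}} a≤ ⟩
    B ℚ.* ℚ.∣ b ∣          ℚ≤.≤⟨ ℚ.*-monoˡ-≤-nonNeg B {{ℚ.pos⇒nonNeg B}} b≤ ⟩
    B ℚ.* d                ℚ≤.∎

  *-cauchy : ∀ {x y} → Cauchy x → Cauchy y → Cauchy (λ n → x n ℚ.* y n)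
  *-cauchy {x} {y} cx cy e =
    let (K , B , B>0 , x≤B) = bounded cx
        (L , C , C>0 , y≤C) = bounded cy
        (d , d>0 , Bd≡) = scaled B {{B>0}} e
        (f , f>0 , Cf≡) = scaled C {{C>0}} e
        (M , p) = cx f {{f>0}}
        (N , q) = cy d {{d>0}}
    in (K ℕ.⊔ L) ℕ.⊔ (M ℕ.⊔ N) , λ m n ≤m ≤n →
      let ≤K = ℕ.≤-trans (ℕ.m≤m⊔n K L) (ℕ.m≤m⊔n (K ℕ.⊔ L) (M ℕ.⊔ N))
          ≤L = ℕ.≤-trans (ℕ.m≤n⊔m K L) (ℕ.m≤m⊔n (K ℕ.⊔ L) (M ℕ.⊔ N))
          ≤M = ℕ.≤-trans (ℕ.m≤m⊔n M N) (ℕ.m≤n⊔m (K ℕ.⊔ L) (M ℕ.⊔ N))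
          ≤N = ℕ.≤-trans (ℕ.m≤n⊔m M N) (ℕ.m≤n⊔m (K ℕ.⊔ L) (M ℕ.⊔ N))
      in ℚ≤.begin
        ℚ.∣ x m ℚ.* y m ℚ.- x n ℚ.* y n ∣
          ℚ≤.≡⟨ cong ℚ.∣_∣ (solve 4
                  (λ a b c g → a :* b :- c :* g := a :* (b :- g) :+ g :* (a :- c))
                  refl (x m) (y m) (x n) (y n)) ⟩
        ℚ.∣ x m ℚ.* (y m ℚ.- y n) ℚ.+ y n ℚ.* (x m ℚ.- x n) ∣
          ℚ≤.≤⟨ ℚ.∣p+q∣≤∣p∣+∣q∣ (x m ℚ.* (y m ℚ.- y n)) (y n ℚ.* (x m ℚ.- x n)) ⟩
        ℚ.∣ x m ℚ.* (y m ℚ.- y n) ∣ ℚ.+ ℚ.∣ y n ℚ.* (x m ℚ.- x n) ∣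
          ℚ≤.≤⟨ ℚ.+-mono-≤
                  (*-bound (x m) (y m ℚ.- y n) {B} {d} {{B>0}} (x≤B m (ℕ.≤-trans ≤K ≤m))
                    (q m n (ℕ.≤-trans ≤N ≤m) (ℕ.≤-trans ≤N ≤n)))
                  (*-bound (y n) (x m ℚ.- x n) {C} {f} {{C>0}} (y≤C n (ℕ.≤-trans ≤L ≤n))
                    (p m n (ℕ.≤-trans ≤M ≤m) (ℕ.≤-trans ≤M ≤n))) ⟩
        B ℚ.* d ℚ.+ C ℚ.* f      ℚ≤.≡⟨ cong₂ ℚ._+_ Bd≡ Cf≡ ⟩
        ½ ℚ.* e ℚ.+ ½ ℚ.* e      ℚ≤.≡⟨ halves e ⟩
        e                        ℚ≤.∎
    where open +-*-Solver

open CauchyLemmas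

fromℚ : ℚ → ℝ
fromℚ q = mkℝ (const q) (const-cauchy q)

fromℕ : ℕ → ℝ
fromℕ n = fromℚ (+ n / 1)

0ℝ 1ℝ : ℝ
0ℝ = fromℚ 0ℚ
1ℝ = fromℚ 1ℚ

infixl 6 _+ℝ_ _-ℝ_
infixl 7 _*ℝ_ _/ℝ_
infix  8 -ℝ_
infixr 8 _^ℝ_

_+ℝ_ _*ℝ_ : ℝ → ℝ → ℝ
x +ℝ y = mkℝ (λ n → seq x n ℚ.+ seq y n) (+-cauchy {seq x} {seq y} (cauchy x) (cauchy y))
x *ℝ y = mkℝ (λ n → seq x n ℚ.* seq y n) (*-cauchy {seq x} {seq y} (cauchy x) (cauchy y))

-ℝ_ : ℝ → ℝ
-ℝ x = mkℝ (λ n → ℚ.- seq x n) (neg-cauchy {seq x} (cauchy x))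

_-ℝ_ : ℝ → ℝ → ℝ
x -ℝ y = x +ℝ (-ℝ y)

∣_∣ℝ : ℝ → ℝ
∣ x ∣ℝ = mkℝ (λ n → ℚ.∣ seq x n ∣) (abs-cauchy {seq x} (cauchy x))

_/ℝ_ : ℝ → (n : ℕ) .{{_ : NonZero n}} → ℝ
x /ℝ n = x *ℝ fromℚ (+ 1 / n)

_^ℝ_ : ℝ → ℕ → ℝ
x ^ℝ zero  = 1ℝ
x ^ℝ suc n = x *ℝ x ^ℝ n

∑ℝ : ∀ {a} {A : Set a} → List A → (A → ℝ) → ℝ
∑ℝ xs f = List.foldr (λ x s → f x +ℝ s) 0ℝ xs

∑ℚ : ℕ → (ℕ → ℚ) → ℚ
∑ℚ zero    f = 0ℚ
∑ℚ (suc c) f = ∑ℚ c f ℚ.+ f c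

-- The Riemann sum of ∫₁ⁿ dt/t with mesh 1/m and right endpoints 1 + (i + 1)/m,
-- whose i-th term is (1/m) · 1/(1 + (i + 1)/m) = 1/(m + i + 1).
logSum : ℕ → ℕ → ℚ
logSum n m = ∑ℚ (pred n ℕ.* m) (λ i → + 1 / suc (m ℕ.+ i))

module LogLemmas where

  private module ℚ≤ = ℚ.≤-Reasoning

  instance
    nz-* : ∀ {a r} .{{_ : NonZero a}} .{{_ : NonZero r}} → NonZero (a ℕ.* r)
    nz-* {a} {r} = ℕ.m*n≢0 a r

  inv : (a : ℕ) .{{_ : NonZero a}} → ℚ
  inv a = + 1 / a

  /-mono : ∀ a b c d .{{_ : NonZero b}} .{{_ : NonZero d}} →
    a ℕ.* d ℕ.≤ c ℕ.* b → + a / b ℚ.≤ + c / d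
  /-mono a (suc b) c (suc d) h = ℚ.toℚᵘ-cancel-≤
    (ℚᵘ.≤-respˡ-≃ (ℚᵘ.≃-sym (ℚ.toℚᵘ-fromℚᵘ (ℚᵘ.mkℚᵘ (+ a) b)))
    (ℚᵘ.≤-respʳ-≃ (ℚᵘ.≃-sym (ℚ.toℚᵘ-fromℚᵘ (ℚᵘ.mkℚᵘ (+ c) d)))
    (ℚᵘ.*≤* (subst (ℤ._≤ _) (ℤ.pos-* a (suc d)) (subst (_ ℤ.≤_) (ℤ.pos-* c (suc b)) (ℤ.+≤+ h))))))

  inv-anti : ∀ {a b} .{{_ : NonZero a}} .{{_ : NonZero b}} → a ℕ.≤ b → inv b ℚ.≤ inv a
  inv-anti {a} {b} h = /-mono 1 b 1 a (ℕ.*-monoʳ-≤ 1 h)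

  ∑-mono : ∀ c {f g} → (∀ i → i ℕ.< c → f i ℚ.≤ g i) → ∑ℚ c f ℚ.≤ ∑ℚ c g
  ∑-mono zero    h = ℚ.≤-refl
  ∑-mono (suc c) h = ℚ.+-mono-≤ (∑-mono c (λ i i<c → h i (ℕ.m<n⇒m<1+n i<c))) (h c (ℕ.n<1+n c))

  ∑-cong : ∀ c {f g} → f ≗ g → ∑ℚ c f ≡ ∑ℚ c g
  ∑-cong zero    h = refl
  ∑-cong (suc c) h = cong₂ ℚ._+_ (∑-cong c h) (h c)

  ∑-const : ∀ c m .{{_ : NonZero m}} → ∑ℚ c (const (inv m)) ≡ + c / m
  ∑-const zero    (suc m) = sym (ℚ.0/n≡0 (suc m))
  ∑-const (suc c) (suc m) = trans (cong (ℚ._+ inv (suc m)) (∑-const c (suc m)))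
    (ℚ.toℚᵘ-injective
      (ℚᵘ.≃-trans (ℚ.toℚᵘ-homo-+ (+ c / suc m) (+ 1 / suc m))
      (ℚᵘ.≃-trans (ℚᵘ.+-cong (ℚ.toℚᵘ-fromℚᵘ (ℚᵘ.mkℚᵘ (+ c) m)) (ℚ.toℚᵘ-fromℚᵘ (ℚᵘ.mkℚᵘ (+ 1) m)))
      (ℚᵘ.≃-trans (ℚᵘ.*≡* (ℤSolver.solve 2
          (λ c m → (c :* m :+ con (+ 1) :* m) :* m := (con (+ 1) :+ c) :* (m :* m))
          refl (+ c) (+ suc m)))
        (ℚᵘ.≃-sym (ℚ.toℚᵘ-fromℚᵘ (ℚᵘ.mkℚᵘ (+ suc c) m)))))))
    where open ℤSolver

  ∑-+ : ∀ c d f → ∑ℚ (c ℕ.+ d) f ≡ ∑ℚ c f ℚ.+ ∑ℚ d (λ i → f (c ℕ.+ i))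
  ∑-+ c zero    f rewrite ℕ.+-identityʳ c = sym (ℚ.+-identityʳ _)
  ∑-+ c (suc d) f rewrite ℕ.+-suc c d | ∑-+ c d f = ℚ.+-assoc (∑ℚ c f) _ _

  lower : ℕ → ℕ → ℚ
  lower a c = ∑ℚ c (λ i → + 1 / suc (a ℕ.+ i))

  refine-block : ∀ b r .{{_ : NonZero r}} → + 1 / suc b ℚ.≤ lower (b ℕ.* r) r
  refine-block b r = at (suc b ℕ.* r) {{ℕ.m*n≢0 (suc b) r}} refl
    where
    at : ∀ q .{{_ : NonZero q}} → suc b ℕ.* r ≡ q → + 1 / suc b ℚ.≤ lower (b ℕ.* r) r
    at q eq = ℚ≤.begin
      + 1 / suc b
        ℚ≤.≤⟨ /-mono 1 (suc b) r q (ℕ.≤-reflexive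
                (trans (ℕ.*-identityˡ q) (trans (sym eq) (ℕ.*-comm (suc b) r)))) ⟩
      + r / q
        ℚ≤.≡⟨ sym (∑-const r q) ⟩
      ∑ℚ r (const (inv q))
        ℚ≤.≤⟨ ∑-mono r (λ i i<r → inv-anti (subst (suc (b ℕ.* r ℕ.+ i) ℕ.≤_) eq
                (subst (suc (b ℕ.* r ℕ.+ i) ℕ.≤_) (ℕ.+-comm (b ℕ.* r) r)
                  (ℕ.≤-trans (ℕ.≤-reflexive (sym (ℕ.+-suc (b ℕ.* r) i)))
                             (ℕ.+-monoʳ-≤ (b ℕ.* r) i<r))))) ⟩
      lower (b ℕ.* r) r ℚ≤.∎

  coarsen-block : ∀ b r .{{_ : NonZero b}} .{{_ : NonZero r}} → lower (b ℕ.* r) r ℚ.≤ inv b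
  coarsen-block b r = ℚ≤.begin
    lower (b ℕ.* r) r
      ℚ≤.≤⟨ ∑-mono r (λ i _ → inv-anti (ℕ.m≤n⇒m≤1+n (ℕ.m≤m+n (b ℕ.* r) i))) ⟩
    ∑ℚ r (const (inv (b ℕ.* r)))
      ℚ≤.≡⟨ ∑-const r (b ℕ.* r) ⟩
    + r / (b ℕ.* r)
      ℚ≤.≤⟨ /-mono r (b ℕ.* r) 1 b
              (ℕ.≤-reflexive (trans (ℕ.*-comm r b) (sym (ℕ.*-identityˡ (b ℕ.* r))))) ⟩
    inv b ℚ≤.∎

  -- Refining the mesh raises the lower sums and keeps them below the upper sums,
  -- for f a = 1/a; f is kept abstract here, as open terms n / d normalise badly.
  module Refinement (f : ℕ → ℚ) where

    L : ℕ → ℕ → ℚ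
    L a c = ∑ℚ c (λ i → f (suc (a ℕ.+ i)))

    module _ (f≥0 : ∀ a → 0ℚ ℚ.≤ f a)
             (fine≥ : ∀ b r .{{_ : NonZero r}} → f (suc b) ℚ.≤ L (b ℕ.* r) r)
             (fine≤ : ∀ b r .{{_ : NonZero b}} .{{_ : NonZero r}} → L (b ℕ.* r) r ℚ.≤ f b)
             where

      L-suc-block : ∀ a c r →
        L (a ℕ.* r) (suc c ℕ.* r) ≡ L (a ℕ.* r) (c ℕ.* r) ℚ.+ L ((a ℕ.+ c) ℕ.* r) r
      L-suc-block a c r = trans
        (cong (L (a ℕ.* r)) (ℕ.+-comm r (c ℕ.* r)))
        (trans (∑-+ (c ℕ.* r) r _)
          (cong (L (a ℕ.* r) (c ℕ.* r) ℚ.+_)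
            (∑-cong r (λ i → cong (λ j → f (suc j))
              (trans (sym (ℕ.+-assoc (a ℕ.* r) (c ℕ.* r) i))
                     (cong (ℕ._+ i) (sym (ℕ.*-distribʳ-+ r a c))))))))

      refine : ∀ a c r .{{_ : NonZero r}} → L a c ℚ.≤ L (a ℕ.* r) (c ℕ.* r)
      refine a zero    r = ℚ.≤-refl
      refine a (suc c) r = ℚ.≤-trans
        (ℚ.+-mono-≤ (refine a c r) (fine≥ (a ℕ.+ c) r))
        (ℚ.≤-reflexive (sym (L-suc-block a c r)))

      coarsen : ∀ a c r .{{_ : NonZero a}} .{{_ : NonZero r}} →
        L (a ℕ.* r) (c ℕ.* r) ℚ.+ f (a ℕ.+ c) ℚ.≤ L a c ℚ.+ f a
      coarsen a zero    r rewrite ℕ.+-identityʳ a = ℚ.≤-refl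
      coarsen a (suc c) r rewrite ℕ.+-suc a c | L-suc-block a c r = ℚ≤.begin
        (X ℚ.+ L ((a ℕ.+ c) ℕ.* r) r) ℚ.+ v
          ℚ≤.≤⟨ ℚ.+-monoˡ-≤ v (ℚ.+-monoʳ-≤ X (fine≤ (a ℕ.+ c) r {{nonZero-+ a c}})) ⟩
        (X ℚ.+ f (a ℕ.+ c)) ℚ.+ v  ℚ≤.≤⟨ ℚ.+-monoˡ-≤ v (coarsen a c r) ⟩
        (L a c ℚ.+ f a) ℚ.+ v      ℚ≤.≡⟨ exchange (L a c) (f a) v ⟩
        (L a c ℚ.+ v) ℚ.+ f a      ℚ≤.∎
        where
        nonZero-+ : ∀ a c .{{_ : NonZero a}} → NonZero (a ℕ.+ c)
        nonZero-+ (suc a) c = _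
        X = L (a ℕ.* r) (c ℕ.* r)
        v = f (suc (a ℕ.+ c))
        exchange : ∀ x y z → (x ℚ.+ y) ℚ.+ z ≡ (x ℚ.+ z) ℚ.+ y
        exchange = solve 3 (λ x y z → (x :+ y) :+ z := (x :+ z) :+ y) refl
          where open +-*-Solver

      compare : ∀ N m m′ .{{_ : NonZero m}} .{{_ : NonZero m′}} →
        L m (N ℕ.* m) ℚ.≤ L m′ (N ℕ.* m′) ℚ.+ f m′
      compare N m m′ = ℚ≤.begin
        L m (N ℕ.* m)
          ℚ≤.≤⟨ refine m (N ℕ.* m) m′ ⟩
        L (m ℕ.* m′) (N ℕ.* m ℕ.* m′)
          ℚ≤.≡⟨ cong₂ L (ℕ.*-comm m m′)
                  (trans (ℕ.*-assoc N m m′)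
                    (trans (cong (N ℕ.*_) (ℕ.*-comm m m′))
                      (sym (ℕ.*-assoc N m′ m)))) ⟩
        M
          ℚ≤.≡⟨ sym (ℚ.+-identityʳ M) ⟩
        M ℚ.+ 0ℚ
          ℚ≤.≤⟨ ℚ.+-monoʳ-≤ M (f≥0 (m′ ℕ.+ N ℕ.* m′)) ⟩
        M ℚ.+ f (m′ ℕ.+ N ℕ.* m′)
          ℚ≤.≤⟨ coarsen m′ (N ℕ.* m′) m ⟩
        L m′ (N ℕ.* m′) ℚ.+ f m′ ℚ≤.∎
        where M = L (m′ ℕ.* m) (N ℕ.* m′ ℕ.* m)

  recip : ℕ → ℚ
  recip zero    = 0ℚ
  recip (suc a) = + 1 / suc a

  recip≥0 : ∀ a → 0ℚ ℚ.≤ recip a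
  recip≥0 zero    = ℚ.≤-refl
  recip≥0 (suc a) = ℚ.nonNegative⁻¹ (+ 1 / suc a) {{ℚ.normalize-nonNeg 1 (suc a)}}

  coarsen-block′ : ∀ b r .{{_ : NonZero b}} .{{_ : NonZero r}} → lower (b ℕ.* r) r ℚ.≤ recip b
  coarsen-block′ (suc b) r = coarsen-block (suc b) r

  logSum-≤ : ∀ n m m′ → logSum n (suc m) ℚ.≤ logSum n (suc m′) ℚ.+ inv (suc m′)
  logSum-≤ n m m′ = Refinement.compare recip recip≥0 refine-block coarsen-block′
    (pred n) (suc m) (suc m′)

  inv-small : ∀ e .{{_ : ℚ.Positive e}} m → ℚ.↧ₙ e ℕ.≤ m → inv (suc m) ℚ.≤ e
  inv-small e@(ℚ.mkℚ ℤ.+[1+ p ] d _) m h = subst (inv (suc m) ℚ.≤_) (ℚ.↥p/↧p≡p e)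
    (/-mono 1 (suc m) (suc p) (suc d)
      (ℕ.≤-trans (ℕ.≤-reflexive (ℕ.*-identityˡ (suc d)))
        (ℕ.≤-trans (ℕ.m≤n⇒m≤1+n h) (ℕ.m≤m+n (suc m) (p ℕ.* suc m)))))

  logSum-cauchy : ∀ n → Cauchy (λ m → logSum n (suc m))
  logSum-cauchy n e = ℚ.↧ₙ e , λ i j ≤i ≤j → ∣∣-cauchy
    (ℚ.≤-trans (logSum-≤ n i j)
      (ℚ.+-monoʳ-≤ (logSum n (suc j)) (inv-small e j ≤j)))
    (ℚ.≤-trans (logSum-≤ n j i)
      (ℚ.+-monoʳ-≤ (logSum n (suc i)) (inv-small e i ≤i)))

open LogLemmas using (logSum-cauchy)

log : (n : ℕ) .{{_ : NonZero n}} → ℝ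
log n = mkℝ (λ m → logSum n (suc m)) (logSum-cauchy n)

Eventually : ((n : ℕ) .{{_ : NonZero n}} → Set) → Set
Eventually P = ∃[ N ] ∀ n .{{_ : NonZero n}} → N ℕ.≤ n → P n

TendsToInfinity : (ℕ → ℝ) → Set
TendsToInfinity f = ∀ M → Eventually λ n → fromℚ M ≤ℝ f n

IsLittleO1 : ((n : ℕ) .{{_ : NonZero n}} → ℝ) → Set
IsLittleO1 f = ∀ e .{{_ : ℚ.Positive e}} → Eventually λ n → ∣ f n ∣ℝ ≤ℝ fromℚ e

module _ {a ℓ} {A : Set a} {E : Rel A ℓ} (E? : Decidable E) (_≟_ : DecidableEquality A) where

  private
    -- Warshall: chains whose intermediate elements all lie in the given list.
    Reach : List A → Rel A (a ⊔ ℓ)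
    Reach []       x y = x ≡ y ⊎ E x y
    Reach (z ∷ zs) x y = Reach zs x y ⊎ (Reach zs x z × Reach zs z y)

    reach? : ∀ zs → Decidable (Reach zs)
    reach? []       x y = (x ≟ y) ⊎-dec E? x y
    reach? (z ∷ zs) x y = reach? zs x y ⊎-dec (reach? zs x z ×-dec reach? zs z y)

    reach⇒star : ∀ zs {x y} → Reach zs x y → Star E x y
    reach⇒star []       (inj₁ refl)    = ε
    reach⇒star []       (inj₂ e)       = e ◅ ε
    reach⇒star (z ∷ zs) (inj₁ r)       = reach⇒star zs r
    reach⇒star (z ∷ zs) (inj₂ (r , s)) = reach⇒star zs r ◅◅ reach⇒star zs s

    weaken : ∀ zs {x y} → Reach [] x y → Reach zs x y
    weaken []       r = r
    weaken (z ∷ zs) r = inj₁ (weaken zs r)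

    through : ∀ {zs z x y} → z ∈ zs → Reach zs x z → Reach zs z y → Reach zs x y
    through (here refl) r s = inj₂ (toHead r , fromHead s)
      where
      toHead : ∀ {x z zs} → Reach (z ∷ zs) x z → Reach zs x z
      toHead (inj₁ r)       = r
      toHead (inj₂ (r , _)) = r
      fromHead : ∀ {z y zs} → Reach (z ∷ zs) z y → Reach zs z y
      fromHead (inj₁ r)       = r
      fromHead (inj₂ (_ , r)) = r
    through (there i) (inj₁ r)       (inj₁ s)       = inj₁ (through i r s)
    through (there i) (inj₁ r)       (inj₂ (s , t)) = inj₂ (through i r s , t)
    through (there i) (inj₂ (q , r)) (inj₁ s)       = inj₂ (q , through i r s)
    through (there i) (inj₂ (q , r)) (inj₂ (s , t)) = inj₂ (q , t)

  star? : ∀ zs → (∀ {x y} → E x y → y ∈ zs) → Decidable (Star E)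
  star? zs inside x y = map′ (reach⇒star zs) star⇒reach (reach? zs x y)
    where
    star⇒reach : ∀ {x y} → Star E x y → Reach zs x y
    star⇒reach ε       = weaken zs (inj₁ refl)
    star⇒reach (e ◅ s) = through (inside e) (weaken zs (inj₂ e)) (star⇒reach s)

-- Simplices are indexed by their number of vertices m, so that m = 0 gives the
-- empty simplex and C^{-1} below needs no separate treatment.
record OrderedSimplex (n m : ℕ) : Set where
  constructor mkSimplex
  field
    vertices  : Vec (Fin n) m
    .distinct : Unique vertices

open OrderedSimplex public

private
  ∀-removeAt : ∀ {n m} {P : Fin n → Set} {v : Vec (Fin n) (suc m)} →
    All.All P v → ∀ i → All.All P (removeAt v i)
  ∀-removeAt                  (_ All.∷ ps)      Fin.zero    = ps
  ∀-removeAt {v = _ ∷ _ ∷ _} (p All.∷ ps) (Fin.suc i) = p All.∷ ∀-removeAt ps i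

  unique-removeAt : ∀ {n m} {v : Vec (Fin n) (suc m)} →
    Unique v → ∀ i → Unique (removeAt v i)
  unique-removeAt                 (_ ∷ us) Fin.zero    = us
  unique-removeAt {v = _ ∷ _ ∷ _} (u ∷ us) (Fin.suc i) = ∀-removeAt u i ∷ unique-removeAt us i

removeVertex : ∀ {n m} → OrderedSimplex n (suc m) → Fin (suc m) → OrderedSimplex n m
removeVertex (mkSimplex v u) i = mkSimplex (removeAt v i) (unique-removeAt u i)

_≟ˢ_ : ∀ {n m} → DecidableEquality (OrderedSimplex n m)
mkSimplex v _ ≟ˢ mkSimplex w _ = map′ (λ { refl → refl }) (cong vertices) (Vec.≡-dec Fin._≟_ v w)

unique? : ∀ {n m} → U.Decidable (Unique {A = Fin n} {m})
unique? = AllPairs.allPairs? (λ i j → ¬? (i Fin.≟ j))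

vectors : ∀ n m → List (Vec (Fin n) m)
vectors n zero    = [] ∷ []
vectors n (suc m) = cartesianProductWith _∷_ (allFin n) (vectors n m)

distinctOnes : ∀ {n m} → List (Vec (Fin n) m) → List (OrderedSimplex n m)
distinctOnes []       = []
distinctOnes (v ∷ vs) with unique? v
... | yes u = mkSimplex v u ∷ distinctOnes vs
... | no  _ = distinctOnes vs

orderedSimplices : ∀ n m → List (OrderedSimplex n m)
orderedSimplices n m = distinctOnes (vectors n m)

∈-vectors : ∀ {n m} (v : Vec (Fin n) m) → v ∈ vectors n m
∈-vectors []      = here refl
∈-vectors (i ∷ v) = ∈-cartesianProductWith⁺ _∷_ (∈-allFin i) (∈-vectors v)

∈-orderedSimplices : ∀ {n m} (σ : OrderedSimplex n m) → σ ∈ orderedSimplices n m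
∈-orderedSimplices (mkSimplex v u) = go (∈-vectors v)
  where
  go : ∀ {vs} → v ∈ vs → mkSimplex v u ∈ distinctOnes vs
  go {w ∷ vs} v∈ with unique? w | v∈
  ... | yes _ | here refl = here refl
  ... | yes _ | there i   = there (go i)
  ... | no ¬u | here refl = contradiction-irr u ¬u
  ... | no _  | there i   = go i

-- An unordered face is represented by its increasing ordering; whether a
-- skew-symmetric function vanishes on a face does not depend on the ordering.
faces : ∀ n m → List (OrderedSimplex n m)
faces n m = List.filter (AllPairs.allPairs? Fin._<?_ ∘ vertices) (orderedSimplices n m)

vertexSet : ∀ {n m} → OrderedSimplex n m → Subset n
vertexSet σ = Vec.foldr _ (λ i s → ⁅ i ⁆ ∪ s) Subset.⊥ (vertices σ)

all-simplices? : ∀ {n m p} {P : OrderedSimplex n m → Set p} → U.Decidable P → Dec (∀ σ → P σ)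
all-simplices? {n} {m} P? = map′
  (λ h σ → ListAll.lookup h (∈-orderedSimplices σ))
  (λ h → ListAll.universal h (orderedSimplices n m))
  (ListAll.all? P? (orderedSimplices n m))

-- Neighbours are m-sets meeting in m - 1 vertices; a chain starting in F stays in F.
Step : ∀ {n m} → List (OrderedSimplex n m) → Rel (OrderedSimplex n m) 0ℓ
Step {m = m} F σ τ = τ ∈ F × ∣ vertexSet σ ∩ vertexSet τ ∣ ≡ m ∸ 1

Connected : ∀ {n m} → List (OrderedSimplex n m) → Set
Connected F = ∀ σ τ → σ ∈ F → τ ∈ F → Star (Step F) σ τ

connected? : ∀ {n m} (F : List (OrderedSimplex n m)) → Dec (Connected F)
connected? {m = m} F =
  all-simplices? λ σ → all-simplices? λ τ →
    (σ ∈? F) →-dec ((τ ∈? F) →-dec star? step? _≟ˢ_ F proj₁ σ τ)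
  where
  _∈?_ : ∀ σ xs → Dec (σ ∈ xs)
  σ ∈? xs = Any.any? (σ ≟ˢ_) xs
  step? : Decidable (Step F)
  step? σ τ = (τ ∈? F) ×-dec (∣ vertexSet σ ∩ vertexSet τ ∣ ℕ.≟ m ∸ 1)

record FiniteAbelianGroup c ℓ : Set (lsuc (c ⊔ ℓ)) where
  field
    abelianGroup : AbelianGroup c ℓ
    order        : ℕ
    enumeration  : Inverse (setoid (Fin order)) (AbelianGroup.setoid abelianGroup)

  open AbelianGroup abelianGroup public renaming (setoid to ≈-setoid; sym to ≈-sym; trans to ≈-trans)
  open Inverse enumeration

  elements : List Carrier
  elements = List.map to (allFin order)

  _≟_ : Decidable _≈_
  x ≟ y = map′ (λ eq → ≈-trans (≈-sym (strictlyInverseˡ x))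
                         (≈-trans (to-cong eq) (strictlyInverseˡ y)))
               from-cong (from x Fin.≟ from y)

-- All functions A → B taking the value b off the list xs, each listed once if
-- xs and bs have no repetitions.
functions : ∀ {a b} {A : Set a} {B : Set b} →
  DecidableEquality A → B → List B → List A → List (A → B)
functions _≟_ b bs []       = const b ∷ []
functions _≟_ b bs (x ∷ xs) = cartesianProductWith
  (λ r f y → if does (y ≟ x) then r else f y) bs (functions _≟_ b bs xs)

module Cochains {c ℓ} (R : FiniteAbelianGroup c ℓ) (n : ℕ) where

  open FiniteAbelianGroup R using (Carrier; _≈_; _∙_; _⁻¹; rawMonoid; elements; _≟_)
    renaming (ε to 0#)

  Function : ℕ → Set c
  Function m = OrderedSimplex n m → Carrier

  swap : ∀ {m} → Vec (Fin n) m → Fin m → Fin m → Vec (Fin n) m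
  swap v i j = v [ i ]≔ lookup v j [ j ]≔ lookup v i

  SkewSymmetric : ∀ {m} → Function m → Set ℓ
  SkewSymmetric φ = ∀ σ τ i j → i ≢ j →
    vertices τ ≡ swap (vertices σ) i j → φ τ ≈ φ σ ⁻¹

  skewSymmetric? : ∀ {m} → U.Decidable (SkewSymmetric {m})
  skewSymmetric? φ = all-simplices? λ σ → all-simplices? λ τ →
    Fin.all? λ i → Fin.all? λ j → ¬? (i Fin.≟ j) →-dec
      (Vec.≡-dec Fin._≟_ (vertices τ) (swap (vertices σ) i j) →-dec (φ τ ≟ (φ σ ⁻¹)))

  -- C^{m-1}(Δ_{n-1}), each cochain listed exactly once.
  cochains : ∀ m → List (Function m)
  cochains m = List.filter skewSymmetric? (functions _≟ˢ_ 0# elements (orderedSimplices n m))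

  [-1]^_·_ : ℕ → Carrier → Carrier
  [-1]^ zero  · x = x
  [-1]^ suc i · x = ([-1]^ i · x) ⁻¹

  d : ∀ {m} → Function m → Function (suc m)
  d φ σ = RawMonoid.sum rawMonoid (λ i → [-1]^ toℕ i · φ (removeVertex σ i))

  _≢0? : U.Decidable (λ x → ¬ (x ≈ 0#))
  x ≢0? = ¬? (x ≟ 0#)

  supp : ∀ {m} → Function m → List (OrderedSimplex n m)
  supp {m} φ = List.filter (λ σ → φ σ ≢0?) (faces n m)

  size : ∀ {m} → Function m → ℕ
  size φ = List.length (supp φ)

  b : ∀ {m} → Function m → ℕ
  b φ = size (d φ)

  -- The initial value size φ of the minimum is the term ψ = 0.
  w : ∀ {k} .{{_ : NonZero k}} → Function k → ℕ
  w {suc m} φ = Extrema.min (size φ) (List.map (λ ψ → size (λ σ → φ σ ∙ d ψ σ)) (cochains m))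

  In𝒢 : ∀ {k} .{{_ : NonZero k}} → Function k → Set ℓ
  In𝒢 φ = ¬ (∀ σ → φ σ ≈ 0#) × Connected (supp φ) × w φ ≡ size φ

  in𝒢? : ∀ {k} .{{_ : NonZero k}} → U.Decidable (In𝒢 {k})
  in𝒢? φ = ¬? (all-simplices? (λ σ → φ σ ≟ 0#)) ×-dec (connected? (supp φ) ×-dec (w φ ℕ.≟ size φ))

  𝒢 : ∀ k .{{_ : NonZero k}} → List (Function k)
  𝒢 k = List.filter in𝒢? (cochains k)

p : ℕ → (ℕ → ℝ) → (n : ℕ) .{{_ : NonZero n}} → ℝ
p k ω n = (fromℕ k *ℝ log n +ℝ ω n) /ℝ n

{-# OPTIONS --safe #-}

-- Let F = supp φ, m = |F| and b = b(φ).  With ψ_u(η) = φ(uη) one has (φ - dψ_u)(σ) = dφ(uσ), so minimality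
-- of φ and summation over u give n m ≤ (k + 1) b.  Choose greedily a set S ⊆ F of at most m / t faces such
-- that no face of F has more than t neighbours in the set W of members of F not adjacent to S.  Counting
-- the k-simplices with exactly one face in F gives |W| n ≤ |W| k + b + m t.  The cochain φ is determined
-- by S, its values on the at most n (k + 1) |S| neighbours of S, and its restriction to W.  Weighting these
-- choices and playing the two lower bounds for b against (1 - p)^n ≤ n^(-k) 2^(-κ) bounds the sum by 2^(-η).
-- If m is at most n divided by a large multiple of log n, one takes S = ∅ and t = m; otherwise t is a small
-- multiple of n.  All estimates use powers of two, with 2^l ≤ n < 2^(l + 1).
module Submission where

open import Defs
open import Algebra.Bundles using (AbelianGroup; CommutativeRing)
import Algebra.Definitions.RawMonoid as RawMonoid
import Algebra.Properties.AbelianGroup as AbelianGroupProperties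
import Algebra.Properties.CommutativeMonoid.Mult as CommutativeMonoidMult
import Algebra.Properties.CommutativeSemiring.Exp as Exp
import Algebra.Properties.Monoid.Mult as Mult
import Algebra.Properties.Semiring.Mult as SemiringMult
open import Data.Bool.Base using (if_then_else_)
open import Data.Empty using (⊥; ⊥-elim)
open import Data.Fin.Base using (Fin; toℕ)
import Data.Fin.Base as Fin
import Data.Fin.Properties as Fin
open import Data.Integer.Base using (+_)
import Data.Integer.Base as ℤ
open import Data.List.Base as List
  using (List; []; _∷_; _++_; length; cartesianProductWith; cartesianProduct; allFin; filter)
open import Data.List.Membership.Propositional using (_∈_; _∉_; find; lose)
import Data.List.Membership.Propositional.Properties as ∈
import Data.List.Properties as List
open import Data.List.Relation.Unary.All as LAll using ([]; _∷_)
open import Data.List.Relation.Unary.AllPairs as LAllPairs using ([]; _∷_)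
open import Data.List.Relation.Unary.Any as LAny using (here; there)
import Data.List.Relation.Unary.Unique.Propositional as LUnique
import Data.List.Relation.Unary.Unique.Propositional.Properties as LUnique
open import Data.Nat.Base as ℕ using (ℕ; zero; suc; NonZero)
import Data.Nat.DivMod as ℕ
import Data.Nat.Properties as ℕ
open import Data.Nat.Solver using () renaming (module +-*-Solver to ℕSolver)
open import Data.Product.Base using (∃-syntax; ∃₂; _×_; _,_; proj₁; proj₂)
open import Data.Rational.Base as ℚ using (ℚ; 0ℚ; 1ℚ; ½)
import Data.Rational.Properties as ℚ
open import Data.Rational.Solver using (module +-*-Solver)
open import Data.Sum.Base using (_⊎_; inj₁; inj₂)
open import Data.Vec.Base as Vec using (Vec; []; _∷_; insertAt; removeAt; lookup)
import Data.Vec.Membership.Propositional as V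
import Data.Vec.Properties as Vec
open import Data.Vec.Relation.Unary.All as VAll using ([]; _∷_)
open import Data.Vec.Relation.Unary.AllPairs as VAllPairs using ([]; _∷_)
open import Data.Vec.Relation.Unary.Any as VAny using (here; there)
open import Data.Vec.Relation.Unary.Unique.Propositional using (Unique)
open import Function.Base using (_∘_; const; flip; id)
open import Function.Bundles using (Inverse)
open import Level using (Level)
open import Relation.Binary.Core using (Rel)
open import Relation.Binary.PropositionalEquality
  hiding (setoid; isEquivalence; isDecEquivalence; isPreorder)
open import Relation.Nullary.Decidable using (Dec; yes; no; does; ¬?; _×-dec_; decidable-stable)
open import Relation.Nullary.Negation using (¬_; contradiction; contradiction-irr)
import Relation.Unary as U

open CommutativeMonoidMult (CommutativeRing.+-commutativeMonoid ℚ.+-*-commutativeRing)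
  using () renaming (×-distrib-+ to ×ℚ-distrib-+)
open Exp (CommutativeRing.commutativeSemiring ℚ.+-*-commutativeRing)
  using (_^_; ^-homo-*; ^-assocʳ; ^-distrib-*)
open Mult (CommutativeRing.+-monoid ℚ.+-*-commutativeRing)
  using () renaming (_×_ to _×ℚ_; ×-assocˡ to ×ℚ-assocˡ; ×-homo-+ to ×ℚ-homo-+)
open SemiringMult (CommutativeRing.semiring ℚ.+-*-commutativeRing)
  using () renaming (×-assoc-* to ×ℚ-assoc-*; ×-comm-* to ×ℚ-comm-*)
open LogLemmas using (/-mono; recip; recip≥0; inv-anti; inv-small)

-- For supports of size m, (1-p)^b has to beat roughly (n^k / m)^m choices. Minimality alone gives
-- n^(-km/(k+1)), in general too weak; b close to nm would suffice, but needs most of the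
-- k-simplices that meet the support to have a single face in it. Hence S: crowded faces are
-- described cheaply as neighbours of S, while those left in W are nearly isolated. In the exponent,
-- b k l is split. The share b (k-1) l, by the sparse bound, pays for placing the faces of W, each
-- costing only about (k-1) l + v once m exceeds 2^(l-v). The remaining b l is at least n m l /
-- (k+1) by minimality; it pays for S, for the values near S, for v and for all error terms. For
-- smaller m a face costs the full k l; there t = m loses little, and κ, drawn from ω(n), covers the
-- constant overhead per face. Binomial coefficients do not appear: a small weight on each nonzero
-- value at an uncovered face makes the sum over all cochains factor over the faces.

private
  variable
    α β ℓ₁ : Level
    𝔸 : Set α
    𝔹 : Set β
    n m : ℕ

-- Increasing vectors

Increasing : Vec (Fin n) m → Set
Increasing = VAllPairs.AllPairs Fin._<_

increasing⇒unique : {v : Vec (Fin n) m} → Increasing v → Unique v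
increasing⇒unique = VAllPairs.map Fin.<⇒≢

position : Fin n → Vec (Fin n) m → Fin (suc m)
position u []      = Fin.zero
position u (x ∷ v) with u Fin.<? x
... | yes _ = Fin.zero
... | no  _ = Fin.suc (position u v)

insert : Fin n → Vec (Fin n) m → Vec (Fin n) (suc m)
insert u v = insertAt v (position u v) u

All-insertAt : ∀ {p} {P : Fin n → Set p} {v : Vec (Fin n) m} {x} i →
  P x → VAll.All P v → VAll.All P (insertAt v i x)
All-insertAt                 Fin.zero    px pv        = px ∷ pv
All-insertAt {v = _ ∷ _} (Fin.suc i) px (py ∷ pv) = py ∷ All-insertAt i px pv

insert-increasing : ∀ {u} {v : Vec (Fin n) m} → ¬ u V.∈ v → Increasing v → Increasing (insert u v)
insert-increasing {v = []} u∉ [] = [] ∷ []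
insert-increasing {u = u} {v = x ∷ v} u∉ (x< ∷ inc) with u Fin.<? x
... | yes u<x = (u<x ∷ VAll.map (Fin.<-trans u<x) x<) ∷ x< ∷ inc
... | no  u≮x = All-insertAt (position u v) x<u x< ∷ insert-increasing (u∉ ∘ there) inc
  where
  x<u = ℕ.≤∧≢⇒< (ℕ.≮⇒≥ u≮x) (λ eq → u∉ (here (sym (Fin.toℕ-injective eq))))

removeAt-All : ∀ {p} {P : Fin n → Set p} {v : Vec (Fin n) (suc m)} →
  VAll.All P v → ∀ i → VAll.All P (removeAt v i)
removeAt-All                 (_ ∷ pv)  Fin.zero    = pv
removeAt-All {v = _ ∷ _ ∷ _} (px ∷ pv) (Fin.suc i) = px ∷ removeAt-All pv i

removeAt-increasing : {v : Vec (Fin n) (suc m)} → Increasing v → ∀ i → Increasing (removeAt v i)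
removeAt-increasing                 (_ ∷ inc)  Fin.zero    = inc
removeAt-increasing {v = _ ∷ _ ∷ _} (x< ∷ inc) (Fin.suc i) =
  removeAt-All x< i ∷ removeAt-increasing inc i

insert-lookup-removeAt : {v : Vec (Fin n) (suc m)} → Increasing v → ∀ i →
  insert (lookup v i) (removeAt v i) ≡ v
insert-lookup-removeAt {v = v} inc i =
  trans (cong (λ j → insertAt (removeAt v i) j (lookup v i)) (position-removeAt inc i))
    (Vec.insertAt-removeAt v i)
  where
  position-removeAt : ∀ {m} {v : Vec (Fin n) (suc m)} → Increasing v → ∀ i →
    position (lookup v i) (removeAt v i) ≡ i
  position-removeAt {v = x ∷ []} _ Fin.zero = refl
  position-removeAt {v = x ∷ y ∷ v} ((x<y ∷ _) ∷ _) Fin.zero with x Fin.<? y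
  ... | yes _   = refl
  ... | no  x≮y = contradiction x<y x≮y
  position-removeAt {v = x ∷ y ∷ v} (x< ∷ inc) (Fin.suc i) with lookup (y ∷ v) i Fin.<? x
  ... | yes <x = contradiction (VAll.lookup⁺ x< i) (ℕ.<⇒≯ <x)
    where open import Data.Vec.Relation.Unary.All.Properties as VAll using (lookup⁺)
  ... | no  _  = cong Fin.suc (position-removeAt inc i)

removeAt-insert : (u : Fin n) (v : Vec (Fin n) m) → removeAt (insert u v) (position u v) ≡ v
removeAt-insert u v = Vec.removeAt-insertAt v (position u v) u

lookup-insert : (u : Fin n) (v : Vec (Fin n) m) → lookup (insert u v) (position u v) ≡ u
lookup-insert u v = Vec.insertAt-lookup v (position u v) u

insertAt-∈⁻ : ∀ {x u} (v : Vec (Fin n) m) i → x V.∈ insertAt v i u → x ≡ u ⊎ x V.∈ v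
insertAt-∈⁻ v       Fin.zero    (here eq)  = inj₁ eq
insertAt-∈⁻ v       Fin.zero    (there x∈) = inj₂ x∈
insertAt-∈⁻ (_ ∷ v) (Fin.suc i) (here eq)  = inj₂ (here eq)
insertAt-∈⁻ (_ ∷ v) (Fin.suc i) (there x∈) with insertAt-∈⁻ v i x∈
... | inj₁ eq = inj₁ eq
... | inj₂ x∈v = inj₂ (there x∈v)

∈-removeAt : (v : Vec (Fin n) (suc m)) {i j : Fin (suc m)} → i ≢ j → lookup v j V.∈ removeAt v i
∈-removeAt v i≢j = subst (V._∈ removeAt v _) (Vec.removeAt-punchOut v i≢j)
  (∈-lookup (Fin.punchOut i≢j) (removeAt v _))
  where open import Data.Vec.Membership.Propositional.Properties using (∈-lookup)

removeAt-∈⁻ : ∀ {x} (v : Vec (Fin n) (suc m)) i → x V.∈ removeAt v i → x V.∈ v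
removeAt-∈⁻ (_ ∷ v)         Fin.zero    x∈         = there x∈
removeAt-∈⁻ (_ ∷ v@(_ ∷ _)) (Fin.suc i) (here eq)  = here eq
removeAt-∈⁻ (_ ∷ v@(_ ∷ _)) (Fin.suc i) (there x∈) = there (removeAt-∈⁻ v i x∈)

∈⇒insertAt : ∀ {x} (v : Vec (Fin n) (suc m)) → x V.∈ v → ∃[ i ] v ≡ insertAt (removeAt v i) i x
∈⇒insertAt v x∈ = VAny.index x∈ ,
  trans (sym (Vec.insertAt-removeAt v (VAny.index x∈)))
    (cong (insertAt _ (VAny.index x∈)) (sym (lookup-index x∈)))
  where open import Data.Vec.Relation.Unary.Any.Properties using (lookup-index)

length-cartesianProductWith : ∀ {a b c} {A : Set a} {B : Set b} {C : Set c} (f : A → B → C) xs ys →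
  length (cartesianProductWith f xs ys) ≡ length xs ℕ.* length ys
length-cartesianProductWith f []       ys = refl
length-cartesianProductWith f (x ∷ xs) ys = trans (List.length-++ (List.map (f x) ys))
  (cong₂ ℕ._+_ (List.length-map (f x) ys) (length-cartesianProductWith f xs ys))

-- All pairs are listed, including those that return `v` itself or a vector with a repeated vertex:
-- an upper bound for the neighbourhood is enough, and the length becomes exactly `n * (m + 1)`.
neighbours : Vec (Fin n) m → List (Vec (Fin n) m)
neighbours {n} {m} v = cartesianProductWith (λ u i → removeAt (insert u v) i) (allFin n) (allFin (suc m))

length-neighbours : (v : Vec (Fin n) m) → length (neighbours v) ≡ n ℕ.* suc m
length-neighbours {n} {m} v = trans
  (length-cartesianProductWith _ (allFin n) (allFin (suc m)))
  (cong₂ ℕ._*_ (List.length-tabulate {n = n} id) (List.length-tabulate {n = suc m} id))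

-- Alternating functions on vectors

-- Adjacent transpositions instead of transpositions of two positions, so that skew symmetry is
-- inherited by `f ∘ (x ∷_)` and proofs recurse along the vector.
data AdjacentSwap {n : ℕ} : Vec (Fin n) m → Vec (Fin n) m → Set where
  here  : ∀ {x y} {v : Vec (Fin n) m} → AdjacentSwap (x ∷ y ∷ v) (y ∷ x ∷ v)
  there : ∀ {x} {v w : Vec (Fin n) m} → AdjacentSwap v w → AdjacentSwap (x ∷ v) (x ∷ w)

module AlternatingFunctions {c ℓ} (G : AbelianGroup c ℓ) (n : ℕ) where

  open AbelianGroup G hiding (sym; trans; refl)
  private module G = AbelianGroup G
  open AbelianGroupProperties G using (ε⁻¹≈ε; ⁻¹-anti-homo‿-; ⁻¹-∙-comm; ⁻¹-involutive; ⁻¹-injective)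
  open import Relation.Binary.Reasoning.Setoid setoid

  Skew : (Vec (Fin n) m → Carrier) → Set ℓ
  Skew f = ∀ {v w} → AdjacentSwap v w → f w ≈ f v ⁻¹

  -- Skew symmetry yields only that twice the value is zero on a vector with a repeated vertex. The
  -- group may have 2-torsion, so vanishing is a separate field.
  record Alternating (f : Vec (Fin n) m → Carrier) : Set ℓ where
    field
      skew   : Skew f
      vanish : ∀ {v} → ¬ Unique v → f v ≈ ε

  open Alternating

  cons-alternating : {f : Vec (Fin n) (suc m) → Carrier} → Alternating f →
    ∀ x → Alternating (f ∘ (x ∷_))
  cons-alternating alt x .skew   s  = alt .skew (there s)
  cons-alternating alt x .vanish ¬u = alt .vanish (λ { (_ ∷ u) → ¬u u })

  ε-skew : Skew {m} (const ε)
  ε-skew _ = G.sym ε⁻¹≈ε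

  -- Moving `x` from place `i` to the front takes `i` adjacent swaps, and each inverts both sides.
  -- With `g = const ε` this transports vanishing.
  agree-insertAt⁻ : {f g : Vec (Fin n) (suc m) → Carrier} → Skew f → Skew g →
    ∀ v i {x} → f (insertAt v i x) ≈ g (insertAt v i x) → f (x ∷ v) ≈ g (x ∷ v)
  agree-insertAt⁻         sf sg v       Fin.zero    eq = eq
  agree-insertAt⁻ {f = f} {g} sf sg (y ∷ v) (Fin.suc i) eq = G.trans (sf here) (G.trans (⁻¹-cong
    (agree-insertAt⁻ {f = f ∘ (y ∷_)} {g ∘ (y ∷_)} (sf ∘ there) (sg ∘ there) v i eq)) (G.sym (sg here)))

  agree-insertAt⁺ : {f g : Vec (Fin n) (suc m) → Carrier} → Skew f → Skew g →
    ∀ v i {x} → f (x ∷ v) ≈ g (x ∷ v) → f (insertAt v i x) ≈ g (insertAt v i x)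
  agree-insertAt⁺         sf sg v       Fin.zero    eq = eq
  agree-insertAt⁺ {f = f} {g} sf sg (y ∷ v) (Fin.suc i) eq =
    agree-insertAt⁺ {f = f ∘ (y ∷_)} {g ∘ (y ∷_)} (sf ∘ there) (sg ∘ there) v i
      (G.trans (sf here) (G.trans (⁻¹-cong eq) (G.sym (sg here))))

  ∈⇒¬unique : ∀ {x} {v : Vec (Fin n) m} → x V.∈ v → ¬ Unique (x ∷ v)
  ∈⇒¬unique x∈ (x∉ ∷ _) = VAll.lookup x∉ x∈ refl

  member? : (x : Fin n) (v : Vec (Fin n) m) → Dec (x V.∈ v)
  member? x v = VAny.any? (x Fin.≟_) v

  -- Insertion sort: the tail is sorted by induction with the head held fixed, then the head is
  -- moved to its place, unless it is repeated and both sides vanish.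
  agree-on-increasing : ∀ {m} {f g : Vec (Fin n) m → Carrier} → Alternating f → Alternating g →
    (∀ v → Increasing v → f v ≈ g v) → ∀ v → f v ≈ g v
  agree-on-increasing altf altg h []      = h [] []
  agree-on-increasing {f = f} {g} altf altg h (x ∷ v) =
    agree-on-increasing (cons-alternating altf x) (cons-alternating altg x) h′ v
    where
    h′ : ∀ w → Increasing w → f (x ∷ w) ≈ g (x ∷ w)
    h′ w inc with member? x w
    ... | yes x∈ = G.trans (altf .vanish (∈⇒¬unique x∈)) (G.sym (altg .vanish (∈⇒¬unique x∈)))
    ... | no  x∉ = agree-insertAt⁻ (altf .skew) (altg .skew) w (position x w)
                     (h (insert x w) (insert-increasing x∉ inc))

  -- The coboundary by recursion on the first vertex; `sum-faces` identifies it with the alternating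
  -- sum. In this form the identity between `∂ f (u ∷ σ)` and `f σ` minus the coboundary of the link
  -- of `u` is the defining equation.
  ∂ : (Vec (Fin n) m → Carrier) → Vec (Fin n) (suc m) → Carrier
  ∂ {zero}  f (x ∷ []) = f []
  ∂ {suc m} f (x ∷ v)  = f v - ∂ (f ∘ (x ∷_)) v

  ∂-cong : ∀ {m} {f g : Vec (Fin n) m → Carrier} → (∀ v → f v ≈ g v) → ∀ v → ∂ f v ≈ ∂ g v
  ∂-cong {zero}  h (x ∷ []) = h []
  ∂-cong {suc m} h (x ∷ v)  = ∙-cong (h v) (⁻¹-cong (∂-cong (h ∘ (x ∷_)) v))

  ∂-⁻¹ : ∀ {m} (f : Vec (Fin n) m → Carrier) v → ∂ (λ w → f w ⁻¹) v ≈ ∂ f v ⁻¹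
  ∂-⁻¹ {zero}  f (x ∷ []) = G.refl
  ∂-⁻¹ {suc m} f (x ∷ v)  = G.trans (∙-congˡ (⁻¹-cong (∂-⁻¹ (f ∘ (x ∷_)) v)))
    (⁻¹-∙-comm (f v) (∂ (f ∘ (x ∷_)) v ⁻¹))

  ∂-zero : ∀ {m} (f : Vec (Fin n) m → Carrier) v → (∀ i → f (removeAt v i) ≈ ε) → ∂ f v ≈ ε
  ∂-zero {zero}  f (x ∷ [])        h = h Fin.zero
  ∂-zero {suc m} f (x ∷ v@(_ ∷ _)) h = begin
    f v - ∂ (f ∘ (x ∷_)) v  ≈⟨ ∙-cong (h Fin.zero) (⁻¹-cong (∂-zero (f ∘ (x ∷_)) v (h ∘ Fin.suc))) ⟩
    ε - ε                   ≈⟨ inverseʳ ε ⟩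
    ε                       ∎

  ∂-single-face : ∀ {m} (f : Vec (Fin n) m → Carrier) v i →
    (∀ j → j ≢ i → f (removeAt v j) ≈ ε) → ∂ f v ≈ ε → f (removeAt v i) ≈ ε
  ∂-single-face {zero}  f (x ∷ [])        Fin.zero    h eq = eq
  ∂-single-face {suc m} f (x ∷ v@(_ ∷ _)) Fin.zero    h eq = begin
    f v                      ≈⟨ identityʳ (f v) ⟨
    f v ∙ ε                  ≈⟨ ∙-congˡ ε⁻¹≈ε ⟨
    f v - ε                  ≈⟨ ∙-congˡ (⁻¹-cong (∂-zero (f ∘ (x ∷_)) v (λ j → h (Fin.suc j) (λ ())))) ⟨
    f v - ∂ (f ∘ (x ∷_)) v   ≈⟨ eq ⟩
    ε                        ∎
  ∂-single-face {suc m} f (x ∷ v@(_ ∷ _)) (Fin.suc i) h eq =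
    ∂-single-face (f ∘ (x ∷_)) v i (λ j j≢i → h (Fin.suc j) (j≢i ∘ Fin.suc-injective))
      (⁻¹-injective (begin
        ∂ (f ∘ (x ∷_)) v ⁻¹      ≈⟨ identityˡ _ ⟨
        ε - ∂ (f ∘ (x ∷_)) v     ≈⟨ ∙-congʳ (h Fin.zero (λ ())) ⟨
        f v - ∂ (f ∘ (x ∷_)) v   ≈⟨ eq ⟩
        ε                        ≈⟨ ε⁻¹≈ε ⟨
        ε ⁻¹                     ∎))

  -- Only a swap of the two leading vertices needs work: unfolding `∂` twice shows the faces
  -- omitting one of them trading places with opposite signs, while the faces containing both change
  -- sign because `f` is skew.
  ∂-skew : ∀ {m} {f : Vec (Fin n) m → Carrier} → Skew f → Skew (∂ f)
  ∂-skew {zero}        sf (there ())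
  ∂-skew {suc zero}    {f} sf (here {x = x} {y} {[]}) = G.sym (⁻¹-anti-homo‿- (f (y ∷ [])) (f (x ∷ [])))
  ∂-skew {suc (suc m)} {f} sf (here {x = x} {y} {v}) = begin
    f (x ∷ v) - (f (y ∷ v) - ∂ (λ w → f (y ∷ x ∷ w)) v)
      ≈⟨ ∙-congˡ (⁻¹-anti-homo‿- (f (y ∷ v)) _) ⟩
    f (x ∷ v) ∙ (∂ (λ w → f (y ∷ x ∷ w)) v - f (y ∷ v))
      ≈⟨ assoc (f (x ∷ v)) _ _ ⟨
    f (x ∷ v) ∙ ∂ (λ w → f (y ∷ x ∷ w)) v - f (y ∷ v)
      ≈⟨ ∙-congʳ (∙-congˡ (G.trans (∂-cong (λ w → sf here) v) (∂-⁻¹ (λ w → f (x ∷ y ∷ w)) v))) ⟩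
    (f (x ∷ v) - ∂ (λ w → f (x ∷ y ∷ w)) v) - f (y ∷ v)
      ≈⟨ ⁻¹-anti-homo‿- (f (y ∷ v)) _ ⟨
    (f (y ∷ v) - (f (x ∷ v) - ∂ (λ w → f (x ∷ y ∷ w)) v)) ⁻¹ ∎
  ∂-skew {suc m} {f} sf (there {x = x} {v} {w} s) = begin
    f w - ∂ (f ∘ (x ∷_)) w           ≈⟨ ∙-cong (sf s) (⁻¹-cong (∂-skew (sf ∘ there) s)) ⟩
    f v ⁻¹ ∙ ∂ (f ∘ (x ∷_)) v ⁻¹ ⁻¹  ≈⟨ ⁻¹-∙-comm (f v) _ ⟩
    (f v - ∂ (f ∘ (x ∷_)) v) ⁻¹      ∎

  -- The faces omitting one copy of `x` cancel; every other face still contains both copies, so `f`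
  -- vanishes on it.
  ∂-repeated-head : ∀ {m} {f : Vec (Fin n) (suc m) → Carrier} → Alternating f → ∀ x v →
    ∂ f (x ∷ x ∷ v) ≈ ε
  ∂-repeated-head {zero}  {f} alt x []      = inverseʳ (f (x ∷ []))
  ∂-repeated-head {suc m} {f} alt x v@(_ ∷ _) = begin
    f (x ∷ v) - (f (x ∷ v) - ∂ (λ w → f (x ∷ x ∷ w)) v)
      ≈⟨ ∙-congˡ (⁻¹-cong (∙-congˡ (⁻¹-cong (∂-zero (λ w → f (x ∷ x ∷ w)) v
           (λ i → alt .vanish (∈⇒¬unique (here refl))))))) ⟩
    f (x ∷ v) - (f (x ∷ v) - ε)
      ≈⟨ ∙-congˡ (⁻¹-cong (G.trans (∙-congˡ ε⁻¹≈ε) (identityʳ _))) ⟩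
    f (x ∷ v) - f (x ∷ v)
      ≈⟨ inverseʳ (f (x ∷ v)) ⟩
    ε ∎

  ∂-repeated : ∀ {m} {f : Vec (Fin n) m → Carrier} → Alternating f → ∀ {x v} → x V.∈ v →
    ∂ f (x ∷ v) ≈ ε
  ∂-repeated {zero}  alt {v = []} ()
  ∂-repeated {suc m} {f} alt {x} {v} x∈ with ∈⇒insertAt v x∈
  ... | i , eq = subst (λ w → ∂ f (x ∷ w) ≈ ε) (sym eq)
    (agree-insertAt⁺ {f = ∂ f ∘ (x ∷_)} {const ε} (∂-skew (alt .skew) ∘ there) ε-skew (removeAt v i) i
      (∂-repeated-head alt x (removeAt v i)))

-- Counting and greedy covers

-- A pigeonhole principle for a relation, so that partners may be found by case analysis and
-- injectivity becomes the absence of common partners. Each partner used is cut out of `ys` before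
-- the next is sought.
length-inject : {R : 𝔸 → 𝔹 → Set ℓ₁} (xs : List 𝔸) (ys : List 𝔹) →
  LAllPairs.AllPairs (λ x x′ → ∀ {y} → R x y → R x′ y → ⊥) xs →
  (∀ {x} → x ∈ xs → ∃[ y ] y ∈ ys × R x y) →
  length xs ℕ.≤ length ys
length-inject         []       ys []         h = ℕ.z≤n
length-inject {R = R} (x ∷ xs) ys (x# ∷ xs#) h
  with h (here refl)
... | y , y∈ , Rxy with ∈.∈-∃++ y∈
... | ys₁ , ys₂ , refl = ℕ.≤-trans
  (ℕ.s≤s (length-inject {R = R} xs (ys₁ ++ ys₂) xs# h′))
  (ℕ.≤-reflexive (trans (cong suc (List.length-++ ys₁))
    (trans (sym (ℕ.+-suc (length ys₁) (length ys₂))) (sym (List.length-++ ys₁)))))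
  where
  h′ : ∀ {x′} → x′ ∈ xs → ∃[ y′ ] y′ ∈ ys₁ ++ ys₂ × R x′ y′
  h′ x′∈ with h (there x′∈)
  ... | y′ , y′∈ , Rx′y′ with ∈.∈-++⁻ ys₁ y′∈
  ... | inj₁ i           = y′ , ∈.∈-++⁺ˡ i , Rx′y′
  ... | inj₂ (there i)   = y′ , ∈.∈-++⁺ʳ ys₁ i , Rx′y′
  ... | inj₂ (here refl) = ⊥-elim (LAll.lookup x# x′∈ Rxy Rx′y′)

length-filter-split : {P : 𝔸 → Set ℓ₁} (P? : U.Decidable P) (xs : List 𝔸) →
  length (filter P? xs) ℕ.+ length (filter (¬? ∘ P?) xs) ≡ length xs
length-filter-split P? []       = refl
length-filter-split P? (x ∷ xs) with P? x
... | yes _ = cong suc (length-filter-split P? xs)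
... | no  _ = trans (ℕ.+-suc _ _) (cong suc (length-filter-split P? xs))

pairs : List 𝔸 → (𝔸 → List 𝔹) → List (𝔸 × 𝔹)
pairs []       g = []
pairs (x ∷ xs) g = List.map (x ,_) (g x) ++ pairs xs g

∈-pairs⁺ : ∀ {xs} {g : 𝔸 → List 𝔹} {x y} → x ∈ xs → y ∈ g x → (x , y) ∈ pairs xs g
∈-pairs⁺                 (here refl) y∈ = ∈.∈-++⁺ˡ (∈.∈-map⁺ _ y∈)
∈-pairs⁺ {xs = x ∷ _} {g} (there x∈)  y∈ = ∈.∈-++⁺ʳ (List.map (x ,_) (g x)) (∈-pairs⁺ x∈ y∈)

∈-pairs⁻ : ∀ xs {g : 𝔸 → List 𝔹} {x y} → (x , y) ∈ pairs xs g → x ∈ xs × y ∈ g x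
∈-pairs⁻ (z ∷ xs) {g} xy∈ with ∈.∈-++⁻ (List.map (z ,_) (g z)) xy∈
... | inj₂ i = let x∈ , y∈ = ∈-pairs⁻ xs i in there x∈ , y∈
... | inj₁ i with ∈.∈-map⁻ (z ,_) i
... | _ , y∈ , refl = here refl , y∈

pairs-unique : ∀ {xs} {g : 𝔸 → List 𝔹} → LUnique.Unique xs → (∀ x → LUnique.Unique (g x)) →
  LUnique.Unique (pairs xs g)
pairs-unique                  []       gu = []
pairs-unique {xs = x ∷ xs} {g} (x# ∷ u) gu = LUnique.++⁺
  (LUnique.map⁺ (λ { refl → refl }) (gu x)) (pairs-unique u gu)
  λ (i , j) → disjoint (∈.∈-map⁻ (x ,_) i) j
  where
  disjoint : ∀ {z} → (∃[ y ] y ∈ g x × z ≡ (x , y)) → z ∉ pairs xs g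
  disjoint (_ , _ , refl) j = LAll.lookup x# (proj₁ (∈-pairs⁻ xs j)) refl

length-pairs-≥ : ∀ xs {g : 𝔸 → List 𝔹} {m} → (∀ x → m ℕ.≤ length (g x)) →
  length xs ℕ.* m ℕ.≤ length (pairs xs g)
length-pairs-≥ []           h = ℕ.z≤n
length-pairs-≥ (x ∷ xs) {g} h = ℕ.≤-trans
  (ℕ.+-mono-≤ (ℕ.≤-trans (h x) (ℕ.≤-reflexive (sym (List.length-map (x ,_) (g x))))) (length-pairs-≥ xs h))
  (ℕ.≤-reflexive (sym (List.length-++ (List.map (x ,_) (g x)))))

length-pairs-≤ : ∀ xs {g : 𝔸 → List 𝔹} {m} → (∀ {x} → x ∈ xs → length (g x) ℕ.≤ m) →
  length (pairs xs g) ℕ.≤ length xs ℕ.* m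
length-pairs-≤ []           h = ℕ.z≤n
length-pairs-≤ (x ∷ xs) {g} h = ℕ.≤-trans
  (ℕ.≤-reflexive (List.length-++ (List.map (x ,_) (g x))))
  (ℕ.+-mono-≤ (ℕ.≤-trans (ℕ.≤-reflexive (List.length-map (x ,_) (g x))) (h (here refl)))
    (length-pairs-≤ xs (h ∘ there)))

infix 4 _∈?_
_∈?_ : ∀ {n m} (v : Vec (Fin n) m) (vs : List (Vec (Fin n) m)) → Dec (v ∈ vs)
v ∈? vs = LAny.any? (Vec.≡-dec Fin._≟_ v) vs

Γ : ∀ {n m} → List (Vec (Fin n) m) → List (Vec (Fin n) m)
Γ = List.concatMap neighbours

module _ {n m : ℕ} (F : List (Vec (Fin n) m)) where

  uncovered : List (Vec (Fin n) m) → List (Vec (Fin n) m)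
  uncovered []      = F
  uncovered (s ∷ S) = filter (λ σ → ¬? (σ ∈? neighbours s)) (uncovered S)

  uncovered⊆ : ∀ S {σ} → σ ∈ uncovered S → σ ∈ F
  uncovered⊆ []      σ∈ = σ∈
  uncovered⊆ (s ∷ S) σ∈ = uncovered⊆ S (proj₁ (∈.∈-filter⁻ _ σ∈))

  uncovered-unique : LUnique.Unique F → ∀ S → LUnique.Unique (uncovered S)
  uncovered-unique u []      = u
  uncovered-unique u (s ∷ S) = LUnique.filter⁺ _ (uncovered-unique u S)

  uncovered-or-Γ : ∀ S {σ} → σ ∈ F → σ ∈ uncovered S ⊎ σ ∈ Γ S
  uncovered-or-Γ []      σ∈ = inj₁ σ∈
  uncovered-or-Γ (s ∷ S) {σ} σ∈ with σ ∈? neighbours s | uncovered-or-Γ S σ∈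
  ... | yes i | _      = inj₂ (∈.∈-++⁺ˡ i)
  ... | no  i | inj₁ j = inj₁ (∈.∈-filter⁺ _ j i)
  ... | no  i | inj₂ j = inj₂ (∈.∈-++⁺ʳ (neighbours s) j)

  uncovered∉Γ : ∀ S {σ} → σ ∈ uncovered S → σ ∉ Γ S
  uncovered∉Γ (s ∷ S) σ∈ σ∈Γ with ∈.∈-filter⁻ (λ σ → ¬? (σ ∈? neighbours s)) {xs = uncovered S} σ∈
    | ∈.∈-++⁻ (neighbours s) σ∈Γ
  ... | _  , σ∉ | inj₁ i = σ∉ i
  ... | σ∈ , _  | inj₂ i = uncovered∉Γ S σ∈ i

  -- `σ` ranges over all of `F`, not only over `U`: the counting in `sparse-bound` charges uncovered
  -- faces to neighbours in `F` that may be covered.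
  Sparse : ℕ → List (Vec (Fin n) m) → Set
  Sparse t U = ∀ {σ} → σ ∈ F → length (filter (_∈? neighbours σ) U) ℕ.≤ t

  -- Greedily add to S a member of F having more than t uncovered neighbours.
  greedy : ∀ t .{{_ : NonZero t}} →
    ∃[ S ] LAll.All (_∈ F) S × length S ℕ.* t ℕ.≤ length F × Sparse t (uncovered S)
  greedy t = go (length F) [] [] ℕ.≤-refl ℕ.≤-refl
    where
    -- The invariant survives because each new member of `S` removes more than `t` uncovered faces.
    -- The shrinking uncovered part also bounds the number of rounds.
    go : ∀ fuel S → LAll.All (_∈ F) S → length S ℕ.* t ℕ.+ length (uncovered S) ℕ.≤ length F →
      length (uncovered S) ℕ.≤ fuel →
      ∃[ S ] LAll.All (_∈ F) S × length S ℕ.* t ℕ.≤ length F × Sparse t (uncovered S)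
    go fuel S S⊆F h ≤fuel
      with LAny.any? (λ σ → t ℕ.<? length (filter (_∈? neighbours σ) (uncovered S))) F
    ... | no none = S , S⊆F , ℕ.m+n≤o⇒m≤o _ h , λ σ∈ → ℕ.≮⇒≥ (λ t< → none (lose σ∈ t<))
    ... | yes some with find some
    ... | σ , σ∈ , t< = next fuel ≤fuel
      where
      split : length (filter (_∈? neighbours σ) (uncovered S)) ℕ.+ length (uncovered (σ ∷ S))
              ≡ length (uncovered S)
      split = length-filter-split (_∈? neighbours σ) (uncovered S)
      drop : t ℕ.+ length (uncovered (σ ∷ S)) ℕ.< length (uncovered S)
      drop = subst (t ℕ.+ length (uncovered (σ ∷ S)) ℕ.<_) split (ℕ.+-monoˡ-< _ t<)
      next : ∀ fuel → length (uncovered S) ℕ.≤ fuel → _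
      next zero       ≤0    = contradiction (ℕ.<-≤-trans drop ≤0) (λ ())
      next (suc fuel) ≤fuel = go fuel (σ ∷ S) (σ∈ ∷ S⊆F)
        (ℕ.≤-trans (ℕ.≤-reflexive (trans (ℕ.+-assoc t _ _)
            (trans (x∙yz≈y∙xz t (length S ℕ.* t) _) refl)))
          (ℕ.≤-trans (ℕ.+-monoʳ-≤ (length S ℕ.* t) (ℕ.<⇒≤ drop)) h))
        (ℕ.≤-pred (ℕ.≤-trans (ℕ.≤-<-trans (ℕ.m≤n+m _ t) drop) ≤fuel))
        where open import Algebra.Properties.CommutativeSemigroup ℕ.+-commutativeSemigroup using (x∙yz≈y∙xz)

length-Γ : ∀ {n m} (S : List (Vec (Fin n) m)) → length (Γ S) ≡ length S ℕ.* (n ℕ.* suc m)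
length-Γ []      = refl
length-Γ (s ∷ S) = trans (List.length-++ (neighbours s)) (cong₂ ℕ._+_ (length-neighbours s) (length-Γ S))

-- Lower bounds for the size of a coboundary

module CoboundarySupport {c ℓ} (G : AbelianGroup c ℓ) (n : ℕ) where

  open AlternatingFunctions G n
  open AbelianGroup G hiding (sym; trans; refl)

  module Bounds {k : ℕ} (f : Vec (Fin n) k → Carrier) (zero? : U.Decidable (_≈ ε))
    (T : List (Vec (Fin n) (suc k))) (alt : Alternating f)
    (∈T : ∀ {τ} → Increasing τ → ¬ ∂ f τ ≈ ε → τ ∈ T) where

    open Alternating alt

    private
      -- A nonzero value excludes `u ∈ σ`, and moving `u` to its place changes at most the sign.
      ∂-insert : ∀ {u σ} → Increasing σ → ¬ ∂ f (u ∷ σ) ≈ ε → insert u σ ∈ T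
      ∂-insert {u} {σ} inc ≉ε = ∈T
        (insert-increasing (λ u∈ → ≉ε (∂-repeated alt u∈)) inc)
        (λ eq → ≉ε (agree-insertAt⁻ (∂-skew skew) ε-skew σ (position u σ) eq))

      insert-injective : ∀ {u u′} {σ σ′ : Vec (Fin n) k} {τ} → τ ≡ insert u σ → τ ≡ insert u′ σ′ →
        position u σ ≡ position u′ σ′ → (σ ≡ σ′) × (u ≡ u′)
      insert-injective {u} {u′} {σ} {σ′} {τ} refl eq pos =
        trans (sym (removeAt-insert u σ)) (trans (cong₂ removeAt eq pos) (removeAt-insert u′ σ′)) ,
        trans (sym (lookup-insert u σ)) (trans (cong₂ lookup eq pos) (lookup-insert u′ σ′))

    module _ (A : List (Vec (Fin n) k)) (A-unique : LUnique.Unique A)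
             (A-increasing : ∀ {σ} → σ ∈ A → Increasing σ) where

      nonzero? : (u : Fin n) → U.Decidable (λ σ → ¬ ∂ f (u ∷ σ) ≈ ε)
      nonzero? u σ = ¬? (zero? (∂ f (u ∷ σ)))

      -- Double counting: a pair `(u , σ)` with `∂ f (u ∷ σ)` nonzero is recovered from the simplex
      -- `insert u σ` in `T` and the position of `u` in it, for which there are `suc k`
      -- possibilities.
      links-bound : ∀ {m} → (∀ u → m ℕ.≤ length (filter (nonzero? u) A)) →
        n ℕ.* m ℕ.≤ length T ℕ.* suc k
      links-bound {m} h = ℕ.≤-trans
        (ℕ.≤-trans (ℕ.≤-reflexive (cong (ℕ._* m) (sym (List.length-tabulate {n = n} id))))
          (length-pairs-≥ (allFin n) h))
        (ℕ.≤-trans (length-inject {R = R} P (cartesianProduct T (allFin (suc k)))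
            (LAllPairs.map (λ x≢ {_} Rxy Rx′y → x≢ (injective Rxy Rx′y))
              (pairs-unique (LUnique.allFin⁺ n) (λ u → LUnique.filter⁺ (nonzero? u) A-unique)))
            target)
          (ℕ.≤-reflexive (trans (length-cartesianProductWith _,_ T (allFin (suc k)))
            (cong (length T ℕ.*_) (List.length-tabulate {n = suc k} id)))))
        where
        P = pairs (allFin n) (λ u → filter (nonzero? u) A)
        R : Fin n × Vec (Fin n) k → Vec (Fin n) (suc k) × Fin (suc k) → Set
        R (u , σ) (τ , i) = τ ≡ insert u σ × i ≡ position u σ
        injective : ∀ {x x′ y} → R x y → R x′ y → x ≡ x′
        injective (τ≡ , refl) (τ≡′ , i≡′) with insert-injective τ≡ τ≡′ i≡′
        ... | refl , refl = refl
        target : ∀ {x} → x ∈ P → ∃[ y ] y ∈ cartesianProduct T (allFin (suc k)) × R x y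
        target {u , σ} x∈ =
          let _ , σ∈ = ∈-pairs⁻ (allFin n) x∈
              σ∈A , ≉ε = ∈.∈-filter⁻ (nonzero? u) {xs = A} σ∈
          in (insert u σ , position u σ) ,
             ∈.∈-cartesianProduct⁺ (∂-insert (A-increasing σ∈A) ≉ε) (∈.∈-allFin _) , refl , refl

    module _ (F : List (Vec (Fin n) k)) (F-increasing : ∀ {σ} → σ ∈ F → Increasing σ)
             (F⇒≉ε : ∀ {σ} → σ ∈ F → ¬ f σ ≈ ε)
             (∈F : ∀ {σ} → Increasing σ → ¬ f σ ≈ ε → σ ∈ F) where

      -- Each witness carries just enough to recover `(σ , u)`. In `lonely`, `σ` is the only face of
      -- `τ` in `F`. In `paired`, `u` need not be stored: it is the one vertex of `σ′` outside `σ`.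
      data Witness : Vec (Fin n) k × Fin n →
                     (Vec (Fin n) k × Fin k) ⊎ Vec (Fin n) (suc k) ⊎ (Vec (Fin n) k × Vec (Fin n) k) → Set where
        vertex : ∀ {σ i} → Witness (σ , lookup σ i) (inj₁ (σ , i))
        lonely : ∀ {σ u τ} → τ ≡ insert u σ → σ ∈ F → (∀ j → removeAt τ j ∈ F → j ≡ position u σ) →
                 Witness (σ , u) (inj₂ (inj₁ τ))
        paired : ∀ {σ u σ′ j} → ¬ u V.∈ σ → σ′ ≡ removeAt (insert u σ) j → position u σ ≢ j →
                 Witness (σ , u) (inj₂ (inj₂ (σ′ , σ)))

      witness-injective : ∀ {x x′ y} → Witness x y → Witness x′ y → x ≡ x′
      witness-injective vertex vertex = refl
      witness-injective (lonely {σ} {u} τ≡ σ∈ only) (lonely {σ′} {u′} τ≡′ σ′∈ _)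
        with insert-injective τ≡ τ≡′ (sym (only (position u′ σ′)
               (subst (_∈ F) (sym (trans (cong (λ τ → removeAt τ (position u′ σ′)) τ≡′) (removeAt-insert u′ σ′))) σ′∈)))
      ... | refl , refl = refl
      witness-injective (paired {σ} {u} {_} {j} u∉ eq i≢j) (paired {u = u′} {j = j′} _ eq′ _)
        with insertAt-∈⁻ σ (position u′ σ) (removeAt-∈⁻ (insert u′ σ) j′ (subst (u V.∈_) eq′ (subst (u V.∈_) (sym eq)
               (subst (V._∈ removeAt (insert u σ) j) (lookup-insert u σ) (∈-removeAt (insert u σ) (i≢j ∘ sym))))))
      ... | inj₁ refl = refl
      ... | inj₂ u∈   = contradiction u∈ u∉

      -- For σ in W and a vertex u, either u ∈ σ, or σ is the only face of σ ∪ u in F and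
      -- then σ ∪ u supports ∂ f, or σ ∪ u has another face in F, which is a neighbour of σ.
      sparse-bound : ∀ W {t} → LUnique.Unique W → (∀ {σ} → σ ∈ W → σ ∈ F) → Sparse F t W →
        length W ℕ.* n ℕ.≤ length W ℕ.* k ℕ.+ (length T ℕ.+ length F ℕ.* t)
      sparse-bound W {t} W-unique W⊆F sparse = ℕ.≤-trans
        (ℕ.≤-reflexive (sym (trans (length-cartesianProductWith _,_ W (allFin n))
          (cong (length W ℕ.*_) (List.length-tabulate {n = n} id)))))
        (ℕ.≤-trans (length-inject {R = Witness} (cartesianProduct W (allFin n)) Y
            (LAllPairs.map (λ x≢ {_} Rxy Rx′y → x≢ (witness-injective Rxy Rx′y))
              (LUnique.cartesianProduct⁺ W-unique (LUnique.allFin⁺ n)))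
            (λ x∈ → target (proj₁ (∈.∈-cartesianProduct⁻ W (allFin n) x∈))))
          lengthY)
        where
        Y₁ = cartesianProduct W (allFin k)
        Y₃ = pairs F (λ σ → filter (_∈? neighbours σ) W)
        Y₂₃ = List.map inj₁ T ++ List.map inj₂ Y₃
        Y = List.map inj₁ Y₁ ++ List.map inj₂ Y₂₃
        lengthY : length Y ℕ.≤ length W ℕ.* k ℕ.+ (length T ℕ.+ length F ℕ.* t)
        lengthY = ℕ.≤-trans (ℕ.≤-reflexive (List.length-++ (List.map inj₁ Y₁))) (ℕ.+-mono-≤
          (ℕ.≤-reflexive (trans (List.length-map inj₁ Y₁) (trans (length-cartesianProductWith _,_ W (allFin k))
            (cong (length W ℕ.*_) (List.length-tabulate {n = k} id)))))
          (ℕ.≤-trans (ℕ.≤-reflexive (trans (List.length-map inj₂ Y₂₃) (List.length-++ (List.map inj₁ T))))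
            (ℕ.+-mono-≤ (ℕ.≤-reflexive (List.length-map inj₁ T))
              (ℕ.≤-trans (ℕ.≤-reflexive (List.length-map inj₂ Y₃)) (length-pairs-≤ F sparse)))))
        target : ∀ {σ u} → σ ∈ W → ∃[ y ] y ∈ Y × Witness (σ , u) y
        target {σ} {u} σ∈ with member? u σ
        ... | yes u∈ = inj₁ (σ , VAny.index u∈) ,
          ∈.∈-++⁺ˡ (∈.∈-map⁺ inj₁ (∈.∈-cartesianProduct⁺ σ∈ (∈.∈-allFin _))) ,
          subst (λ v → Witness (σ , v) (inj₁ (σ , VAny.index u∈))) (sym (lookup-index u∈)) vertex
          where open import Data.Vec.Relation.Unary.Any.Properties using (lookup-index)
        ... | no u∉ with Fin.any? (λ j → (¬? (position u σ Fin.≟ j)) ×-dec (removeAt (insert u σ) j ∈? F))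
        ...   | yes (j , i≢j , σ′∈) = inj₂ (inj₂ (removeAt (insert u σ) j , σ)) ,
          ∈.∈-++⁺ʳ (List.map inj₁ Y₁) (∈.∈-map⁺ inj₂ (∈.∈-++⁺ʳ (List.map inj₁ T) (∈.∈-map⁺ inj₂
            (∈-pairs⁺ σ′∈ (∈.∈-filter⁺ (_∈? neighbours (removeAt (insert u σ) j)) σ∈ isNeighbour))))) ,
          paired u∉ refl i≢j
          where
          τ = insert u σ
          isNeighbour : σ ∈ neighbours (removeAt τ j)
          isNeighbour = subst (_∈ neighbours (removeAt τ j))
            (trans (cong (λ v → removeAt v (position u σ))
                (insert-lookup-removeAt (insert-increasing u∉ (F-increasing (W⊆F σ∈))) j))
              (removeAt-insert u σ))
            (∈.∈-cartesianProductWith⁺ (λ v i → removeAt (insert v (removeAt τ j)) i)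
              (∈.∈-allFin (lookup τ j)) (∈.∈-allFin (position u σ)))
        ...   | no none = inj₂ (inj₁ (insert u σ)) ,
          ∈.∈-++⁺ʳ (List.map inj₁ Y₁) (∈.∈-map⁺ inj₂ (∈.∈-++⁺ˡ (∈.∈-map⁺ inj₁
            (∈T τ-increasing (λ eq → F⇒≉ε (W⊆F σ∈)
              (subst (λ v → f v ≈ ε) (removeAt-insert u σ)
                (∂-single-face f (insert u σ) (position u σ) others-vanish eq))))))) ,
          lonely refl (W⊆F σ∈) (λ j j∈ → decidable-stable (j Fin.≟ position u σ)
            (λ j≢i → none (j , j≢i ∘ sym , j∈)))
          where
          τ-increasing = insert-increasing u∉ (F-increasing (W⊆F σ∈))
          others-vanish : ∀ j → j ≢ position u σ → f (removeAt (insert u σ) j) ≈ ε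
          others-vanish j j≢i = decidable-stable (zero? _) (λ ≉ε →
            none (j , j≢i ∘ sym , ∈F (removeAt-increasing τ-increasing j) ≉ε))

-- Cochains as alternating functions

module _ {a b c r s t : Level} {A : Set a} {B : Set b} {C : Set c} {R : Rel C r} {S : Rel A s} {T : Rel B t} where

  cartesianProductWith-AllPairs : (f : A → B → C) {xs : List A} {ys : List B} →
    (∀ {x x′ y y′} → S x x′ → R (f x y) (f x′ y′)) → (∀ {x y y′} → T y y′ → R (f x y) (f x y′)) →
    LAllPairs.AllPairs S xs → LAllPairs.AllPairs T ys →
    LAllPairs.AllPairs R (cartesianProductWith f xs ys)
  cartesianProductWith-AllPairs f hS hT []          ys# = []
  cartesianProductWith-AllPairs f {x ∷ xs} {ys} hS hT (x# ∷ xs#) ys# = ++⁺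
    (map⁺ (LAllPairs.map hT ys#))
    (cartesianProductWith-AllPairs f hS hT xs# ys#)
    (LAll.tabulate (λ i → LAll.tabulate (λ j → apart (∈.∈-map⁻ (f x) i) (∈.∈-cartesianProductWith⁻ f xs ys j))))
    where
    open import Data.List.Relation.Unary.AllPairs.Properties using (++⁺; map⁺)
    apart : ∀ {z w} → (∃[ y ] y ∈ ys × z ≡ f x y) → (∃₂ λ x′ y′ → x′ ∈ xs × y′ ∈ ys × w ≡ f x′ y′) → R z w
    apart (_ , _ , refl) (_ , _ , x′∈ , _ , refl) = hS (LAll.lookup x# x′∈)

length-filter-mono : ∀ {a p q} {A : Set a} {P : A → Set p} {Q : A → Set q}
  (P? : U.Decidable P) (Q? : U.Decidable Q) → (∀ {x} → P x → Q x) →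
  ∀ xs → length (filter P? xs) ℕ.≤ length (filter Q? xs)
length-filter-mono P? Q? P⇒Q []       = ℕ.z≤n
length-filter-mono P? Q? P⇒Q (x ∷ xs) with P? x | Q? x
... | yes _  | yes _  = ℕ.s≤s (length-filter-mono P? Q? P⇒Q xs)
... | yes Px | no ¬Qx = contradiction (P⇒Q Px) ¬Qx
... | no  _  | yes _  = ℕ.m≤n⇒m≤1+n (length-filter-mono P? Q? P⇒Q xs)
... | no  _  | no  _  = length-filter-mono P? Q? P⇒Q xs

length-filter-map : ∀ {a b p} {A : Set a} {B : Set b} {P : B → Set p} (P? : U.Decidable P) (f : A → B) →
  ∀ xs → length (filter P? (List.map f xs)) ≡ length (filter (P? ∘ f) xs)
length-filter-map P? f []       = refl
length-filter-map P? f (x ∷ xs) with P? (f x)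
... | yes _ = cong suc (length-filter-map P? f xs)
... | no  _ = length-filter-map P? f xs

module _ {n m : ℕ} where

  vertices-injective : {σ τ : OrderedSimplex n m} → vertices σ ≡ vertices τ → σ ≡ τ
  vertices-injective {mkSimplex _ _} {mkSimplex _ _} refl = refl

  distinctOnes-unique : {vs : List (Vec (Fin n) m)} → LUnique.Unique vs → LUnique.Unique (distinctOnes vs)
  distinctOnes-unique []                 = []
  distinctOnes-unique {v ∷ vs} (v# ∷ vs#) with unique? v
  ... | no  _ = distinctOnes-unique vs#
  ... | yes u = new v# ∷ distinctOnes-unique vs#
    where
    new : ∀ {ws} → LAll.All (v ≢_) ws → LAll.All (mkSimplex v u ≢_) (distinctOnes ws)
    new []                = []
    new {w ∷ ws} (v≢w ∷ v#) with unique? w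
    ... | yes _ = v≢w ∘ cong vertices ∷ new v#
    ... | no  _ = new v#

vectors-unique : ∀ n m → LUnique.Unique (vectors n m)
vectors-unique n zero    = [] ∷ []
vectors-unique n (suc m) = LUnique.cartesianProductWith⁺ _∷_ Vec.∷-injective
  (LUnique.allFin⁺ n) (vectors-unique n m)

length-vectors : ∀ n m → length (vectors n m) ≡ n ℕ.^ m
length-vectors n zero    = refl
length-vectors n (suc m) = trans (length-cartesianProductWith _∷_ (allFin n) (vectors n m))
  (cong₂ ℕ._*_ (List.length-tabulate {n = n} id) (length-vectors n m))

length-distinctOnes : ∀ {n m} (vs : List (Vec (Fin n) m)) → length (distinctOnes vs) ℕ.≤ length vs
length-distinctOnes []       = ℕ.z≤n
length-distinctOnes (v ∷ vs) with unique? v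
... | yes _ = ℕ.s≤s (length-distinctOnes vs)
... | no  _ = ℕ.m≤n⇒m≤1+n (length-distinctOnes vs)

module _ (n m : ℕ) where

  orderedSimplices-unique : LUnique.Unique (orderedSimplices n m)
  orderedSimplices-unique = distinctOnes-unique (vectors-unique n m)

  increasingVectors : List (Vec (Fin n) m)
  increasingVectors = List.map vertices (faces n m)

  length-increasingVectors : length increasingVectors ℕ.≤ n ℕ.^ m
  length-increasingVectors = ℕ.≤-trans (ℕ.≤-reflexive (List.length-map vertices (faces n m)))
    (ℕ.≤-trans (List.length-filter _ (orderedSimplices n m))
      (ℕ.≤-trans (length-distinctOnes (vectors n m)) (ℕ.≤-reflexive (length-vectors n m))))

  increasingVectors-unique : LUnique.Unique increasingVectors
  increasingVectors-unique = LUnique.map⁺ vertices-injective (LUnique.filter⁺ _ orderedSimplices-unique)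

  ∈-faces⁻ : ∀ {σ} → σ ∈ faces n m → Increasing (vertices σ)
  ∈-faces⁻ σ∈ = proj₂ (∈.∈-filter⁻ _ {xs = orderedSimplices n m} σ∈)

  ∈-faces⁺ : ∀ {v} (inc : Increasing v) → mkSimplex v (increasing⇒unique inc) ∈ faces n m
  ∈-faces⁺ inc = ∈.∈-filter⁺ _ (∈-orderedSimplices _) inc

  ∈-increasingVectors⁻ : ∀ {v} → v ∈ increasingVectors → Increasing v
  ∈-increasingVectors⁻ v∈ with ∈.∈-map⁻ vertices v∈
  ... | _ , σ∈ , refl = ∈-faces⁻ σ∈

  ∈-increasingVectors⁺ : ∀ {v} → Increasing v → v ∈ increasingVectors
  ∈-increasingVectors⁺ inc = ∈.∈-map⁺ vertices (∈-faces⁺ inc)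

adjacentSwap-sym : ∀ {n m} {v w : Vec (Fin n) m} → AdjacentSwap v w → AdjacentSwap w v
adjacentSwap-sym here      = here
adjacentSwap-sym (there s) = there (adjacentSwap-sym s)

adjacentSwap-All : ∀ {n m p} {P : Fin n → Set p} {v w : Vec (Fin n) m} →
  AdjacentSwap v w → VAll.All P v → VAll.All P w
adjacentSwap-All here      (px ∷ py ∷ pv) = py ∷ px ∷ pv
adjacentSwap-All (there s) (px ∷ pv)      = px ∷ adjacentSwap-All s pv

adjacentSwap-unique : ∀ {n m} {v w : Vec (Fin n) m} → AdjacentSwap v w → Unique v → Unique w
adjacentSwap-unique here      ((x≢y ∷ x#) ∷ y# ∷ u) = (≢-sym x≢y ∷ y#) ∷ x# ∷ u
adjacentSwap-unique (there s) (x# ∷ u)              = adjacentSwap-All s x# ∷ adjacentSwap-unique s u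

module _ {c ℓ} (R : FiniteAbelianGroup c ℓ) (n : ℕ) where

  open FiniteAbelianGroup R hiding (_≟_; refl)
  private module R = FiniteAbelianGroup R
  open Inverse enumeration using (to; from; to-cong; from-cong; strictlyInverseˡ; strictlyInverseʳ)
  open Cochains R n
  open AlternatingFunctions abelianGroup n
  open AbelianGroupProperties abelianGroup using (ε⁻¹≈ε; ⁻¹-∙-comm; ⁻¹-involutive)
  open import Relation.Binary.Reasoning.Setoid ≈-setoid

  -- Total on vectors, so that a vertex can be prepended without a proof of distinctness; the value
  -- `ε` on repeated vertices is the one that alternation forces.
  extend : ∀ {m} → Function m → Vec (Fin n) m → Carrier
  extend φ v with unique? v
  ... | yes u = φ (mkSimplex v u)
  ... | no  _ = ε

  extend-vertices : ∀ {m} (φ : Function m) σ → extend φ (vertices σ) ≡ φ σ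
  extend-vertices φ (mkSimplex v u) with unique? v
  ... | yes _ = refl
  ... | no ¬u = contradiction-irr u ¬u

  extend-¬unique : ∀ {m} (φ : Function m) {v} → ¬ Unique v → extend φ v ≡ ε
  extend-¬unique φ {v} ¬u with unique? v
  ... | yes u = contradiction u ¬u
  ... | no  _ = refl

  extend-cong : ∀ {m} {φ : Function m} {g : Vec (Fin n) m → Carrier} →
    (∀ {v} → ¬ Unique v → g v ≈ ε) → (∀ σ → φ σ ≈ g (vertices σ)) → ∀ v → extend φ v ≈ g v
  extend-cong h₀ h v with unique? v
  ... | yes u = h (mkSimplex v u)
  ... | no ¬u = ≈-sym (h₀ ¬u)

  adjacentSwap⇒swap : ∀ {m} {v w : Vec (Fin n) m} → AdjacentSwap v w → ∃₂ λ i j → i ≢ j × w ≡ swap v i j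
  adjacentSwap⇒swap here      = Fin.zero , Fin.suc Fin.zero , (λ ()) , refl
  adjacentSwap⇒swap (there s) = let i , j , i≢j , eq = adjacentSwap⇒swap s in
    Fin.suc i , Fin.suc j , i≢j ∘ Fin.suc-injective , cong (_ ∷_) eq

  extend-alternating : ∀ {m} {φ : Function m} → SkewSymmetric φ → Alternating (extend φ)
  extend-alternating {φ = φ} sφ = record { skew = skew ; vanish = λ ¬u → R.reflexive (extend-¬unique φ ¬u) }
    where
    skew : Skew (extend φ)
    skew {v} {w} s with unique? v | unique? w
    ... | yes _ | yes _ = let i , j , i≢j , eq = adjacentSwap⇒swap s in sφ _ _ i j i≢j eq
    ... | yes u | no ¬u = contradiction (adjacentSwap-unique s u) ¬u
    ... | no ¬u | yes u = contradiction (adjacentSwap-unique (adjacentSwap-sym s) u) ¬u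
    ... | no  _ | no  _ = ≈-sym ε⁻¹≈ε

  sum-cong : ∀ {m} {f g : Fin m → Carrier} → (∀ i → f i ≈ g i) →
    RawMonoid.sum rawMonoid f ≈ RawMonoid.sum rawMonoid g
  sum-cong {zero}  h = R.refl
  sum-cong {suc m} h = ∙-cong (h Fin.zero) (sum-cong (h ∘ Fin.suc))

  sum-⁻¹ : ∀ {m} (f : Fin m → Carrier) →
    RawMonoid.sum rawMonoid (λ i → f i ⁻¹) ≈ RawMonoid.sum rawMonoid f ⁻¹
  sum-⁻¹ {zero}  f = ≈-sym ε⁻¹≈ε
  sum-⁻¹ {suc m} f = ≈-trans (∙-congˡ (sum-⁻¹ (f ∘ Fin.suc))) (⁻¹-∙-comm _ _)

  sum-faces : ∀ {m} (f : Vec (Fin n) m → Carrier) v →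
    RawMonoid.sum rawMonoid (λ i → [-1]^ toℕ i · f (removeAt v i)) ≈ ∂ f v
  sum-faces {zero}  f (x ∷ [])        = R.identityʳ _
  sum-faces {suc m} f (x ∷ v@(_ ∷ _)) = ∙-congˡ (≈-trans
    (sum-⁻¹ (λ i → [-1]^ toℕ i · f (x ∷ removeAt v i)))
    (⁻¹-cong (sum-faces (f ∘ (x ∷_)) v)))

  [-1]^-cong : ∀ i {x y} → x ≈ y → ([-1]^ i · x) ≈ ([-1]^ i · y)
  [-1]^-cong zero    eq = eq
  [-1]^-cong (suc i) eq = ⁻¹-cong ([-1]^-cong i eq)

  d≈∂ : ∀ {m} (φ : Function m) σ → d φ σ ≈ ∂ (extend φ) (vertices σ)
  d≈∂ φ σ = ≈-trans
    (sum-cong (λ i → [-1]^-cong (toℕ i) (R.reflexive (sym (extend-vertices φ (removeVertex σ i))))))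
    (sum-faces (extend φ) (vertices σ))

  ∈-supp⁻ : ∀ {m} {φ : Function m} {v} → v ∈ List.map vertices (supp φ) →
    Increasing v × ¬ extend φ v ≈ ε
  ∈-supp⁻ {m} {φ} v∈ with ∈.∈-map⁻ vertices v∈
  ... | σ , σ∈ , refl = let σ∈faces , ≉ε = ∈.∈-filter⁻ _ {xs = faces n m} σ∈ in
    ∈-faces⁻ n m σ∈faces , λ eq → ≉ε (≈-trans (R.reflexive (sym (extend-vertices φ σ))) eq)

  ∈-supp⁺ : ∀ {m} {φ : Function m} {v} (inc : Increasing v) →
    ¬ φ (mkSimplex v (increasing⇒unique inc)) ≈ ε → v ∈ List.map vertices (supp φ)
  ∈-supp⁺ {m} inc ≉ε = ∈.∈-map⁺ vertices (∈.∈-filter⁺ _ (∈-faces⁺ n m inc) ≉ε)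

  supp-unique : ∀ {m} (φ : Function m) → LUnique.Unique (List.map vertices (supp φ))
  supp-unique {m} φ = LUnique.map⁺ vertices-injective
    (LUnique.filter⁺ _ (LUnique.filter⁺ _ (orderedSimplices-unique n m)))

  functions-complete : ∀ {a} {A : Set a} (_≟ᴬ_ : (x y : A) → Dec (x ≡ y)) {e bs} (ψ : A → Carrier) →
    (∀ x → ∃[ y ] y ∈ bs × y ≈ ψ x) → ∀ xs →
    ∃[ f ] f ∈ functions _≟ᴬ_ e bs xs × (∀ {y} → y ∈ xs → f y ≈ ψ y)
  functions-complete _≟ᴬ_ {e} ψ h []  = const e , here refl , λ ()
  functions-complete _≟ᴬ_ {e} {bs} ψ h (x ∷ xs) =
    let r , r∈ , r≈ = h x
        f , f∈ , f≈ = functions-complete _≟ᴬ_ {e} {bs} ψ h xs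
    in _ , ∈.∈-cartesianProductWith⁺ _ r∈ f∈ , (λ {y} → agree {r} {f} r≈ f≈ {y})
    where
    agree : ∀ {r f} → r ≈ ψ x → (∀ {y} → y ∈ xs → f y ≈ ψ y) →
      ∀ {y} → y ∈ x ∷ xs → (if does (y ≟ᴬ x) then r else f y) ≈ ψ y
    agree r≈ f≈ {y} y∈ with y ≟ᴬ x | y∈
    ... | yes refl | _         = r≈
    ... | no  y≢x  | here eq   = contradiction eq y≢x
    ... | no  _    | there y∈xs = f≈ y∈xs

  -- `w` minimises over the list `cochains`, so a competitor built by hand, such as a link, has to
  -- be replaced by a listed cochain that agrees with it pointwise.
  cochains-complete : ∀ {m} {ψ : Function m} → SkewSymmetric ψ →
    ∃[ φ ] φ ∈ cochains m × (∀ σ → φ σ ≈ ψ σ)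
  cochains-complete {m} {ψ} sψ =
    let φ , φ∈ , φ≈ = functions-complete _≟ˢ_ {ε} {elements} ψ
          (λ σ → to (from (ψ σ)) , ∈.∈-map⁺ to (∈.∈-allFin _) , strictlyInverseˡ (ψ σ)) (orderedSimplices n m)
        φ≈ψ = λ σ → φ≈ (∈-orderedSimplices σ)
    in φ , ∈.∈-filter⁺ skewSymmetric? φ∈
         (λ σ τ i j i≢j eq → ≈-trans (φ≈ψ τ) (≈-trans (sψ σ τ i j i≢j eq) (⁻¹-cong (≈-sym (φ≈ψ σ))))) , φ≈ψ

  functions-distinct : ∀ {a} {A : Set a} (_≟ᴬ_ : (x y : A) → Dec (x ≡ y)) {e bs} →
    LAllPairs.AllPairs (λ x y → ¬ x ≈ y) bs → ∀ {xs} → LUnique.Unique xs →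
    LAllPairs.AllPairs (λ f g → ¬ (∀ {y} → y ∈ xs → f y ≈ g y)) (functions _≟ᴬ_ e bs xs)
  functions-distinct _≟ᴬ_ bs# []                  = [] ∷ []
  functions-distinct _≟ᴬ_ {e} {bs} bs# {x ∷ xs} (x# ∷ xs#) = cartesianProductWith-AllPairs _
    (λ r≉s h → r≉s (subst₂ _≈_ (at-x _ _) (at-x _ _) (h (here refl))))
    (λ f≠g h → f≠g (λ y∈ → subst₂ _≈_ (off-x y∈ _ _) (off-x y∈ _ _) (h (there y∈))))
    bs# (functions-distinct _≟ᴬ_ bs# xs#)
    where
    at-x : ∀ r s → (if does (x ≟ᴬ x) then r else s) ≡ r
    at-x r s with x ≟ᴬ x
    ... | yes _   = refl
    ... | no  x≢x = contradiction refl x≢x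
    off-x : ∀ {y} → y ∈ xs → ∀ r s → (if does (y ≟ᴬ x) then r else s) ≡ s
    off-x {y} y∈ r s with y ≟ᴬ x
    ... | yes refl = contradiction refl (LAll.lookup x# y∈)
    ... | no  _    = refl

  cochains-distinct : ∀ m → LAllPairs.AllPairs (λ φ ψ → ¬ (∀ σ → φ σ ≈ ψ σ)) (cochains m)
  cochains-distinct m = LAllPairs.map (λ h φ≈ψ → h (λ _ → φ≈ψ _)) (filter⁺ skewSymmetric?
    (functions-distinct _≟ˢ_ {ε} {elements}
      (map⁺ (LAllPairs.map (λ i≢j eq → i≢j (trans (sym (strictlyInverseʳ _))
          (trans (from-cong eq) (strictlyInverseʳ _)))) (LUnique.allFin⁺ order)))
      (orderedSimplices-unique n m)))
    where open import Data.List.Relation.Unary.AllPairs.Properties using (filter⁺; map⁺)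

  swap-involutive : ∀ {m} (v : Vec (Fin n) m) {i j} → i ≢ j → swap (swap v i j) i j ≡ v
  swap-involutive v {i} {j} i≢j
    rewrite Vec.lookup∘update j (v Vec.[ i ]≔ lookup v j) (lookup v i)
          | Vec.lookup∘update′ i≢j (v Vec.[ i ]≔ lookup v j) (lookup v i)
          | Vec.lookup∘update i v (lookup v j)
          | Vec.[]≔-commutes {x = lookup v i} {y = lookup v i} (v Vec.[ i ]≔ lookup v j) j i (i≢j ∘ sym)
          | Vec.[]≔-idempotent {x = lookup v j} {y = lookup v i} v i
          | Vec.[]≔-idempotent {x = lookup v i} {y = lookup v j} (v Vec.[ i ]≔ lookup v i) j
          | Vec.[]≔-lookup v i = Vec.[]≔-lookup v j

  swap-All : ∀ {m p} {P : Fin n → Set p} {v : Vec (Fin n) m} → VAll.All P v → ∀ i j → VAll.All P (swap v i j)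
  swap-All pv i j = update j (update i pv (lookup⁺ pv j)) (lookup⁺ pv i)
    where
    open import Data.Vec.Relation.Unary.All.Properties using (lookup⁺)
    update : ∀ {m p} {P : Fin n → Set p} {v : Vec (Fin n) m} i {x} → VAll.All P v → P x → VAll.All P (v Vec.[ i ]≔ x)
    update Fin.zero    (_ ∷ pv)  px = px ∷ pv
    update (Fin.suc i) (py ∷ pv) px = py ∷ update i pv px

  link-skew : ∀ {m} {φ : Function (suc m)} → SkewSymmetric φ → ∀ u →
    SkewSymmetric (λ σ → extend φ (u ∷ vertices σ))
  link-skew {φ = φ} sφ u σ@(mkSimplex v uv) τ@(mkSimplex _ uw) i j i≢j refl
    with unique? (u ∷ v) | unique? (u ∷ swap v i j)
  ... | yes _         | yes _         = sφ _ _ (Fin.suc i) (Fin.suc j) (i≢j ∘ Fin.suc-injective) refl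
  ... | no  _         | no  _         = ≈-sym ε⁻¹≈ε
  ... | yes (u# ∷ _)  | no ¬u         = contradiction-irr (swap-All u# i j ∷ uw) ¬u
  ... | no ¬u         | yes (u# ∷ _)  = contradiction-irr
    (subst (VAll.All (u ≢_)) (swap-involutive v i≢j) (swap-All u# i j) ∷ uv) ¬u

-- The two lower bounds for b in terms of cochains

module CochainBounds {c ℓ} (R : FiniteAbelianGroup c ℓ) (n : ℕ) where

  open FiniteAbelianGroup R hiding (refl)
  private module R = FiniteAbelianGroup R
  open Cochains R n
  open AlternatingFunctions abelianGroup n
  open AbelianGroupProperties abelianGroup using (ε⁻¹≈ε; ⁻¹-injective)

  support : ∀ {m} → Function m → List (Vec (Fin n) m)
  support φ = List.map vertices (supp φ)

  length-support : ∀ {m} (φ : Function m) → length (support φ) ≡ size φ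
  length-support φ = List.length-map vertices (supp φ)

  ∈-support : ∀ {m} (φ : Function m) {v} → Increasing v → ¬ extend R n φ v ≈ ε → v ∈ support φ
  ∈-support φ inc ≉ε = ∈-supp⁺ R n inc (λ eq → ≉ε (≈-trans
    (R.reflexive (extend-vertices R n φ (mkSimplex _ (increasing⇒unique inc)))) eq))

  module _ {m : ℕ} {φ ψ : Function m} (sφ : SkewSymmetric φ) (sψ : SkewSymmetric ψ) where

    determined-by-increasing : (∀ {v} → v ∈ increasingVectors n m → extend R n φ v ≈ extend R n ψ v) →
      ∀ σ → φ σ ≈ ψ σ
    determined-by-increasing h σ = subst₂ _≈_ (extend-vertices R n φ σ) (extend-vertices R n ψ σ)
      (agree-on-increasing (extend-alternating R n sφ) (extend-alternating R n sψ)
        (λ v inc → h (∈-increasingVectors⁺ n m inc)) (vertices σ))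

  nonzero⇒0<size : ∀ {m} {φ : Function m} → SkewSymmetric φ → ¬ (∀ σ → φ σ ≈ ε) → 0 ℕ.< size φ
  nonzero⇒0<size {m} {φ} sφ φ≉0 with size φ in eq
  ... | suc _ = ℕ.z<s
  ... | zero  = contradiction (determined-by-increasing {ψ = const ε} sφ (λ _ _ _ _ _ _ → ≈-sym ε⁻¹≈ε) vanish) φ≉0
    where
    empty : ∀ {a} {A : Set a} {x : A} {xs} → x ∈ xs → length xs ≢ 0
    empty (here _)  ()
    empty (there _) ()
    vanish : ∀ {v} → v ∈ increasingVectors n m → extend R n φ v ≈ extend R n (const ε) v
    vanish {v} v∈ with extend R n φ v ≟ ε
    ... | yes ≈ε = ≈-trans ≈ε (≈-sym (extend-cong R n {g = const ε} (λ _ → R.refl) (λ _ → R.refl) v))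
    ... | no  ≉ε = contradiction (trans (length-support φ) eq)
                     (empty (∈-support φ (∈-increasingVectors⁻ n m v∈) ≉ε))

  module _ {k : ℕ} {φ : Function k} (sφ : SkewSymmetric φ) where

    private
      f = extend R n φ
      alt = extend-alternating R n sφ

      ∈T : ∀ {τ} → Increasing τ → ¬ ∂ f τ ≈ ε → τ ∈ support (d φ)
      ∈T inc ≉ε = ∈-supp⁺ R n inc (λ eq → ≉ε (≈-trans (≈-sym (d≈∂ R n φ (mkSimplex _ (increasing⇒unique inc)))) eq))

    open CoboundarySupport.Bounds abelianGroup n f (_≟ ε) (support (d φ)) alt ∈T

    sparse⇒b≥ : ∀ W {t} → LUnique.Unique W → (∀ {σ} → σ ∈ W → σ ∈ support φ) → Sparse (support φ) t W →
      length W ℕ.* n ℕ.≤ length W ℕ.* k ℕ.+ (b φ ℕ.+ size φ ℕ.* t)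
    sparse⇒b≥ W {t} W-unique W⊆F sparse = subst₂
      (λ x y → length W ℕ.* n ℕ.≤ length W ℕ.* k ℕ.+ (x ℕ.+ y ℕ.* t)) (length-support (d φ)) (length-support φ)
      (sparse-bound (support φ) (proj₁ ∘ ∈-supp⁻ R n {φ = φ}) (proj₂ ∘ ∈-supp⁻ R n {φ = φ}) (∈-support φ)
        W W-unique W⊆F sparse)

    links⇒b≥ : ∀ {m} → (∀ u → m ℕ.≤ length (filter (λ σ → ¬? (∂ f (u ∷ vertices σ) ≟ ε)) (faces n k))) →
      n ℕ.* m ℕ.≤ b φ ℕ.* suc k
    links⇒b≥ {m} h = subst (λ x → n ℕ.* m ℕ.≤ x ℕ.* suc k) (length-support (d φ))
      (links-bound (increasingVectors n k) (increasingVectors-unique n k) (∈-increasingVectors⁻ n k)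
        (λ u → ℕ.≤-trans (h u) (ℕ.≤-reflexive
          (sym (length-filter-map (λ σ → ¬? (∂ f (u ∷ σ) ≟ ε)) vertices (faces n k))))))

  module _ {k : ℕ} {φ : Function (suc k)} (sφ : SkewSymmetric φ) where

    private
      f = extend R n φ
      alt = extend-alternating R n sφ

    w≤link : ∀ u → w φ ℕ.≤ length (filter (λ σ → ¬? (∂ f (u ∷ vertices σ) ≟ ε)) (faces n (suc k)))
    -- `w` adds coboundaries, so the competitor is the inverse of the link of `u`; `coned` then
    -- holds by the recursion for `∂`.
    w≤link u with cochains-complete R n {ψ = λ σ → f (u ∷ vertices σ) ⁻¹}
                    (λ σ τ i j i≢j eq → ⁻¹-cong (link-skew R n sφ u σ τ i j i≢j eq))
    ... | ψ , ψ∈ , ψ≈ = ℕ.≤-trans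
      (min≤v⁺ {v = size (λ σ → φ σ ∙ d ψ σ)} (size φ) _ (inj₂ (lose (∈.∈-map⁺ _ ψ∈) ℕ.≤-refl)))
      (length-filter-mono _ _ (λ {σ} ≉ε eq → ≉ε (≈-trans (coned σ) eq)) (faces n (suc k)))
      where
      open import Data.List.Extrema.Nat using (min≤v⁺)
      ψ̂≈ : ∀ v → extend R n ψ v ≈ f (u ∷ v) ⁻¹
      ψ̂≈ = extend-cong R n
        (λ ¬u → ≈-trans (⁻¹-cong (Alternating.vanish alt {u ∷ _} (λ { (_ ∷ uv) → ¬u uv }))) ε⁻¹≈ε) ψ≈
      coned : ∀ σ → φ σ ∙ d ψ σ ≈ ∂ f (u ∷ vertices σ)
      coned σ = ∙-cong (R.reflexive (sym (extend-vertices R n φ σ)))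
        (≈-trans (d≈∂ R n ψ σ) (≈-trans (∂-cong ψ̂≈ (vertices σ)) (∂-⁻¹ (f ∘ (u ∷_)) (vertices σ))))

    minimal⇒b≥ : w φ ≡ size φ → n ℕ.* size φ ℕ.≤ b φ ℕ.* suc (suc k)
    minimal⇒b≥ eq = links⇒b≥ sφ (λ u → ℕ.≤-trans (ℕ.≤-reflexive (sym eq)) (w≤link u))

-- Rational sums and products

0≤* : ∀ {x y} → 0ℚ ℚ.≤ x → 0ℚ ℚ.≤ y → 0ℚ ℚ.≤ x ℚ.* y
0≤* {x} {y} 0≤x 0≤y = subst (ℚ._≤ x ℚ.* y) (ℚ.*-zeroˡ y)
  (ℚ.*-monoʳ-≤-nonNeg y {{ℚ.nonNegative 0≤y}} 0≤x)

*-mono-≤ : ∀ {x y u v} → 0ℚ ℚ.≤ u → 0ℚ ℚ.≤ y → x ℚ.≤ y → u ℚ.≤ v → x ℚ.* u ℚ.≤ y ℚ.* v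
*-mono-≤ {y = y} {u} 0≤u 0≤y x≤y u≤v = ℚ.≤-trans
  (ℚ.*-monoʳ-≤-nonNeg u {{ℚ.nonNegative 0≤u}} x≤y)
  (ℚ.*-monoˡ-≤-nonNeg y {{ℚ.nonNegative 0≤y}} u≤v)

0≤1 : 0ℚ ℚ.≤ 1ℚ
0≤1 = ℚ.nonNegative⁻¹ 1ℚ

0≤½ : 0ℚ ℚ.≤ ½
0≤½ = ℚ.nonNegative⁻¹ ½

½≤1 : ½ ℚ.≤ 1ℚ
½≤1 = ℚ.*≤* (ℤ.+≤+ (ℕ.s≤s ℕ.z≤n))

0≤^ : ∀ {x} n → 0ℚ ℚ.≤ x → 0ℚ ℚ.≤ x ^ n
0≤^ zero    0≤x = 0≤1
0≤^ (suc n) 0≤x = 0≤* 0≤x (0≤^ n 0≤x)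

^-monoˡ-≤ : ∀ {x y} n → 0ℚ ℚ.≤ x → x ℚ.≤ y → x ^ n ℚ.≤ y ^ n
^-monoˡ-≤ zero    0≤x x≤y = ℚ.≤-refl
^-monoˡ-≤ (suc n) 0≤x x≤y =
  *-mono-≤ (0≤^ n 0≤x) (ℚ.≤-trans 0≤x x≤y) x≤y (^-monoˡ-≤ n 0≤x x≤y)

1^n≡1 : ∀ n → 1ℚ ^ n ≡ 1ℚ
1^n≡1 zero    = refl
1^n≡1 (suc n) = trans (ℚ.*-identityˡ (1ℚ ^ n)) (1^n≡1 n)

^≤1 : ∀ {x} n → 0ℚ ℚ.≤ x → x ℚ.≤ 1ℚ → x ^ n ℚ.≤ 1ℚ
^≤1 {x} n 0≤x x≤1 = subst (x ^ n ℚ.≤_) (1^n≡1 n) (^-monoˡ-≤ n 0≤x x≤1)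

^-anti-≤ : ∀ {x m n} → 0ℚ ℚ.≤ x → x ℚ.≤ 1ℚ → m ℕ.≤ n → x ^ n ℚ.≤ x ^ m
^-anti-≤ {n = n} 0≤x x≤1 ℕ.z≤n   = ^≤1 n 0≤x x≤1
^-anti-≤ {x} {suc m} {suc n} 0≤x x≤1 (ℕ.s≤s m≤n) =
  *-mono-≤ (0≤^ n 0≤x) 0≤x ℚ.≤-refl (^-anti-≤ 0≤x x≤1 m≤n)

^-monoˡ-< : ∀ {x y} n → 0ℚ ℚ.≤ x → x ℚ.< y → x ^ suc n ℚ.< y ^ suc n
^-monoˡ-< {x} {y} zero    0≤x x<y = subst₂ ℚ._<_ (sym (ℚ.*-identityʳ x)) (sym (ℚ.*-identityʳ y)) x<y
^-monoˡ-< {x} {y} (suc n) 0≤x x<y = ℚ.≤-<-trans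
  (ℚ.*-monoʳ-≤-nonNeg (x ^ suc n) {{ℚ.nonNegative (0≤^ (suc n) 0≤x)}} (ℚ.<⇒≤ x<y))
  (ℚ.*-monoʳ-<-pos y {{ℚ.positive (ℚ.≤-<-trans 0≤x x<y)}} (^-monoˡ-< n 0≤x x<y))

^-cancelˡ-≤ : ∀ {x y} n .{{_ : NonZero n}} → 0ℚ ℚ.≤ y → x ^ n ℚ.≤ y ^ n → x ℚ.≤ y
^-cancelˡ-≤ {x} {y} (suc n) 0≤y xⁿ≤yⁿ with ℚ._≤?_ x y
... | yes x≤y = x≤y
... | no  x≰y = ⊥-elim (ℚ.<-irrefl refl (ℚ.<-≤-trans (^-monoˡ-< n 0≤y (ℚ.≰⇒> x≰y)) xⁿ≤yⁿ))

∑ : List 𝔸 → (𝔸 → ℚ) → ℚ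
∑ xs f = List.foldr (λ x s → f x ℚ.+ s) 0ℚ xs

∏ : List 𝔸 → (𝔸 → ℚ) → ℚ
∏ xs f = List.foldr (λ x s → f x ℚ.* s) 1ℚ xs

∑-mono-≤ : (xs : List 𝔸) {f g : 𝔸 → ℚ} → (∀ {x} → x ∈ xs → f x ℚ.≤ g x) → ∑ xs f ℚ.≤ ∑ xs g
∑-mono-≤ []       h = ℚ.≤-refl
∑-mono-≤ (x ∷ xs) h = ℚ.+-mono-≤ (h (here refl)) (∑-mono-≤ xs (h ∘ there))

∑-cong : (xs : List 𝔸) {f g : 𝔸 → ℚ} → (∀ x → f x ≡ g x) → ∑ xs f ≡ ∑ xs g
∑-cong []       h = refl
∑-cong (x ∷ xs) h = cong₂ ℚ._+_ (h x) (∑-cong xs h)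

0≤∑ : (xs : List 𝔸) {f : 𝔸 → ℚ} → (∀ x → 0ℚ ℚ.≤ f x) → 0ℚ ℚ.≤ ∑ xs f
0≤∑ []       h = ℚ.≤-refl
0≤∑ (x ∷ xs) h = ℚ.+-mono-≤ (h x) (0≤∑ xs h)

x≤y+x : ∀ {x y} → 0ℚ ℚ.≤ y → x ℚ.≤ y ℚ.+ x
x≤y+x {x} {y} 0≤y = subst (ℚ._≤ y ℚ.+ x) (ℚ.+-identityˡ x) (ℚ.+-monoˡ-≤ x 0≤y)

x≤x+y : ∀ {x y} → 0ℚ ℚ.≤ y → x ℚ.≤ x ℚ.+ y
x≤x+y {x} {y} 0≤y = subst (ℚ._≤ x ℚ.+ y) (ℚ.+-identityʳ x) (ℚ.+-monoʳ-≤ x 0≤y)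

term≤∑ : {xs : List 𝔸} {f : 𝔸 → ℚ} → (∀ x → 0ℚ ℚ.≤ f x) → ∀ {x} → x ∈ xs → f x ℚ.≤ ∑ xs f
term≤∑ {xs = _ ∷ xs} 0≤f (here refl) = x≤x+y (0≤∑ xs 0≤f)
term≤∑ {xs = y ∷ _}  0≤f (there x∈)  = ℚ.≤-trans (term≤∑ 0≤f x∈) (x≤y+x (0≤f y))

∑-++ : (xs ys : List 𝔸) (f : 𝔸 → ℚ) → ∑ (xs ++ ys) f ≡ ∑ xs f ℚ.+ ∑ ys f
∑-++ []       ys f = sym (ℚ.+-identityˡ _)
∑-++ (x ∷ xs) ys f = trans (cong (f x ℚ.+_) (∑-++ xs ys f)) (sym (ℚ.+-assoc (f x) _ _))

∑-map : (xs : List 𝔸) (h : 𝔸 → 𝔹) (f : 𝔹 → ℚ) → ∑ (List.map h xs) f ≡ ∑ xs (f ∘ h)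
∑-map []       h f = refl
∑-map (x ∷ xs) h f = cong (f (h x) ℚ.+_) (∑-map xs h f)

∑-*ˡ : (c : ℚ) (xs : List 𝔸) (f : 𝔸 → ℚ) → ∑ xs (λ x → c ℚ.* f x) ≡ c ℚ.* ∑ xs f
∑-*ˡ c []       f = sym (ℚ.*-zeroʳ c)
∑-*ˡ c (x ∷ xs) f = trans (cong (c ℚ.* f x ℚ.+_) (∑-*ˡ c xs f)) (sym (ℚ.*-distribˡ-+ c (f x) _))

∑-zero : (xs : List 𝔸) → ∑ xs (const 0ℚ) ≡ 0ℚ
∑-zero []       = refl
∑-zero (_ ∷ xs) = trans (ℚ.+-identityˡ _) (∑-zero xs)

∑-+ : (xs : List 𝔸) (f g : 𝔸 → ℚ) → ∑ xs (λ x → f x ℚ.+ g x) ≡ ∑ xs f ℚ.+ ∑ xs g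
∑-+ []       f g = refl
∑-+ (x ∷ xs) f g = trans (cong ((f x ℚ.+ g x) ℚ.+_) (∑-+ xs f g)) (interchange (f x) (g x) _ _)
  where
  open import Algebra.Properties.CommutativeSemigroup
    (CommutativeRing.+-commutativeSemigroup ℚ.+-*-commutativeRing) using (interchange)

∑-swap : (xs : List 𝔸) (ys : List 𝔹) (f : 𝔸 → 𝔹 → ℚ) →
  ∑ xs (λ x → ∑ ys (f x)) ≡ ∑ ys (λ y → ∑ xs (λ x → f x y))
∑-swap []       ys f = sym (∑-zero ys)
∑-swap (x ∷ xs) ys f = trans (cong (∑ ys (f x) ℚ.+_) (∑-swap xs ys f)) (sym (∑-+ ys (f x) _))

∑-cartesianProductWith : ∀ {C : Set α} (c : 𝔸 → 𝔹 → C) (xs : List 𝔸) (ys : List 𝔹) (f : C → ℚ) →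
  ∑ (cartesianProductWith c xs ys) f ≡ ∑ xs (λ x → ∑ ys (λ y → f (c x y)))
∑-cartesianProductWith c []       ys f = refl
∑-cartesianProductWith c (x ∷ xs) ys f = trans
  (∑-++ (List.map (c x) ys) (cartesianProductWith c xs ys) f)
  (cong₂ ℚ._+_ (∑-map ys (c x) f) (∑-cartesianProductWith c xs ys f))

×ℚ-mono-≤ : ∀ {m n x} → 0ℚ ℚ.≤ x → m ℕ.≤ n → m ×ℚ x ℚ.≤ n ×ℚ x
×ℚ-mono-≤ {n = n} {x} 0≤x ℕ.z≤n = 0≤×ℚ n
  where
  0≤×ℚ : ∀ n → 0ℚ ℚ.≤ n ×ℚ x
  0≤×ℚ zero    = ℚ.≤-refl
  0≤×ℚ (suc n) = ℚ.+-mono-≤ 0≤x (0≤×ℚ n)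
×ℚ-mono-≤ {x = x} 0≤x (ℕ.s≤s m≤n) = ℚ.+-monoʳ-≤ x (×ℚ-mono-≤ 0≤x m≤n)

∑-const : (xs : List 𝔸) (c : ℚ) → ∑ xs (const c) ≡ length xs ×ℚ c
∑-const []       c = refl
∑-const (x ∷ xs) c = cong (c ℚ.+_) (∑-const xs c)

halves : ∀ x → ½ ℚ.* x ℚ.+ ½ ℚ.* x ≡ x
halves x = trans (sym (ℚ.*-distribʳ-+ x ½ ½)) (ℚ.*-identityˡ x)

2^n×½^n≡1 : ∀ n → (2 ℕ.^ n) ×ℚ (½ ^ n) ≡ 1ℚ
2^n×½^n≡1 zero    = refl
2^n×½^n≡1 (suc n) = begin
  (2 ℕ.* 2 ℕ.^ n) ×ℚ (½ ℚ.* ½ ^ n)   ≡⟨ cong (_×ℚ (½ ℚ.* ½ ^ n)) (ℕ.*-comm 2 (2 ℕ.^ n)) ⟩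
  (2 ℕ.^ n ℕ.* 2) ×ℚ (½ ℚ.* ½ ^ n)   ≡⟨ ×ℚ-assocˡ (½ ℚ.* ½ ^ n) (2 ℕ.^ n) 2 ⟨
  (2 ℕ.^ n) ×ℚ (2 ×ℚ (½ ℚ.* ½ ^ n))   ≡⟨ cong ((2 ℕ.^ n) ×ℚ_) (trans (cong (½ ℚ.* ½ ^ n ℚ.+_) (ℚ.+-identityʳ _))
                                        (halves (½ ^ n))) ⟩
  (2 ℕ.^ n) ×ℚ (½ ^ n)               ≡⟨ 2^n×½^n≡1 n ⟩
  1ℚ                                ∎
  where open ≡-Reasoning

∑-½^≤1 : (xs : List 𝔸) {e : ℕ} → length xs ℕ.≤ 2 ℕ.^ e → ∑ xs (const (½ ^ e)) ℚ.≤ 1ℚ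
∑-½^≤1 xs {e} h = subst₂ ℚ._≤_ (sym (∑-const xs (½ ^ e))) (2^n×½^n≡1 e) (×ℚ-mono-≤ (0≤^ e 0≤½) h)

-- A weighted pigeonhole principle: distinct members of xs have no common partner in ys.
∑-inject : {R : 𝔸 → 𝔹 → Set ℓ₁} {f : 𝔸 → ℚ} {g : 𝔹 → ℚ} (xs : List 𝔸) (ys : List 𝔹) →
  (∀ y → 0ℚ ℚ.≤ g y) →
  LAllPairs.AllPairs (λ x x′ → ∀ {y} → R x y → R x′ y → ⊥) xs →
  (∀ {x} → x ∈ xs → ∃[ y ] y ∈ ys × R x y × f x ℚ.≤ g y) →
  ∑ xs f ℚ.≤ ∑ ys g
∑-inject                 []       ys 0≤g []         h = 0≤∑ ys 0≤g
∑-inject {R = R} {f} {g} (x ∷ xs) ys 0≤g (x# ∷ xs#) h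
  with h (here refl)
... | y , y∈ , Rxy , fx≤gy with ∈.∈-∃++ y∈
... | ys₁ , ys₂ , refl = ℚ.≤-trans
  (ℚ.+-mono-≤ fx≤gy (∑-inject {R = R} {f} {g} xs (ys₁ ++ ys₂) 0≤g xs# h′))
  (ℚ.≤-reflexive (trans (cong (g y ℚ.+_) (∑-++ ys₁ ys₂ g))
    (trans (x∙yz≈y∙xz (g y) (∑ ys₁ g) (∑ ys₂ g)) (sym (∑-++ ys₁ (y ∷ ys₂) g)))))
  where
  open import Algebra.Properties.CommutativeSemigroup
    (CommutativeRing.+-commutativeSemigroup ℚ.+-*-commutativeRing) using (x∙yz≈y∙xz)
  h′ : ∀ {x′} → x′ ∈ xs → ∃[ y′ ] y′ ∈ ys₁ ++ ys₂ × R x′ y′ × f x′ ℚ.≤ g y′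
  h′ x′∈ with h (there x′∈)
  ... | y′ , y′∈ , Rx′y′ , ≤ with ∈.∈-++⁻ ys₁ y′∈
  ... | inj₁ i           = y′ , ∈.∈-++⁺ˡ i , Rx′y′ , ≤
  ... | inj₂ (there i)   = y′ , ∈.∈-++⁺ʳ ys₁ i , Rx′y′ , ≤
  ... | inj₂ (here refl) = ⊥-elim (LAll.lookup x# x′∈ Rxy Rx′y′)

-- Generating functions over assignments of values

assignments : List 𝔹 → List 𝔸 → List (List 𝔹)
assignments vs []       = [] ∷ []
assignments vs (_ ∷ as) = cartesianProductWith _∷_ vs (assignments vs as)

module _ (h : 𝔸 → 𝔹 → ℚ) where

  weight : List 𝔸 → List 𝔹 → ℚ
  weight []       _        = 1ℚ
  weight (a ∷ as) []       = 0ℚ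
  weight (a ∷ as) (v ∷ vs) = h a v ℚ.* weight as vs

  -- The distributive law. It turns a sum over all assignments of values to faces into a product of
  -- independent sums, one for each face.
  ∑-assignments : (vs : List 𝔹) (as : List 𝔸) →
    ∑ (assignments vs as) (weight as) ≡ ∏ as (λ a → ∑ vs (h a))
  ∑-assignments vs []       = ℚ.+-identityʳ 1ℚ
  ∑-assignments vs (a ∷ as) = begin
    ∑ (assignments vs (a ∷ as)) (weight (a ∷ as))
      ≡⟨ ∑-cartesianProductWith _∷_ vs (assignments vs as) (weight (a ∷ as)) ⟩
    ∑ vs (λ v → ∑ (assignments vs as) (λ ws → h a v ℚ.* weight as ws))
      ≡⟨ ∑-cong vs (λ v → ∑-*ˡ (h a v) (assignments vs as) (weight as)) ⟩
    ∑ vs (λ v → h a v ℚ.* W)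
      ≡⟨ ∑-cong vs (λ v → ℚ.*-comm (h a v) W) ⟩
    ∑ vs (λ v → W ℚ.* h a v)
      ≡⟨ ∑-*ˡ W vs (h a) ⟩
    W ℚ.* ∑ vs (h a)
      ≡⟨ ℚ.*-comm W _ ⟩
    ∑ vs (h a) ℚ.* W
      ≡⟨ cong (∑ vs (h a) ℚ.*_) (∑-assignments vs as) ⟩
    ∑ vs (h a) ℚ.* ∏ as (λ a → ∑ vs (h a)) ∎
    where
    open ≡-Reasoning
    W = ∑ (assignments vs as) (weight as)

  weight-map : (f : 𝔸 → 𝔹) (as : List 𝔸) → weight as (List.map f as) ≡ ∏ as (λ a → h a (f a))
  weight-map f []       = refl
  weight-map f (a ∷ as) = cong (h a (f a) ℚ.*_) (weight-map f as)

  0≤weight : (∀ a v → 0ℚ ℚ.≤ h a v) → ∀ as vs → 0ℚ ℚ.≤ weight as vs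
  0≤weight 0≤h []       _        = 0≤1
  0≤weight 0≤h (a ∷ as) []       = ℚ.≤-refl
  0≤weight 0≤h (a ∷ as) (v ∷ vs) = 0≤* (0≤h a v) (0≤weight 0≤h as vs)

map∈assignments : {vs : List 𝔹} (f : 𝔸 → 𝔹) → (∀ a → f a ∈ vs) →
  (as : List 𝔸) → List.map f as ∈ assignments vs as
map∈assignments f f∈ []       = here refl
map∈assignments f f∈ (a ∷ as) = ∈.∈-cartesianProductWith⁺ _∷_ (f∈ a) (map∈assignments f f∈ as)

0≤∏ : (as : List 𝔸) {f : 𝔸 → ℚ} → (∀ a → 0ℚ ℚ.≤ f a) → 0ℚ ℚ.≤ ∏ as f
0≤∏ []       0≤f = 0≤1
0≤∏ (a ∷ as) 0≤f = 0≤* (0≤f a) (0≤∏ as 0≤f)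

∏≤^ : (as : List 𝔸) {f : 𝔸 → ℚ} {c : ℚ} → (∀ a → 0ℚ ℚ.≤ f a) → (∀ a → f a ℚ.≤ c) →
  ∏ as f ℚ.≤ c ^ length as
∏≤^ []       0≤f f≤c = ℚ.≤-refl
∏≤^ (a ∷ as) 0≤f f≤c =
  *-mono-≤ (0≤∏ as 0≤f) (ℚ.≤-trans (0≤f a) (f≤c a)) (f≤c a) (∏≤^ as 0≤f f≤c)

-- A rational substitute for 1 - x ≤ exp(-x), with the product of the factors 1 + y in place of the
-- exponential. The induction rests on (1 - y - s)(1 + y) = (1 - s) - y(y + s).
1-∑*∏1+≤1 : (ys : List ℚ) → (∀ {y} → y ∈ ys → 0ℚ ℚ.≤ y) →
  (1ℚ ℚ.- ∑ ys id) ℚ.* ∏ ys (1ℚ ℚ.+_) ℚ.≤ 1ℚ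
1-∑*∏1+≤1 []       0≤ = ℚ.≤-refl
1-∑*∏1+≤1 (y ∷ ys) 0≤ = begin
  (1ℚ ℚ.- (y ℚ.+ s)) ℚ.* ((1ℚ ℚ.+ y) ℚ.* q)
    ≡⟨ solve 3 (λ y s q → (con 1ℚ :- (y :+ s)) :* ((con 1ℚ :+ y) :* q)
         := (con 1ℚ :- s) :* q :- (y :* (y :+ s)) :* q) refl y s q ⟩
  (1ℚ ℚ.- s) ℚ.* q ℚ.- (y ℚ.* (y ℚ.+ s)) ℚ.* q
    ≤⟨ ℚ.+-monoʳ-≤ ((1ℚ ℚ.- s) ℚ.* q) (ℚ.neg-antimono-≤
         (0≤* (0≤* 0≤y (ℚ.+-mono-≤ 0≤y 0≤s)) 0≤q)) ⟩
  (1ℚ ℚ.- s) ℚ.* q ℚ.- 0ℚ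
    ≡⟨ ℚ.+-identityʳ _ ⟩
  (1ℚ ℚ.- s) ℚ.* q
    ≤⟨ 1-∑*∏1+≤1 ys (0≤ ∘ there) ⟩
  1ℚ ∎
  where
  open ℚ.≤-Reasoning
  open +-*-Solver
  s = ∑ ys id
  q = ∏ ys (1ℚ ℚ.+_)
  0≤y = 0≤ (here refl)
  0≤s = ℚ.≤-trans (ℚ.≤-reflexive (sym (∑-zero ys))) (∑-mono-≤ ys (0≤ ∘ there))
  0≤q : 0ℚ ℚ.≤ q
  0≤q = 0≤∏-∈ ys (0≤ ∘ there)
    where
    0≤∏-∈ : ∀ ys → (∀ {y} → y ∈ ys → 0ℚ ℚ.≤ y) → 0ℚ ℚ.≤ ∏ ys (1ℚ ℚ.+_)
    0≤∏-∈ []       _  = 0≤1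
    0≤∏-∈ (y ∷ ys) 0≤ = 0≤* (ℚ.≤-trans 0≤1 (x≤x+y (0≤ (here refl)))) (0≤∏-∈ ys (0≤ ∘ there))

∏-replicate : ∀ n x (f : ℚ → ℚ) → ∏ (List.replicate n x) f ≡ f x ^ n
∏-replicate zero    x f = refl
∏-replicate (suc n) x f = cong (f x ℚ.*_) (∏-replicate n x f)

-- With 2^ξ copies of y = 2^(-ξ-1) summing to ½, the previous bound gives (1 + y)^(2^ξ) ≤ 2.
1+½^-power≤4 : ∀ ξ → (1ℚ ℚ.+ ½ ^ suc ξ) ^ (2 ℕ.^ suc ξ) ℚ.* ½ ^ 2 ℚ.≤ 1ℚ
1+½^-power≤4 ξ = begin
  z ^ (2 ℕ.* h) ℚ.* ½ ^ 2    ≡⟨ cong (λ e → z ^ e ℚ.* ½ ^ 2) (ℕ.*-comm 2 h) ⟩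
  z ^ (h ℕ.* 2) ℚ.* ½ ^ 2    ≡⟨ cong (ℚ._* ½ ^ 2) (^-assocʳ z h 2) ⟨
  (z ^ h) ^ 2 ℚ.* ½ ^ 2      ≡⟨ ^-distrib-* (z ^ h) ½ 2 ⟨
  (z ^ h ℚ.* ½) ^ 2          ≤⟨ ^≤1 2 (0≤* (0≤^ h 0≤z) 0≤½) half ⟩
  1ℚ                         ∎
  where
  open ℚ.≤-Reasoning
  y = ½ ^ suc ξ
  z = 1ℚ ℚ.+ y
  h = 2 ℕ.^ ξ
  ys = List.replicate h y
  0≤z = ℚ.≤-trans 0≤1 (x≤x+y (0≤^ (suc ξ) 0≤½))
  ∑≡½ : ∑ ys id ≡ ½
  ∑≡½ = begin-equality
    ∑ ys id                        ≡⟨ ∑-replicate h ⟩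
    ∑ ys (const y)                 ≡⟨ ∑-*ˡ ½ ys (const (½ ^ ξ)) ⟩
    ½ ℚ.* ∑ ys (const (½ ^ ξ))     ≡⟨ cong (½ ℚ.*_) (trans (∑-const ys (½ ^ ξ))
                                       (trans (cong (_×ℚ (½ ^ ξ)) (List.length-replicate h)) (2^n×½^n≡1 ξ))) ⟩
    ½                              ∎
    where
    ∑-replicate : ∀ h → ∑ (List.replicate h y) id ≡ ∑ (List.replicate h y) (const y)
    ∑-replicate zero    = refl
    ∑-replicate (suc h) = cong (y ℚ.+_) (∑-replicate h)
  half : z ^ h ℚ.* ½ ℚ.≤ 1ℚ
  half = begin
    z ^ h ℚ.* ½                              ≡⟨ ℚ.*-comm (z ^ h) ½ ⟩
    ½ ℚ.* z ^ h                              ≡⟨ cong₂ ℚ._*_ (cong (λ s → 1ℚ ℚ.- s) ∑≡½) (∏-replicate h y (1ℚ ℚ.+_)) ⟨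
    (1ℚ ℚ.- ∑ ys id) ℚ.* ∏ ys (1ℚ ℚ.+_)      ≤⟨ 1-∑*∏1+≤1 ys (λ y∈ → nonneg h y∈) ⟩
    1ℚ                                       ∎
    where
    nonneg : ∀ h {x} → x ∈ List.replicate h y → 0ℚ ℚ.≤ x
    nonneg (suc h) (here refl) = 0≤^ (suc ξ) 0≤½
    nonneg (suc h) (there x∈)  = nonneg h x∈

-- This stands in for a binomial coefficient: `N` will be the number of faces and `m` the support
-- size. The hypotheses make `N` times the weight 2^(-ξ-1) at most `m`, so the generating function
-- (1 + weight)^N is at most 4^m.
1+½^-power-bound : ∀ ξ {μ m N} → N ℕ.≤ 2 ℕ.^ (suc ξ ℕ.+ μ) → 2 ℕ.^ μ ℕ.≤ m →
  (1ℚ ℚ.+ ½ ^ suc ξ) ^ N ℚ.* ½ ^ (2 ℕ.* m) ℚ.≤ 1ℚ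
1+½^-power-bound ξ {μ} {m} {N} N≤ ≤m = begin
  z ^ N ℚ.* ½ ^ (2 ℕ.* m)
    ≤⟨ *-mono-≤ (0≤^ (2 ℕ.* m) 0≤½) (0≤^ (H ℕ.* M) 0≤z) zᴺ≤
         (^-anti-≤ 0≤½ ½≤1 (ℕ.*-monoʳ-≤ 2 ≤m)) ⟩
  z ^ (H ℕ.* M) ℚ.* ½ ^ (2 ℕ.* M)
    ≡⟨ cong₂ ℚ._*_ (^-assocʳ z H M) (^-assocʳ ½ 2 M) ⟨
  (z ^ H) ^ M ℚ.* (½ ^ 2) ^ M
    ≡⟨ ^-distrib-* (z ^ H) (½ ^ 2) M ⟨
  (z ^ H ℚ.* ½ ^ 2) ^ M
    ≤⟨ ^≤1 M (0≤* (0≤^ H 0≤z) (0≤^ 2 0≤½)) (1+½^-power≤4 ξ) ⟩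
  1ℚ ∎
  where
  open ℚ.≤-Reasoning
  z = 1ℚ ℚ.+ ½ ^ suc ξ
  H = 2 ℕ.^ suc ξ
  M = 2 ℕ.^ μ
  1≤z = x≤x+y (0≤^ (suc ξ) 0≤½)
  0≤z = ℚ.≤-trans 0≤1 1≤z
  zᴺ≤ : z ^ N ℚ.≤ z ^ (H ℕ.* M)
  zᴺ≤ = ^-mono-exponent (ℕ.≤-trans N≤ (ℕ.≤-reflexive (ℕ.^-distribˡ-+-* 2 (suc ξ) μ)))
    where
    ^-mono-exponent : ∀ {a b} → a ℕ.≤ b → z ^ a ℚ.≤ z ^ b
    ^-mono-exponent {b = zero}  ℕ.z≤n     = ℚ.≤-refl
    ^-mono-exponent {b = suc b} ℕ.z≤n     = ℚ.≤-trans (^-mono-exponent {b = b} ℕ.z≤n)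
      (ℚ.≤-trans (ℚ.≤-reflexive (sym (ℚ.*-identityˡ (z ^ b))))
        (ℚ.*-monoʳ-≤-nonNeg (z ^ b) {{ℚ.nonNegative (0≤^ b 0≤z)}} 1≤z))
    ^-mono-exponent (ℕ.s≤s a≤b) = ℚ.*-monoˡ-≤-nonNeg z {{ℚ.nonNegative 0≤z}} (^-mono-exponent a≤b)

∑-downFrom-½^ : ∀ N → ∑ (List.downFrom N) (λ i → ½ ^ suc i) ℚ.≤ 1ℚ
∑-downFrom-½^ N = ℚ.≤-trans (x≤x+y (0≤^ N 0≤½)) (ℚ.≤-reflexive (total N))
  where
  open ≡-Reasoning
  total : ∀ N → ∑ (List.downFrom N) (λ i → ½ ^ suc i) ℚ.+ ½ ^ N ≡ 1ℚ
  total zero    = refl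
  total (suc N) = begin
    (½ ^ suc N ℚ.+ s) ℚ.+ ½ ^ suc N  ≡⟨ cong (ℚ._+ ½ ^ suc N) (ℚ.+-comm (½ ^ suc N) s) ⟩
    (s ℚ.+ ½ ^ suc N) ℚ.+ ½ ^ suc N  ≡⟨ ℚ.+-assoc s _ _ ⟩
    s ℚ.+ (½ ^ suc N ℚ.+ ½ ^ suc N)  ≡⟨ cong (s ℚ.+_) (halves (½ ^ N)) ⟩
    s ℚ.+ ½ ^ N                      ≡⟨ total N ⟩
    1ℚ                               ∎
    where s = ∑ (List.downFrom N) (λ i → ½ ^ suc i)

listsUpTo : ∀ {a} {A : Set a} → List A → ℕ → List (List A)
listsUpTo xs zero    = [] ∷ []
listsUpTo xs (suc s) = [] ∷ cartesianProductWith _∷_ xs (listsUpTo xs s)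

∈-listsUpTo : ∀ {a} {A : Set a} {xs : List A} {ys s} → LAll.All (_∈ xs) ys → length ys ℕ.≤ s →
  ys ∈ listsUpTo xs s
∈-listsUpTo {s = zero}  []         _         = here refl
∈-listsUpTo {s = suc _} []         _         = here refl
∈-listsUpTo {s = suc _} (y∈ ∷ ys∈) (ℕ.s≤s ≤s) =
  there (∈.∈-cartesianProductWith⁺ _∷_ y∈ (∈-listsUpTo ys∈ ≤s))

length-listsUpTo : ∀ {a} {A : Set a} (xs : List A) s → length (listsUpTo xs s) ℕ.≤ suc (length xs) ℕ.^ s
length-listsUpTo xs zero    = ℕ.≤-refl
length-listsUpTo xs (suc s) = begin
  suc (length (cartesianProductWith _∷_ xs (listsUpTo xs s)))
    ≡⟨ cong suc (length-cartesianProductWith _∷_ xs (listsUpTo xs s)) ⟩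
  suc (length xs ℕ.* length (listsUpTo xs s))
    ≤⟨ ℕ.+-mono-≤ (ℕ.m^n>0 (suc (length xs)) s) (ℕ.*-monoʳ-≤ (length xs) (length-listsUpTo xs s)) ⟩
  suc (length xs) ℕ.^ s ℕ.+ length xs ℕ.* suc (length xs) ℕ.^ s ∎
  where open ℕ.≤-Reasoning

-- Exponents

n<2^n : ∀ n → n ℕ.< 2 ℕ.^ n
n<2^n zero    = ℕ.z<s
n<2^n (suc n) = begin-strict
  suc n                ≡⟨ ℕ.+-comm 1 n ⟩
  n ℕ.+ 1              <⟨ ℕ.+-mono-<-≤ (n<2^n n) (ℕ.m^n>0 2 n) ⟩
  2 ℕ.^ n ℕ.+ 2 ℕ.^ n  ≡⟨ cong (2 ℕ.^ n ℕ.+_) (ℕ.+-identityʳ _) ⟨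
  2 ℕ.^ suc n          ∎
  where open ℕ.≤-Reasoning

linear≤2^ : ∀ a b → ∃[ c ] ∀ j → a ℕ.* (c ℕ.+ j) ℕ.+ b ℕ.≤ 2 ℕ.^ (c ℕ.+ j)
linear≤2^ a b = c , λ j → proj₁ (go j)
  where
  open ℕ.≤-Reasoning
  x = a ℕ.+ b
  -- Three times `x`, so that 2^c is at least (1 + x)^3, whose expansion dominates x c + x. The
  -- extra bound on `a` carried by `go` is what each increase of the exponent consumes.
  c = x ℕ.+ x ℕ.+ x
  cube : suc x ℕ.* suc x ℕ.* suc x ℕ.≤ 2 ℕ.^ c
  cube = begin
    suc x ℕ.* suc x ℕ.* suc x
      ≤⟨ ℕ.*-mono-≤ (ℕ.*-mono-≤ (n<2^n x) (n<2^n x)) (n<2^n x) ⟩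
    2 ℕ.^ x ℕ.* 2 ℕ.^ x ℕ.* 2 ℕ.^ x
      ≡⟨ trans (ℕ.^-distribˡ-+-* 2 (x ℕ.+ x) x) (cong (ℕ._* 2 ℕ.^ x) (ℕ.^-distribˡ-+-* 2 x x)) ⟨
    2 ℕ.^ c ∎
  go : ∀ j → a ℕ.* (c ℕ.+ j) ℕ.+ b ℕ.≤ 2 ℕ.^ (c ℕ.+ j) × a ℕ.≤ 2 ℕ.^ (c ℕ.+ j)
  go zero rewrite ℕ.+-identityʳ c = (begin
      a ℕ.* c ℕ.+ b      ≤⟨ ℕ.+-mono-≤ (ℕ.*-monoˡ-≤ c (ℕ.m≤m+n a b)) (ℕ.m≤n+m b a) ⟩
      x ℕ.* c ℕ.+ x      ≤⟨ ℕ.m≤m+n _ (x ℕ.* x ℕ.* x ℕ.+ 2 ℕ.* x ℕ.+ 1) ⟩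
      x ℕ.* c ℕ.+ x ℕ.+ (x ℕ.* x ℕ.* x ℕ.+ 2 ℕ.* x ℕ.+ 1)
        ≡⟨ solve 1 (λ x → x :* (x :+ x :+ x) :+ x :+ (x :* x :* x :+ con 2 :* x :+ con 1)
             := (con 1 :+ x) :* (con 1 :+ x) :* (con 1 :+ x)) refl x ⟩
      suc x ℕ.* suc x ℕ.* suc x  ≤⟨ cube ⟩
      2 ℕ.^ c ∎) , (begin
      a        ≤⟨ ℕ.m≤m+n a b ⟩
      x        ≤⟨ ℕ.m≤n+m x (x ℕ.+ x) ⟩
      c        ≤⟨ ℕ.<⇒≤ (n<2^n c) ⟩
      2 ℕ.^ c  ∎)
    where open ℕSolver
  go (suc j) rewrite ℕ.+-suc c j = let h , a≤ = go j in (begin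
      a ℕ.* suc (c ℕ.+ j) ℕ.+ b          ≡⟨ cong (ℕ._+ b) (ℕ.*-suc a (c ℕ.+ j)) ⟩
      a ℕ.+ a ℕ.* (c ℕ.+ j) ℕ.+ b        ≡⟨ ℕ.+-assoc a _ b ⟩
      a ℕ.+ (a ℕ.* (c ℕ.+ j) ℕ.+ b)      ≤⟨ ℕ.+-mono-≤ a≤ h ⟩
      2 ℕ.^ (c ℕ.+ j) ℕ.+ 2 ℕ.^ (c ℕ.+ j)  ≡⟨ cong (2 ℕ.^ (c ℕ.+ j) ℕ.+_) (ℕ.+-identityʳ _) ⟨
      2 ℕ.^ suc (c ℕ.+ j)                ∎) ,
    ℕ.≤-trans a≤ (ℕ.m≤m+n _ _)

-- Any λ with both a l + b ≤ 2^λ and d (e + λ) ≤ l serves as the threshold between small and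
-- large supports, so it has to lie between log₂ l and l.
threshold : ∀ a b d e .{{_ : NonZero d}} →
  ∃[ l₀ ] ∀ l → l₀ ℕ.≤ l → ∃[ λ′ ] a ℕ.* l ℕ.+ b ℕ.≤ 2 ℕ.^ λ′ × d ℕ.* (e ℕ.+ λ′) ℕ.≤ l
threshold a b d e with linear≤2^ (a ℕ.* d) (a ℕ.* (d ℕ.* (e ℕ.+ 1)) ℕ.+ b)
-- The witness `c + j` equals `l / d - e`, the largest value that the second inequality allows.
-- Rounding in `l / d` loses at most `d`, hence the `e + 1` in the constants given to `linear≤2^`.
... | c , h = (e ℕ.+ c) ℕ.* d , λ l l₀≤l →
  let e+c≤q = ℕ.≤-trans (ℕ.≤-reflexive (sym (ℕ.m*n/n≡m (e ℕ.+ c) d))) (ℕ./-monoˡ-≤ d l₀≤l)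
      j , eq = ℕ.m≤n⇒∃[o]m+o≡n e+c≤q
  in c ℕ.+ j , (begin
      a ℕ.* l ℕ.+ b
        ≤⟨ ℕ.+-monoˡ-≤ b (ℕ.*-monoʳ-≤ a (l≤ l (trans (sym (ℕ.+-assoc e c j)) eq))) ⟩
      a ℕ.* (d ℕ.* (e ℕ.+ (c ℕ.+ j)) ℕ.+ d) ℕ.+ b
        ≡⟨ solve 5 (λ a b d e v → a :* (d :* (e :+ v) :+ d) :+ b
             := a :* d :* v :+ (a :* (d :* (e :+ con 1)) :+ b)) refl a b d e (c ℕ.+ j) ⟩
      a ℕ.* d ℕ.* (c ℕ.+ j) ℕ.+ (a ℕ.* (d ℕ.* (e ℕ.+ 1)) ℕ.+ b)
        ≤⟨ h j ⟩
      2 ℕ.^ (c ℕ.+ j) ∎) , (begin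
      d ℕ.* (e ℕ.+ (c ℕ.+ j))  ≡⟨ cong (d ℕ.*_) (trans (sym (ℕ.+-assoc e c j)) eq) ⟩
      d ℕ.* (l ℕ./ d)          ≡⟨ ℕ.*-comm d (l ℕ./ d) ⟩
      l ℕ./ d ℕ.* d            ≤⟨ ℕ.m/n*n≤m l d ⟩
      l                        ∎)
  where
  open ℕ.≤-Reasoning
  open ℕSolver
  l≤ : ∀ l {q} → q ≡ l ℕ./ d → l ℕ.≤ d ℕ.* q ℕ.+ d
  l≤ l {q} refl = begin
    l                              ≡⟨ ℕ.m≡m%n+[m/n]*n l d ⟩
    l ℕ.% d ℕ.+ l ℕ./ d ℕ.* d      ≤⟨ ℕ.+-monoˡ-≤ _ (ℕ.<⇒≤ (ℕ.m%n<n l d)) ⟩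
    d ℕ.+ l ℕ./ d ℕ.* d            ≡⟨ ℕ.+-comm d _ ⟩
    l ℕ./ d ℕ.* d ℕ.+ d            ≡⟨ cong (ℕ._+ d) (ℕ.*-comm (l ℕ./ d) d) ⟩
    d ℕ.* (l ℕ./ d) ℕ.+ d          ∎

-- Per unit of n m, `κ` holds `η` for the target, `ρ` for the value on a face, `k` for the rounding
-- of `l` to `suc l`, and 4 = 3 + 1. The last unit is a reserve: it absorbs the losses m k G and m m
-- G, together at most m n by the first two hypotheses.
small-support-exponent : ∀ {k′ n l η ρ v m b} .{{_ : NonZero m}} →
  let k = suc k′; κ = η ℕ.+ 4 ℕ.+ k ℕ.+ ρ; G = k ℕ.* l ℕ.+ κ in
  suc k ℕ.* G ℕ.≤ 2 ℕ.^ v → m ℕ.* 2 ℕ.^ v ℕ.≤ n → m ℕ.* n ℕ.≤ m ℕ.* k ℕ.+ (b ℕ.+ m ℕ.* m) →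
  n ℕ.* (η ℕ.+ 3 ℕ.* m ℕ.+ (k ℕ.* suc l ℕ.+ ρ) ℕ.* m) ℕ.≤ b ℕ.* G
small-support-exponent {k′} {n} {l} {η} {ρ} {v} {m} {b} h₁ h₂ h₃ = ℕ.+-cancelʳ-≤ (m ℕ.* n) _ _ (begin
  n ℕ.* (η ℕ.+ 3 ℕ.* m ℕ.+ (k ℕ.* suc l ℕ.+ ρ) ℕ.* m) ℕ.+ m ℕ.* n
    ≤⟨ ℕ.+-monoˡ-≤ (m ℕ.* n) (ℕ.*-monoʳ-≤ n (ℕ.+-monoˡ-≤ _ (ℕ.+-monoˡ-≤ (3 ℕ.* m) (ℕ.m≤m*n η m)))) ⟩
  n ℕ.* (η ℕ.* m ℕ.+ 3 ℕ.* m ℕ.+ (k ℕ.* suc l ℕ.+ ρ) ℕ.* m) ℕ.+ m ℕ.* n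
    ≡⟨ solve 6 (λ n m η k l ρ →
         n :* (η :* m :+ con 3 :* m :+ (k :* (con 1 :+ l) :+ ρ) :* m) :+ m :* n
         := m :* n :* (k :* l :+ (η :+ con 4 :+ k :+ ρ))) refl n m η k l ρ ⟩
  m ℕ.* n ℕ.* G
    ≤⟨ ℕ.*-monoˡ-≤ G h₃ ⟩
  (m ℕ.* k ℕ.+ (b ℕ.+ m ℕ.* m)) ℕ.* G
    ≤⟨ ℕ.*-monoˡ-≤ G (ℕ.+-monoˡ-≤ (b ℕ.+ m ℕ.* m) (ℕ.*-monoˡ-≤ k (ℕ.m≤m*n m m))) ⟩
  (m ℕ.* m ℕ.* k ℕ.+ (b ℕ.+ m ℕ.* m)) ℕ.* G
    ≡⟨ solve 4 (λ m k b G → (m :* m :* k :+ (b :+ m :* m)) :* G := b :* G :+ m :* (m :* ((con 1 :+ k) :* G)))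
         refl m k b G ⟩
  b ℕ.* G ℕ.+ m ℕ.* (m ℕ.* (suc k ℕ.* G))
    ≤⟨ ℕ.+-monoʳ-≤ (b ℕ.* G) (ℕ.*-monoʳ-≤ m (ℕ.≤-trans (ℕ.*-monoʳ-≤ m h₁) h₂)) ⟩
  b ℕ.* G ℕ.+ m ℕ.* n ∎)
  where
  open ℕ.≤-Reasoning
  open ℕSolver
  k = suc k′
  G = k ℕ.* l ℕ.+ (η ℕ.+ 4 ℕ.+ k ℕ.+ ρ)

-- The total coefficient of n m in the errors for large supports. `B` bounds n s / m; `k * B` pays
-- for listing `S`, `ρ * B * suc k` for the values on its neighbours, `1 + k′ + ρ` for the part of
-- the price of an uncovered face that depends on neither `l` nor `v`, and `k′ * k` for the term
-- `u * k` of the sparse bound.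
largeConstant : (k′ η ρ γ : ℕ) → ℕ
largeConstant k′ η ρ γ = η ℕ.+ 3 ℕ.+ k ℕ.* B ℕ.+ ρ ℕ.* B ℕ.* suc k ℕ.+ 1 ℕ.+ k′ ℕ.+ ρ ℕ.+ k′ ℕ.* k
  where
  k = suc k′
  B = 2 ℕ.* 2 ℕ.^ γ

-- Here b k l is b k′ l + b l. The sparse bound, multiplied by k′ l, charges the leading price k′ l
-- of the `u` uncovered faces to b k′ l; everything else is charged to b l through the minimality
-- bound.
large-support-exponent : ∀ {k′ n l η ρ v m b κ γ s t u} .{{_ : NonZero m}} →
  let k = suc k′; C = largeConstant k′ η ρ γ in
  n ℕ.* m ℕ.≤ b ℕ.* suc k → u ℕ.* n ℕ.≤ u ℕ.* k ℕ.+ (b ℕ.+ m ℕ.* t) → u ℕ.≤ m →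
  t ℕ.* 2 ℕ.^ γ ≡ 2 ℕ.^ l → 2 ℕ.^ l ℕ.≤ n → n ℕ.≤ 2 ℕ.* 2 ℕ.^ l → s ℕ.* t ℕ.≤ m →
  2 ℕ.* suc k ℕ.* (C ℕ.+ v) ℕ.≤ l → 2 ℕ.* suc k ℕ.* k′ ℕ.≤ 2 ℕ.^ γ →
  n ℕ.* (η ℕ.+ 3 ℕ.* m ℕ.+ k ℕ.* suc l ℕ.* s
    ℕ.+ (ρ ℕ.* (s ℕ.* (n ℕ.* suc k)) ℕ.+ (suc (k′ ℕ.* suc l ℕ.+ v) ℕ.+ ρ) ℕ.* u))
    ℕ.≤ b ℕ.* (k ℕ.* l ℕ.+ κ)
large-support-exponent {k′} {n} {l} {η} {ρ} {v} {m} {b} {κ} {γ} {s} {t} {u} h₁ h₂ u≤m t≡ 2ˡ≤n n≤ st≤m hC hγ = begin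
  n ℕ.* (η ℕ.+ 3 ℕ.* m ℕ.+ k ℕ.* suc l ℕ.* s
    ℕ.+ (ρ ℕ.* (s ℕ.* (n ℕ.* suc k)) ℕ.+ (suc (k′ ℕ.* suc l ℕ.+ v) ℕ.+ ρ) ℕ.* u))
    ≡⟨ solve 10 (λ n η m k l s ρ k′ v u →
         n :* (η :+ con 3 :* m :+ k :* (con 1 :+ l) :* s
           :+ (ρ :* (s :* (n :* (con 1 :+ k))) :+ (con 1 :+ (k′ :* (con 1 :+ l) :+ v) :+ ρ) :* u))
         := n :* (η :+ con 3 :* m :+ k :* ((con 1 :+ l) :* s) :+ ρ :* ((n :* s) :* (con 1 :+ k))
              :+ (con 1 :+ k′ :+ v :+ ρ) :* u) :+ k′ :* l :* (u :* n))
         refl n η m k l s ρ k′ v u ⟩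
  n ℕ.* (η ℕ.+ 3 ℕ.* m ℕ.+ k ℕ.* (suc l ℕ.* s) ℕ.+ ρ ℕ.* ((n ℕ.* s) ℕ.* suc k) ℕ.+ (1 ℕ.+ k′ ℕ.+ v ℕ.+ ρ) ℕ.* u)
    ℕ.+ k′ ℕ.* l ℕ.* (u ℕ.* n)
    ≤⟨ ℕ.+-mono-≤
         (ℕ.*-monoʳ-≤ n (ℕ.+-mono-≤ (ℕ.+-mono-≤ (ℕ.+-mono-≤ (ℕ.+-monoˡ-≤ (3 ℕ.* m) (ℕ.m≤m*n η m))
           (ℕ.*-monoʳ-≤ k (ℕ.≤-trans (ℕ.*-monoˡ-≤ s (ℕ.≤-trans (n<2^n l) 2ˡ≤n)) ns≤Bm)))
           (ℕ.*-monoʳ-≤ ρ (ℕ.*-monoˡ-≤ (suc k) ns≤Bm)))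
           (ℕ.*-monoʳ-≤ (1 ℕ.+ k′ ℕ.+ v ℕ.+ ρ) u≤m)))
         (ℕ.*-monoʳ-≤ (k′ ℕ.* l) h₂) ⟩
  n ℕ.* (η ℕ.* m ℕ.+ 3 ℕ.* m ℕ.+ k ℕ.* (B ℕ.* m) ℕ.+ ρ ℕ.* ((B ℕ.* m) ℕ.* suc k) ℕ.+ (1 ℕ.+ k′ ℕ.+ v ℕ.+ ρ) ℕ.* m)
    ℕ.+ k′ ℕ.* l ℕ.* (u ℕ.* k ℕ.+ (b ℕ.+ m ℕ.* t))
    ≡⟨ solve 12 (λ n η m k B ρ k′ v l u b t →
         n :* (η :* m :+ con 3 :* m :+ k :* (B :* m) :+ ρ :* ((B :* m) :* (con 1 :+ k)) :+ (con 1 :+ k′ :+ v :+ ρ) :* m)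
           :+ k′ :* l :* (u :* k :+ (b :+ m :* t))
         := n :* m :* (η :+ con 3 :+ k :* B :+ ρ :* B :* (con 1 :+ k) :+ con 1 :+ k′ :+ ρ :+ v)
              :+ k′ :* k :* (l :* u) :+ k′ :* l :* b :+ k′ :* l :* (m :* t))
         refl n η m k B ρ k′ v l u b t ⟩
  n ℕ.* m ℕ.* (η ℕ.+ 3 ℕ.+ k ℕ.* B ℕ.+ ρ ℕ.* B ℕ.* suc k ℕ.+ 1 ℕ.+ k′ ℕ.+ ρ ℕ.+ v)
    ℕ.+ k′ ℕ.* k ℕ.* (l ℕ.* u) ℕ.+ k′ ℕ.* l ℕ.* b ℕ.+ k′ ℕ.* l ℕ.* (m ℕ.* t)
    ≤⟨ ℕ.+-monoˡ-≤ (k′ ℕ.* l ℕ.* (m ℕ.* t)) (ℕ.+-monoˡ-≤ (k′ ℕ.* l ℕ.* b) (ℕ.+-monoʳ-≤ _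
         (ℕ.*-monoʳ-≤ (k′ ℕ.* k) (ℕ.*-mono-≤ (ℕ.≤-trans (ℕ.<⇒≤ (n<2^n l)) 2ˡ≤n) u≤m)))) ⟩
  n ℕ.* m ℕ.* (η ℕ.+ 3 ℕ.+ k ℕ.* B ℕ.+ ρ ℕ.* B ℕ.* suc k ℕ.+ 1 ℕ.+ k′ ℕ.+ ρ ℕ.+ v)
    ℕ.+ k′ ℕ.* k ℕ.* (n ℕ.* m) ℕ.+ k′ ℕ.* l ℕ.* b ℕ.+ k′ ℕ.* l ℕ.* (m ℕ.* t)
    ≡⟨ solve 11 (λ n m η k B ρ k′ v l b t →
         n :* m :* (η :+ con 3 :+ k :* B :+ ρ :* B :* (con 1 :+ k) :+ con 1 :+ k′ :+ ρ :+ v)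
           :+ k′ :* k :* (n :* m) :+ k′ :* l :* b :+ k′ :* l :* (m :* t)
         := n :* m :* (η :+ con 3 :+ k :* B :+ ρ :* B :* (con 1 :+ k) :+ con 1 :+ k′ :+ ρ :+ k′ :* k :+ v)
              :+ k′ :* l :* (m :* t) :+ k′ :* l :* b)
         refl n m η k B ρ k′ v l b t ⟩
  n ℕ.* m ℕ.* (C ℕ.+ v) ℕ.+ k′ ℕ.* l ℕ.* (m ℕ.* t) ℕ.+ k′ ℕ.* l ℕ.* b
    ≤⟨ ℕ.+-monoˡ-≤ (k′ ℕ.* l ℕ.* b) (ℕ.*-cancelˡ-≤ (2 ℕ.* suc k) main) ⟩
  b ℕ.* l ℕ.+ k′ ℕ.* l ℕ.* b
    ≡⟨ solve 3 (λ b l k′ → b :* l :+ k′ :* l :* b := b :* ((con 1 :+ k′) :* l)) refl b l k′ ⟩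
  b ℕ.* (k ℕ.* l)
    ≤⟨ ℕ.*-monoʳ-≤ b (ℕ.m≤m+n (k ℕ.* l) κ) ⟩
  b ℕ.* (k ℕ.* l ℕ.+ κ) ∎
  where
  open ℕ.≤-Reasoning
  open ℕSolver
  k = suc k′
  B = 2 ℕ.* 2 ℕ.^ γ
  C = largeConstant k′ η ρ γ
  ns≤Bm : n ℕ.* s ℕ.≤ B ℕ.* m
  ns≤Bm = begin
    n ℕ.* s                        ≤⟨ ℕ.*-monoˡ-≤ s n≤ ⟩
    2 ℕ.* 2 ℕ.^ l ℕ.* s            ≡⟨ cong (λ x → 2 ℕ.* x ℕ.* s) t≡ ⟨
    2 ℕ.* (t ℕ.* 2 ℕ.^ γ) ℕ.* s    ≡⟨ solve 3 (λ t g s → con 2 :* (t :* g) :* s := con 2 :* g :* (s :* t))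
      refl t (2 ℕ.^ γ) s ⟩
    B ℕ.* (s ℕ.* t)                ≤⟨ ℕ.*-monoʳ-≤ B st≤m ⟩
    B ℕ.* m                        ∎
  -- Two errors share the budget equally: after multiplication by `2 * suc k` each is at most n m l,
  -- the first by the smallness of `C + v` against `l`, the second by that of `t` against `n`.
  main : 2 ℕ.* suc k ℕ.* (n ℕ.* m ℕ.* (C ℕ.+ v) ℕ.+ k′ ℕ.* l ℕ.* (m ℕ.* t)) ℕ.≤ 2 ℕ.* suc k ℕ.* (b ℕ.* l)
  main = begin
    2 ℕ.* suc k ℕ.* (n ℕ.* m ℕ.* (C ℕ.+ v) ℕ.+ k′ ℕ.* l ℕ.* (m ℕ.* t))
      ≡⟨ solve 7 (λ d nm Cv k′ l m t → d :* (nm :* Cv :+ k′ :* l :* (m :* t))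
           := nm :* (d :* Cv) :+ l :* m :* (t :* (d :* k′))) refl (2 ℕ.* suc k) (n ℕ.* m) (C ℕ.+ v) k′ l m t ⟩
    n ℕ.* m ℕ.* (2 ℕ.* suc k ℕ.* (C ℕ.+ v)) ℕ.+ l ℕ.* m ℕ.* (t ℕ.* (2 ℕ.* suc k ℕ.* k′))
      ≤⟨ ℕ.+-mono-≤ (ℕ.*-monoʳ-≤ (n ℕ.* m) hC) (ℕ.*-monoʳ-≤ (l ℕ.* m)
           (ℕ.≤-trans (ℕ.*-monoʳ-≤ t hγ) (ℕ.≤-trans (ℕ.≤-reflexive t≡) 2ˡ≤n))) ⟩
    n ℕ.* m ℕ.* l ℕ.+ l ℕ.* m ℕ.* n
      ≡⟨ solve 3 (λ n m l → n :* m :* l :+ l :* m :* n := con 2 :* l :* (n :* m)) refl n m l ⟩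
    2 ℕ.* l ℕ.* (n ℕ.* m)
      ≤⟨ ℕ.*-monoʳ-≤ (2 ℕ.* l) h₁ ⟩
    2 ℕ.* l ℕ.* (b ℕ.* suc k)
      ≡⟨ solve 3 (λ l b k → con 2 :* l :* (b :* (con 1 :+ k)) := con 2 :* (con 1 :+ k) :* (b :* l)) refl l b k ⟩
    2 ℕ.* suc k ℕ.* (b ℕ.* l) ∎

-- Weights of cochains

unique-⊆⇒length≤ : ∀ {a} {A : Set a} {xs ys : List A} → LUnique.Unique xs → (∀ {x} → x ∈ xs → x ∈ ys) →
  length xs ℕ.≤ length ys
unique-⊆⇒length≤ {xs = xs} {ys} u xs⊆ys = length-inject {R = _≡_} xs ys
  (LAllPairs.map (λ { x≢x {_} refl refl → x≢x refl }) u) (λ x∈ → _ , xs⊆ys x∈ , refl)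

module Weights {o ρ : ℕ} (o≤2^ρ : o ℕ.≤ 2 ℕ.^ ρ) (i₀ : Fin o)
  {n m : ℕ} (C : List (Vec (Fin n) m)) (ξ : ℕ) where

  label : Fin o → ℚ
  label i with i Fin.≟ i₀
  ... | yes _ = 1ℚ
  ... | no  _ = ½ ^ (ξ ℕ.+ ρ)

  -- Weights whose total over all values stays near 1. On a covered face all values count alike and
  -- total at most 1. On an uncovered face the zero value is free and each other value costs ξ + ρ
  -- binary digits, for a total of at most 1 + 2^(-ξ).
  factor : Vec (Fin n) m → Fin o → ℚ
  factor σ i with σ ∈? C
  ... | yes _ = ½ ^ ρ
  ... | no  _ = label i

  0≤label : ∀ i → 0ℚ ℚ.≤ label i
  0≤label i with i Fin.≟ i₀
  ... | yes _ = 0≤1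
  ... | no  _ = 0≤^ (ξ ℕ.+ ρ) 0≤½

  0≤factor : ∀ σ i → 0ℚ ℚ.≤ factor σ i
  0≤factor σ i with σ ∈? C
  ... | yes _ = 0≤^ ρ 0≤½
  ... | no  _ = 0≤label i

  ∑-½^ρ≤1 : ∑ (allFin o) (const (½ ^ ρ)) ℚ.≤ 1ℚ
  ∑-½^ρ≤1 = ∑-½^≤1 (allFin o) {ρ} (ℕ.≤-trans (ℕ.≤-reflexive (List.length-tabulate {n = o} id)) o≤2^ρ)

  ∑-label≤ : ∑ (allFin o) label ℚ.≤ 1ℚ ℚ.+ ½ ^ ξ
  ∑-label≤ = ℚ.≤-trans (go (LUnique.allFin⁺ o)) (ℚ.+-monoʳ-≤ 1ℚ (begin
    ∑ (allFin o) (const y)                    ≡⟨ ∑-cong (allFin o) (λ _ → ^-homo-* ½ ξ ρ) ⟩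
    ∑ (allFin o) (λ _ → ½ ^ ξ ℚ.* ½ ^ ρ)      ≡⟨ ∑-*ˡ (½ ^ ξ) (allFin o) (const (½ ^ ρ)) ⟩
    ½ ^ ξ ℚ.* ∑ (allFin o) (const (½ ^ ρ))    ≤⟨ ℚ.*-monoˡ-≤-nonNeg (½ ^ ξ) {{ℚ.nonNegative (0≤^ ξ 0≤½)}} ∑-½^ρ≤1 ⟩
    ½ ^ ξ ℚ.* 1ℚ                              ≡⟨ ℚ.*-identityʳ (½ ^ ξ) ⟩
    ½ ^ ξ                                     ∎))
    where
    open ℚ.≤-Reasoning
    y = ½ ^ (ξ ℕ.+ ρ)
    rest : ∀ {is} → LAll.All (i₀ ≢_) is → ∑ is label ≡ ∑ is (const y)
    rest []                  = refl
    rest {i ∷ is} (i₀≢ ∷ i₀#) with i Fin.≟ i₀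
    ... | yes refl = contradiction refl i₀≢
    ... | no  _    = cong (y ℚ.+_) (rest i₀#)
    go : ∀ {is} → LUnique.Unique is → ∑ is label ℚ.≤ 1ℚ ℚ.+ ∑ is (const y)
    go []            = 0≤1
    go {i ∷ is} (i# ∷ is#) with i Fin.≟ i₀
    ... | yes refl = ℚ.+-monoʳ-≤ 1ℚ (ℚ.≤-trans (ℚ.≤-reflexive (rest i#)) (x≤y+x (0≤^ (ξ ℕ.+ ρ) 0≤½)))
    ... | no  _    = ℚ.≤-trans (ℚ.+-monoʳ-≤ y (go is#)) (ℚ.≤-reflexive
      (solve 2 (λ y s → y :+ (con 1ℚ :+ s) := con 1ℚ :+ (y :+ s)) refl y (∑ is (const y))))
      where open +-*-Solver

  ∑-factor≤ : ∀ σ → ∑ (allFin o) (factor σ) ℚ.≤ 1ℚ ℚ.+ ½ ^ ξ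
  ∑-factor≤ σ with σ ∈? C
  ... | yes _ = ℚ.≤-trans ∑-½^ρ≤1 (x≤x+y (0≤^ ξ 0≤½))
  ... | no  _ = ∑-label≤

  private
    shrink : ∀ c e e′ {x} → ½ ^ e ℚ.≤ x → c ℕ.+ e ℕ.≤ e′ → ½ ^ e′ ℚ.≤ ½ ^ c ℚ.* x
    shrink c e e′ {x} ½^e≤x c+e≤e′ = begin
      ½ ^ e′            ≤⟨ ^-anti-≤ 0≤½ ½≤1 c+e≤e′ ⟩
      ½ ^ (c ℕ.+ e)     ≡⟨ ^-homo-* ½ c e ⟩
      ½ ^ c ℚ.* ½ ^ e   ≤⟨ ℚ.*-monoˡ-≤-nonNeg (½ ^ c) {{ℚ.nonNegative (0≤^ c 0≤½)}} ½^e≤x ⟩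
      ½ ^ c ℚ.* x       ∎
      where open ℚ.≤-Reasoning

    count : List (Vec (Fin n) m) → List (Vec (Fin n) m) → ℕ
    count ys as = length (filter (_∈? ys) as)

    E : ℕ → ℕ → ℕ
    E a u = ρ ℕ.* a ℕ.+ (ξ ℕ.+ ρ) ℕ.* u

    arith₁ : ∀ a b {x y z} → y ℕ.≤ z → a ℕ.+ (a ℕ.* x ℕ.+ b ℕ.* y) ℕ.≤ a ℕ.* suc x ℕ.+ b ℕ.* z
    arith₁ a b {x} {y} {z} y≤z = ℕ.≤-trans (ℕ.≤-reflexive (sym (ℕ.+-assoc a (a ℕ.* x) (b ℕ.* y))))
      (ℕ.+-mono-≤ (ℕ.≤-reflexive (sym (ℕ.*-suc a x))) (ℕ.*-monoʳ-≤ b y≤z))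

    arith₂ : ∀ b {x y} → b ℕ.+ (x ℕ.+ b ℕ.* y) ≡ x ℕ.+ b ℕ.* suc y
    arith₂ b {x} {y} = solve 3 (λ b x y → b :+ (x :+ b :* y) := x :+ b :* (con 1 :+ y)) refl b x y
      where open ℕSolver

  -- A face outside `C` and `W` has the zero value and contributes the factor 1. A face in both
  -- lists is charged twice on the left, which only weakens the bound.
  ∏-factor≥ : (value : Vec (Fin n) m → Fin o) (W : List (Vec (Fin n) m)) →
    ∀ as → (∀ {σ} → σ ∈ as → σ ∈ C ⊎ σ ∈ W ⊎ value σ ≡ i₀) →
    ½ ^ (ρ ℕ.* length (filter (_∈? C) as) ℕ.+ (ξ ℕ.+ ρ) ℕ.* length (filter (_∈? W) as))
      ℚ.≤ ∏ as (λ σ → factor σ (value σ))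
  ∏-factor≥ value W []       cover = ^≤1 (ρ ℕ.* 0 ℕ.+ (ξ ℕ.+ ρ) ℕ.* 0) 0≤½ ½≤1
  ∏-factor≥ value W (σ ∷ as) cover with ∏-factor≥ value W as (cover ∘ there)
  ... | ih with σ ∈? C | σ ∈? W
  ...   | yes _  | yes _  = shrink ρ (E (count C as) (count W as)) (E (suc (count C as)) (suc (count W as))) ih
    (arith₁ ρ (ξ ℕ.+ ρ) {count C as} (ℕ.n≤1+n (count W as)))
  ...   | yes _  | no  _  = shrink ρ (E (count C as) (count W as)) (E (suc (count C as)) (count W as)) ih
    (arith₁ ρ (ξ ℕ.+ ρ) {count C as} {count W as} ℕ.≤-refl)
  ...   | no  ∉C | W?     with value σ Fin.≟ i₀ | W?
  ...     | yes _  | yes _  = shrink 0 (E (count C as) (count W as)) (E (count C as) (suc (count W as))) ih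
                                (ℕ.+-monoʳ-≤ (ρ ℕ.* (count C as)) (ℕ.*-monoʳ-≤ (ξ ℕ.+ ρ) (ℕ.n≤1+n (count W as))))
  ...     | yes _  | no  _  = shrink 0 (E (count C as) (count W as)) (E (count C as) (count W as)) ih ℕ.≤-refl
  ...     | no  _  | yes _  = shrink (ξ ℕ.+ ρ) (E (count C as) (count W as)) (E (count C as) (suc (count W as))) ih
    (ℕ.≤-reflexive (arith₂ (ξ ℕ.+ ρ) {ρ ℕ.* (count C as)} {count W as}))
  ...     | no  ≢i₀ | no ∉W with cover (here refl)
  ...       | inj₁ ∈C        = contradiction ∈C ∉C
  ...       | inj₂ (inj₁ ∈W) = contradiction ∈W ∉W
  ...       | inj₂ (inj₂ ≡i₀) = contradiction ≡i₀ ≢i₀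

-- Only `Q ^ n` is controlled and `b` need not be a multiple of `n`, so the two sides are compared
-- through their n-th powers.
power-bound : ∀ {n e b G Q} .{{_ : NonZero n}} → 0ℚ ℚ.≤ Q → Q ^ n ℚ.≤ ½ ^ G → n ℕ.* e ℕ.≤ b ℕ.* G →
  Q ^ b ℚ.≤ ½ ^ e
power-bound {n} {e} {b} {G} {Q} 0≤Q Qⁿ≤ ne≤bG = ^-cancelˡ-≤ n (0≤^ e 0≤½) (begin
  (Q ^ b) ^ n     ≡⟨ trans (^-assocʳ Q b n) (trans (cong (Q ^_) (ℕ.*-comm b n)) (sym (^-assocʳ Q n b))) ⟩
  (Q ^ n) ^ b     ≤⟨ ^-monoˡ-≤ b (0≤^ n 0≤Q) Qⁿ≤ ⟩
  (½ ^ G) ^ b     ≡⟨ trans (^-assocʳ ½ G b) (cong (½ ^_) (ℕ.*-comm G b)) ⟩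
  ½ ^ (b ℕ.* G)   ≤⟨ ^-anti-≤ 0≤½ ½≤1 (ℕ.≤-trans (ℕ.≤-reflexive (ℕ.*-comm e n)) ne≤bG) ⟩
  ½ ^ (e ℕ.* n)   ≡⟨ ^-assocʳ ½ e n ⟨
  (½ ^ e) ^ n     ∎)
  where open ℚ.≤-Reasoning

-- What a support size m has to provide: lists of at most s faces, and weights
-- 2^(-ξ-1) for the uncovered faces whose total over all cochains is at most 4^m.
record Scheme {c ℓ} (R : FiniteAbelianGroup c ℓ) (k′ η K n m : ℕ) (Q : ℚ) : Set (c Level.⊔ ℓ) where
  open FiniteAbelianGroup R using (order; ε; enumeration)
  open Inverse enumeration using (from)
  open Cochains R n
  open CochainBounds R n

  field
    s μ ξ : ℕ
    ξ+μ≡K : suc ξ ℕ.+ μ ≡ K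
    2^μ≤m : 2 ℕ.^ μ ℕ.≤ m

  -- The discount on each term: `K * s` offsets the number of lists `S`, two of the three `m` offset
  -- the total mass 4^m, and the third leaves 2^(-m), so that the sum over all sizes converges to at
  -- most 2^(-η).
  scale : ℕ
  scale = η ℕ.+ 3 ℕ.* m ℕ.+ K ℕ.* s

  mass : List (Vec (Fin n) (suc k′)) → Function (suc k′) → ℚ
  mass S φ = ∏ (increasingVectors n (suc k′)) (λ σ →
    Weights.factor {ρ = order} (ℕ.<⇒≤ (n<2^n order)) (from ε) (Γ S) (suc ξ) σ (from (extend R n φ σ)))

  field
    charge : ∀ {φ : Function (suc k′)} → SkewSymmetric φ → In𝒢 φ → size φ ≡ m →
      ∃[ S ] S ∈ listsUpTo (increasingVectors n (suc k′)) s × Q ^ b φ ℚ.≤ ½ ^ scale ℚ.* mass S φ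

module _ {c ℓ} (R : FiniteAbelianGroup c ℓ) (k′ : ℕ) where

  open FiniteAbelianGroup R hiding (refl)
  private module R = FiniteAbelianGroup R
  open Inverse enumeration using (from; from-cong; to; to-cong; strictlyInverseˡ)

  private
    k = suc k′

  module _ (n : ℕ) where

    open Cochains R n
    open CochainBounds R n

    private
      A = increasingVectors n k

      ρ = order
      order≤ = ℕ.<⇒≤ (n<2^n order)

    -- A cochain is determined by its values on increasing simplices, so the members of `𝒢` inject
    -- into all assignments of values, and the sum over the latter factors.
    ∑𝒢-∏≤ : (h : Vec (Fin n) k → Fin order → ℚ) → (∀ σ i → 0ℚ ℚ.≤ h σ i) →
      ∑ (𝒢 k) (λ φ → ∏ A (λ σ → h σ (from (extend R n φ σ)))) ℚ.≤ ∏ A (λ σ → ∑ (allFin order) (h σ))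
    ∑𝒢-∏≤ h 0≤h = ℚ.≤-trans
      (∑-inject {R = Codes} (𝒢 k) (assignments (allFin order) A) (0≤weight h 0≤h A)
        (filter⁺ in𝒢? (LAllPairs.map apart (cochains-distinct R n k)))
        (λ {φ} φ∈ → code φ , map∈assignments (from ∘ extend R n φ) (λ _ → ∈.∈-allFin _) A ,
          (skew φ∈ , refl) , ℚ.≤-reflexive (sym (weight-map h (from ∘ extend R n φ) A))))
      (ℚ.≤-reflexive (∑-assignments h (allFin order) A))
      where
      open import Data.List.Relation.Unary.AllPairs.Properties using (filter⁺)
      code : Function k → List (Fin order)
      code φ = List.map (from ∘ extend R n φ) A
      -- Skew symmetry is recorded in the relation because a code determines the cochain only among
      -- skew-symmetric functions, and `∑-inject` asks for disjointness without mentioning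
      -- membership in the list.
      Codes : Function k → List (Fin order) → Set ℓ
      Codes φ is = SkewSymmetric φ × is ≡ code φ
      skew : ∀ {φ} → φ ∈ 𝒢 k → SkewSymmetric φ
      skew φ∈ = proj₂ (∈.∈-filter⁻ skewSymmetric? {xs = functions _≟ˢ_ ε elements (orderedSimplices n k)}
        (proj₁ (∈.∈-filter⁻ in𝒢? {xs = cochains k} φ∈)))
      from-injective : ∀ {x y} → from x ≡ from y → x ≈ y
      from-injective {x} {y} eq = ≈-trans (≈-sym (strictlyInverseˡ x)) (≈-trans (to-cong eq) (strictlyInverseˡ y))
      map-injective-on : ∀ {a b} {A : Set a} {B : Set b} (f g : A → B) {xs} →
        List.map f xs ≡ List.map g xs → ∀ {x} → x ∈ xs → f x ≡ g x
      map-injective-on f g eq (here refl) = List.∷-injectiveˡ eq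
      map-injective-on f g eq (there x∈)  = map-injective-on f g (List.∷-injectiveʳ eq) x∈
      apart : ∀ {φ ψ} → ¬ (∀ σ → φ σ ≈ ψ σ) → ∀ {is} → Codes φ is → Codes ψ is → ⊥
      apart {φ} {ψ} φ≠ψ (sφ , eq) (sψ , eq′) = φ≠ψ (determined-by-increasing {φ = φ} {ψ} sφ sψ
        (λ v∈ → from-injective (map-injective-on (from ∘ extend R n φ) (from ∘ extend R n ψ) (trans (sym eq) eq′) v∈)))

    module _ (η K : ℕ) (A<2^K : suc (length A) ℕ.≤ 2 ℕ.^ K) (Q : ℚ)
             (scheme : ∀ i → Scheme R k′ η K n (suc i) Q) where

      open Scheme

      private
        ms = List.downFrom (length A)

        bound : ℕ → Function k → ℚ
        bound i φ = ∑ (listsUpTo A (s (scheme i))) (λ S → ½ ^ scale (scheme i) ℚ.* mass (scheme i) S φ)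

        0≤summand : ∀ i φ S → 0ℚ ℚ.≤ ½ ^ scale (scheme i) ℚ.* mass (scheme i) S φ
        0≤summand i φ S = 0≤* (0≤^ (scale (scheme i)) 0≤½)
          (0≤∏ A (λ σ → Weights.0≤factor {ρ = ρ} order≤ (from ε) (Γ S) _ σ _))

        0≤bound : ∀ i φ → 0ℚ ℚ.≤ bound i φ
        0≤bound i φ = 0≤∑ (listsUpTo A (s (scheme i))) (0≤summand i φ)

        term≤bounds : ∀ {φ} → φ ∈ 𝒢 k → Q ^ b φ ℚ.≤ ∑ ms (λ i → bound i φ)
        term≤bounds {φ} φ∈ with ∈.∈-filter⁻ in𝒢? {xs = cochains k} φ∈
        ... | φ∈c , φ∈𝒢 with ∈.∈-filter⁻ skewSymmetric? {xs = functions _≟ˢ_ ε elements (orderedSimplices n k)} φ∈c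
        ... | _ , sφ with size φ in eq | nonzero⇒0<size sφ (proj₁ φ∈𝒢) | size≤
          where
          size≤ : size φ ℕ.≤ length A
          size≤ = ℕ.≤-trans (List.length-filter _ (faces n k))
            (ℕ.≤-reflexive (sym (List.length-map vertices (faces n k))))
        ... | suc i | _ | i< with charge (scheme i) sφ φ∈𝒢 eq
        ...   | S , S∈ , Q≤ = ℚ.≤-trans Q≤ (ℚ.≤-trans (term≤∑ (0≤summand i φ) S∈)
                (term≤∑ (λ i → 0≤bound i φ) (∈.∈-downFrom⁺ i<)))

        ∑mass≤ : ∀ i S → ∑ (𝒢 k) (mass (scheme i) S) ℚ.≤ (1ℚ ℚ.+ ½ ^ suc (ξ (scheme i))) ^ length A
        ∑mass≤ i S = ℚ.≤-trans (∑𝒢-∏≤ factor 0≤factor)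
          (∏≤^ A (λ σ → 0≤∑ (allFin order) (0≤factor σ)) ∑-factor≤)
          where open Weights {ρ = ρ} order≤ (from ε) (Γ S) (suc (ξ (scheme i)))

        ∑bound≤ : ∀ i → ∑ (𝒢 k) (bound i) ℚ.≤ ½ ^ η ℚ.* ½ ^ suc i
        ∑bound≤ i = begin
          ∑ (𝒢 k) (bound i)
            ≡⟨ ∑-swap (𝒢 k) Ss (λ φ S → ½ ^ e ℚ.* mass (scheme i) S φ) ⟩
          ∑ Ss (λ S → ∑ (𝒢 k) (λ φ → ½ ^ e ℚ.* mass (scheme i) S φ))
            ≡⟨ ∑-cong Ss (λ S → ∑-*ˡ (½ ^ e) (𝒢 k) (mass (scheme i) S)) ⟩
          ∑ Ss (λ S → ½ ^ e ℚ.* ∑ (𝒢 k) (mass (scheme i) S))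
            ≤⟨ ∑-mono-≤ Ss (λ {S} _ → ℚ.*-monoˡ-≤-nonNeg (½ ^ e) {{ℚ.nonNegative (0≤^ e 0≤½)}} (∑mass≤ i S)) ⟩
          ∑ Ss (λ S → ½ ^ e ℚ.* z)
            ≡⟨ ∑-cong Ss (λ _ → trans (cong (ℚ._* z) ½^e≡)
                 (solve 5 (λ a b c w z → ((a :* (b :* c)) :* w) :* z := ((a :* b) :* (z :* c)) :* w) refl
                   (½ ^ η) (½ ^ m′) (½ ^ (2 ℕ.* m′)) (½ ^ (K ℕ.* s′)) z)) ⟩
          ∑ Ss (λ S → ((½ ^ η ℚ.* ½ ^ m′) ℚ.* (z ℚ.* ½ ^ (2 ℕ.* m′))) ℚ.* ½ ^ (K ℕ.* s′))
            ≡⟨ ∑-*ˡ ((½ ^ η ℚ.* ½ ^ m′) ℚ.* (z ℚ.* ½ ^ (2 ℕ.* m′))) Ss (const (½ ^ (K ℕ.* s′))) ⟩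
          ((½ ^ η ℚ.* ½ ^ m′) ℚ.* (z ℚ.* ½ ^ (2 ℕ.* m′))) ℚ.* ∑ Ss (const (½ ^ (K ℕ.* s′)))
            ≤⟨ *-mono-≤ (0≤∑ Ss (λ _ → 0≤^ (K ℕ.* s′) 0≤½)) 0≤ηm*1
                 (ℚ.*-monoˡ-≤-nonNeg (½ ^ η ℚ.* ½ ^ m′) {{ℚ.nonNegative 0≤ηm}} z≤)
                 (∑-½^≤1 Ss {K ℕ.* s′} lengthSs) ⟩
          ((½ ^ η ℚ.* ½ ^ m′) ℚ.* 1ℚ) ℚ.* 1ℚ
            ≡⟨ trans (ℚ.*-identityʳ _) (ℚ.*-identityʳ _) ⟩
          ½ ^ η ℚ.* ½ ^ m′ ∎
          where
          open ℚ.≤-Reasoning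
          open +-*-Solver
          m′ = suc i
          s′ = s (scheme i)
          Ss = listsUpTo A s′
          e = scale (scheme i)
          z = (1ℚ ℚ.+ ½ ^ suc (ξ (scheme i))) ^ length A
          ½^e≡ : ½ ^ e ≡ (½ ^ η ℚ.* (½ ^ m′ ℚ.* ½ ^ (2 ℕ.* m′))) ℚ.* ½ ^ (K ℕ.* s′)
          ½^e≡ = trans (^-homo-* ½ (η ℕ.+ 3 ℕ.* m′) (K ℕ.* s′)) (cong (ℚ._* ½ ^ (K ℕ.* s′))
            (trans (^-homo-* ½ η (3 ℕ.* m′)) (cong (½ ^ η ℚ.*_) (^-homo-* ½ m′ (2 ℕ.* m′)))))
          0≤ηm = 0≤* (0≤^ η 0≤½) (0≤^ m′ 0≤½)
          0≤ηm*1 = 0≤* 0≤ηm 0≤1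
          z≤ : z ℚ.* ½ ^ (2 ℕ.* m′) ℚ.≤ 1ℚ
          z≤ = 1+½^-power-bound (ξ (scheme i)) {μ (scheme i)} {m′}
            (ℕ.≤-trans (ℕ.n≤1+n (length A)) (ℕ.≤-trans A<2^K (ℕ.≤-reflexive (cong (2 ℕ.^_) (sym (ξ+μ≡K (scheme i)))))))
            (2^μ≤m (scheme i))
          lengthSs : length Ss ℕ.≤ 2 ℕ.^ (K ℕ.* s′)
          lengthSs = ℕ.≤-trans (length-listsUpTo A s′)
            (ℕ.≤-trans (ℕ.^-monoˡ-≤ s′ A<2^K) (ℕ.≤-reflexive (ℕ.^-*-assoc 2 K s′)))

      ∑𝒢≤ : ∑ (𝒢 k) (λ φ → Q ^ b φ) ℚ.≤ ½ ^ η
      ∑𝒢≤ = begin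
        ∑ (𝒢 k) (λ φ → Q ^ b φ)                ≤⟨ ∑-mono-≤ (𝒢 k) term≤bounds ⟩
        ∑ (𝒢 k) (λ φ → ∑ ms (λ i → bound i φ))  ≡⟨ ∑-swap (𝒢 k) ms (flip bound) ⟩
        ∑ ms (λ i → ∑ (𝒢 k) (bound i))          ≤⟨ ∑-mono-≤ ms (λ {i} _ → ∑bound≤ i) ⟩
        ∑ ms (λ i → ½ ^ η ℚ.* ½ ^ suc i)        ≡⟨ ∑-*ˡ (½ ^ η) ms (λ i → ½ ^ suc i) ⟩
        ½ ^ η ℚ.* ∑ ms (λ i → ½ ^ suc i)        ≤⟨ ℚ.*-monoˡ-≤-nonNeg (½ ^ η) {{ℚ.nonNegative (0≤^ η 0≤½)}}
                                                   (∑-downFrom-½^ (length A)) ⟩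
        ½ ^ η ℚ.* 1ℚ                            ≡⟨ ℚ.*-identityʳ (½ ^ η) ⟩
        ½ ^ η                                   ∎
        where open ℚ.≤-Reasoning

-- Schemes for small and for large supports

module _ {c ℓ} (R : FiniteAbelianGroup c ℓ) (k′ η n l κ : ℕ) .{{_ : NonZero n}} (Q : ℚ)
         (0≤Q : 0ℚ ℚ.≤ Q) (Qⁿ≤ : Q ^ n ℚ.≤ ½ ^ (suc k′ ℕ.* l ℕ.+ κ)) where

  open FiniteAbelianGroup R hiding (refl)
  private module R = FiniteAbelianGroup R
  open Inverse enumeration using (from; from-cong)
  open Cochains R n
  open CochainBounds R n

  private
    k = suc k′
    K = k ℕ.* suc l
    A = increasingVectors n k

  Charged : (ξ s m : ℕ) → Function k → Set
  Charged ξ s m φ = ∃[ S ] S ∈ listsUpTo A s × Q ^ b φ ℚ.≤ ½ ^ (η ℕ.+ 3 ℕ.* m ℕ.+ K ℕ.* s) ℚ.* ∏ A (λ σ →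
    Weights.factor {ρ = order} (ℕ.<⇒≤ (n<2^n order)) (from ε) (Γ S) (suc ξ) σ (from (extend R n φ σ)))

  -- Reduces a scheme to an inequality between natural numbers. The summand multiplied by `order`
  -- and the one multiplied by `suc ξ + order` bound the binary digits lost in the mass of `φ`: at
  -- most s n (k + 1) faces are covered, and any other face with a nonzero value lies in the
  -- uncovered list.
  charge-by-cover : ∀ {ξ s m} {φ : Function k} → SkewSymmetric φ → ∀ S →
    LAll.All (_∈ support φ) S → length S ℕ.≤ s →
    n ℕ.* (η ℕ.+ 3 ℕ.* m ℕ.+ K ℕ.* s ℕ.+ (order ℕ.* (s ℕ.* (n ℕ.* suc k))
      ℕ.+ (suc ξ ℕ.+ order) ℕ.* length (uncovered (support φ) S))) ℕ.≤ b φ ℕ.* (k ℕ.* l ℕ.+ κ) →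
    Charged ξ s m φ
  charge-by-cover {ξ} {s} {m} {φ} sφ S S⊆F S≤s exponents = S ,
    ∈-listsUpTo (LAll.map (∈-increasingVectors⁺ n k ∘ proj₁ ∘ ∈-supp⁻ R n {φ = φ}) S⊆F) S≤s , (begin
      Q ^ b φ
        ≤⟨ power-bound {n} {e₁ ℕ.+ e₂} {b φ} {k ℕ.* l ℕ.+ κ} 0≤Q Qⁿ≤ exponents ⟩
      ½ ^ (e₁ ℕ.+ e₂)
        ≡⟨ ^-homo-* ½ e₁ e₂ ⟩
      ½ ^ e₁ ℚ.* ½ ^ e₂
        ≤⟨ ℚ.*-monoˡ-≤-nonNeg (½ ^ e₁) {{ℚ.nonNegative (0≤^ e₁ 0≤½)}} (ℚ.≤-trans
             (^-anti-≤ 0≤½ ½≤1 (ℕ.+-mono-≤ (ℕ.*-monoʳ-≤ order covered≤) (ℕ.*-monoʳ-≤ (suc ξ ℕ.+ order) uncovered≤)))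
             (∏-factor≥ (from ∘ extend R n φ) W A cover)) ⟩
      ½ ^ e₁ ℚ.* ∏ A (λ σ → factor σ (from (extend R n φ σ))) ∎)
    where
    open ℚ.≤-Reasoning
    open Weights {ρ = order} (ℕ.<⇒≤ (n<2^n order)) (from ε) (Γ S) (suc ξ)
    F = support φ
    W = uncovered F S
    e₁ = η ℕ.+ 3 ℕ.* m ℕ.+ K ℕ.* s
    e₂ = order ℕ.* (s ℕ.* (n ℕ.* suc k)) ℕ.+ (suc ξ ℕ.+ order) ℕ.* length W
    A-unique = increasingVectors-unique n k
    filter≤ : ∀ ys → length (filter (_∈? ys) A) ℕ.≤ length ys
    filter≤ ys = unique-⊆⇒length≤ (LUnique.filter⁺ (_∈? ys) A-unique) (λ x∈ → proj₂ (∈.∈-filter⁻ (_∈? ys) {xs = A} x∈))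
    covered≤ : length (filter (_∈? Γ S) A) ℕ.≤ s ℕ.* (n ℕ.* suc k)
    covered≤ = ℕ.≤-trans (filter≤ (Γ S)) (ℕ.≤-trans (ℕ.≤-reflexive (length-Γ S)) (ℕ.*-monoˡ-≤ (n ℕ.* suc k) S≤s))
    uncovered≤ : length (filter (_∈? W) A) ℕ.≤ length W
    uncovered≤ = filter≤ W
    cover : ∀ {σ} → σ ∈ A → σ ∈ Γ S ⊎ σ ∈ W ⊎ from (extend R n φ σ) ≡ from ε
    cover {σ} σ∈A with extend R n φ σ ≟ ε
    ... | yes ≈ε = inj₂ (inj₂ (from-cong ≈ε))
    ... | no  ≉ε with uncovered-or-Γ F S (∈-support φ (∈-increasingVectors⁻ n k σ∈A) ≉ε)
    ...   | inj₁ σ∈W = inj₂ (inj₁ σ∈W)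
    ...   | inj₂ σ∈Γ = inj₁ σ∈Γ

  module _ (v m : ℕ) .{{_ : NonZero m}} where

    smallScheme : κ ≡ η ℕ.+ 4 ℕ.+ k ℕ.+ order → suc k ℕ.* (k ℕ.* l ℕ.+ κ) ℕ.≤ 2 ℕ.^ v → m ℕ.* 2 ℕ.^ v ℕ.≤ n →
      Scheme R k′ η K n m Q
    smallScheme refl h₁ h₂ = record
      -- Every support face is uncovered and pays the full price: this `ξ` makes `suc ξ` equal to
      -- `K`. Sparseness with parameter `m` is automatic, since a part of the support has at most
      -- `m` members.
      { s = 0 ; μ = 0 ; ξ = l ℕ.+ k′ ℕ.* suc l
      ; ξ+μ≡K = ℕ.+-identityʳ K
      ; 2^μ≤m = ℕ.>-nonZero⁻¹ m
      ; charge = λ {φ} sφ _ size≡m → charge-by-cover {l ℕ.+ k′ ℕ.* suc l} {0} {m} {φ} sφ [] [] ℕ.z≤n (begin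
          n ℕ.* (η ℕ.+ 3 ℕ.* m ℕ.+ K ℕ.* 0 ℕ.+ (order ℕ.* 0 ℕ.+ (K ℕ.+ order) ℕ.* length (support φ)))
            ≡⟨ cong (λ x → n ℕ.* (η ℕ.+ 3 ℕ.* m ℕ.+ K ℕ.* 0 ℕ.+ (order ℕ.* 0 ℕ.+ (K ℕ.+ order) ℕ.* x)))
                 (trans (length-support φ) size≡m) ⟩
          n ℕ.* (η ℕ.+ 3 ℕ.* m ℕ.+ K ℕ.* 0 ℕ.+ (order ℕ.* 0 ℕ.+ (K ℕ.+ order) ℕ.* m))
            ≡⟨ solve 5 (λ n η m K ρ → n :* (η :+ con 3 :* m :+ K :* con 0 :+ (ρ :* con 0 :+ (K :+ ρ) :* m))
                 := n :* (η :+ con 3 :* m :+ (K :+ ρ) :* m)) refl n η m K order ⟩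
          n ℕ.* (η ℕ.+ 3 ℕ.* m ℕ.+ (K ℕ.+ order) ℕ.* m)
            ≤⟨ small-support-exponent {k′} {n} {l} {η} {order} {v} {m} {b φ} h₁ h₂ (b≥ sφ size≡m) ⟩
          b φ ℕ.* (k ℕ.* l ℕ.+ κ) ∎)
      }
      where
      open ℕ.≤-Reasoning
      open ℕSolver
      b≥ : ∀ {φ : Function k} → SkewSymmetric φ → size φ ≡ m → m ℕ.* n ℕ.≤ m ℕ.* k ℕ.+ (b φ ℕ.+ m ℕ.* m)
      b≥ {φ} sφ refl = subst (λ x → x ℕ.* n ℕ.≤ x ℕ.* k ℕ.+ (b φ ℕ.+ size φ ℕ.* size φ)) (length-support φ)
        (sparse⇒b≥ sφ (support φ) (supp-unique R n φ) id
          (λ _ → ℕ.≤-trans (List.length-filter _ (support φ)) (ℕ.≤-reflexive (length-support φ))))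

    largeScheme : ∀ γ → 2 ℕ.^ l ℕ.≤ n → n ℕ.≤ 2 ℕ.* 2 ℕ.^ l → 2 ℕ.^ l ℕ.≤ m ℕ.* 2 ℕ.^ v →
      γ ℕ.≤ l → 2 ℕ.* suc k ℕ.* (largeConstant k′ η order γ ℕ.+ v) ℕ.≤ l → 2 ℕ.* suc k ℕ.* k′ ℕ.≤ 2 ℕ.^ γ →
      Scheme R k′ η K n m Q
    largeScheme γ 2ˡ≤n n≤ ≤m2ᵛ γ≤l hC hγ = record
      { s = s′ ; μ = l ℕ.∸ v ; ξ = ξ′ ; ξ+μ≡K = ξ′+μ≡K ; 2^μ≤m = 2^≤m ; charge = charged }
      where
      -- Up to a factor of two this is n / 2^γ: small enough for the error m t, yet large enough
      -- that `s′` is at most a constant times m / n.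
      t = 2 ℕ.^ (l ℕ.∸ γ)
      t≢0 : NonZero t
      t≢0 = ℕ.m^n≢0 2 (l ℕ.∸ γ)
      s′ = (m ℕ./ t) {{t≢0}}
      v≤l : v ℕ.≤ l
      v≤l = begin
        v                                                      ≤⟨ ℕ.m≤n+m v (largeConstant k′ η order γ) ⟩
        largeConstant k′ η order γ ℕ.+ v                       ≤⟨ ℕ.m≤n*m _ (2 ℕ.* suc k) ⟩
        2 ℕ.* suc k ℕ.* (largeConstant k′ η order γ ℕ.+ v)     ≤⟨ hC ⟩
        l                                                      ∎
        where open ℕ.≤-Reasoning
      -- As `m` is at least 2^(l - v), μ may be `l - v`. An uncovered nonzero face then costs about
      -- k′ l + v instead of k l, which leaves one share b l of the budget free.
      ξ′ = k′ ℕ.* suc l ℕ.+ v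
      ξ′+μ≡K : suc ξ′ ℕ.+ (l ℕ.∸ v) ≡ K
      ξ′+μ≡K = cong suc (trans (ℕ.+-assoc (k′ ℕ.* suc l) v (l ℕ.∸ v))
        (trans (cong (k′ ℕ.* suc l ℕ.+_) (ℕ.m+[n∸m]≡n v≤l)) (ℕ.+-comm (k′ ℕ.* suc l) l)))
      2^≤m : 2 ℕ.^ (l ℕ.∸ v) ℕ.≤ m
      2^≤m = ℕ.*-cancelʳ-≤ (2 ℕ.^ (l ℕ.∸ v)) m (2 ℕ.^ v) {{ℕ.m^n≢0 2 v}}
        (ℕ.≤-trans (ℕ.≤-reflexive (trans (sym (ℕ.^-distribˡ-+-* 2 (l ℕ.∸ v) v)) (cong (2 ℕ.^_) (ℕ.m∸n+n≡m v≤l)))) ≤m2ᵛ)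
      charged : ∀ {φ : Function k} → SkewSymmetric φ → In𝒢 φ → size φ ≡ m → Charged ξ′ s′ m φ
      charged {φ} sφ (_ , _ , w≡size) size≡m = from-cover (greedy F t {{t≢0}})
        where
        F = support φ
        length-F : length F ≡ m
        length-F = trans (length-support φ) size≡m
        from-cover : (∃[ S ] LAll.All (_∈ F) S × length S ℕ.* t ℕ.≤ length F × Sparse F t (uncovered F S)) →
          Charged ξ′ s′ m φ
        from-cover (S , S⊆F , St≤ , sparse) = charge-by-cover {ξ′} {s′} {m} {φ} sφ S S⊆F
          (ℕ.≤-trans (ℕ.≤-reflexive (sym (ℕ.m*n/n≡m (length S) t {{t≢0}})))
            (ℕ./-monoˡ-≤ t {{t≢0}} (ℕ.≤-trans St≤ (ℕ.≤-reflexive length-F))))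
          (large-support-exponent {k′} {n} {l} {η} {order} {v} {m} {b φ} {κ} {γ} {s′} {t} {length W}
            (subst (λ x → n ℕ.* x ℕ.≤ b φ ℕ.* suc k) size≡m (minimal⇒b≥ sφ w≡size))
            (subst (λ x → length W ℕ.* n ℕ.≤ length W ℕ.* k ℕ.+ (b φ ℕ.+ x ℕ.* t)) size≡m
              (sparse⇒b≥ sφ W W-unique W⊆F sparse))
            (ℕ.≤-trans (unique-⊆⇒length≤ W-unique W⊆F) (ℕ.≤-reflexive length-F))
            (trans (sym (ℕ.^-distribˡ-+-* 2 (l ℕ.∸ γ) γ)) (cong (2 ℕ.^_) (ℕ.m∸n+n≡m γ≤l)))
            2ˡ≤n n≤ (ℕ.m/n*n≤m m t {{t≢0}}) hC hγ)
          where
          W = uncovered F S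
          W⊆F = uncovered⊆ F S
          W-unique = uncovered-unique F (supp-unique R n φ) S

-- The bound for rational powers, uniformly in the base

binaryOrder : ∀ n .{{_ : NonZero n}} → ∃[ l ] 2 ℕ.^ l ℕ.≤ n × n ℕ.< 2 ℕ.^ suc l
binaryOrder (suc zero) = 0 , ℕ.≤-refl , ℕ.≤-refl
binaryOrder (suc n@(suc _)) with binaryOrder n
... | l , ≤n , n< with suc n ℕ.<? 2 ℕ.^ suc l
...   | yes sn< = l , ℕ.m≤n⇒m≤1+n ≤n , sn<
...   | no  sn≮ = suc l , ℕ.≮⇒≥ sn≮ , ℕ.<-≤-trans (ℕ.s≤s n<)
        (ℕ.≤-trans (ℕ.+-monoˡ-≤ _ (ℕ.m^n>0 2 (suc l)))
          (ℕ.≤-reflexive (cong (2 ℕ.^ suc l ℕ.+_) (sym (ℕ.+-identityʳ _)))))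

∑𝒢-power-bound : ∀ {c ℓ} (R : FiniteAbelianGroup c ℓ) k′ η → ∃₂ λ κ n₀ → ∀ n l .{{_ : NonZero n}} →
  n₀ ℕ.≤ n → 2 ℕ.^ l ℕ.≤ n → n ℕ.< 2 ℕ.^ suc l → ∀ Q → 0ℚ ℚ.≤ Q → Q ^ n ℚ.≤ ½ ^ (suc k′ ℕ.* l ℕ.+ κ) →
  ∑ (Cochains.𝒢 R n (suc k′)) (λ φ → Q ^ Cochains.b R n φ) ℚ.≤ ½ ^ η
∑𝒢-power-bound R k′ η =
  -- The first two arguments spell out (k + 1)(k l + κ), needed for small supports; the other two
  -- encode the condition on `C + v` for large ones. The choice of `n₀` forces `l` above both `l₁`
  -- and `γ`.
  let l₁ , thr = threshold (suc k ℕ.* k) (suc k ℕ.* κ) (2 ℕ.* suc k) (largeConstant k′ η order γ)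
  in κ , 2 ℕ.^ suc (l₁ ℕ.⊔ γ) , λ n l n₀≤n 2ˡ≤n n<2ˡ Q 0≤Q Qⁿ≤ →
    let l₁⊔γ≤l = exponent-≤ (ℕ.≤-<-trans n₀≤n n<2ˡ)
        v , hv , hC = thr l (ℕ.≤-trans (ℕ.m≤m⊔n l₁ γ) l₁⊔γ≤l)
    in ∑𝒢≤ R k′ n η (k ℕ.* suc l) (size-bound n l n<2ˡ) Q
      (λ i → scheme n l Q 0≤Q Qⁿ≤ 2ˡ≤n n<2ˡ (ℕ.≤-trans (ℕ.m≤n⊔m l₁ γ) l₁⊔γ≤l) v hv hC (suc i))
  where
  open FiniteAbelianGroup R using (order)
  k = suc k′
  κ = η ℕ.+ 4 ℕ.+ k ℕ.+ order
  γ = 2 ℕ.* suc k ℕ.* k′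
  exponent-≤ : ∀ {x y} → 2 ℕ.^ suc x ℕ.< 2 ℕ.^ suc y → x ℕ.≤ y
  exponent-≤ {x} {y} h = ℕ.≮⇒≥ (λ y<x → ℕ.<⇒≱ h (ℕ.^-monoʳ-≤ 2 (ℕ.s≤s (ℕ.<⇒≤ y<x))))
  size-bound : ∀ n l → n ℕ.< 2 ℕ.^ suc l → length (increasingVectors n k) ℕ.< 2 ℕ.^ (k ℕ.* suc l)
  size-bound n l n< = ℕ.≤-<-trans (length-increasingVectors n k) (ℕ.<-≤-trans (ℕ.^-monoˡ-< k n<)
    (ℕ.≤-reflexive (trans (ℕ.^-*-assoc 2 (suc l) k) (cong (2 ℕ.^_) (ℕ.*-comm (suc l) k)))))
  scheme : ∀ n l .{{_ : NonZero n}} Q → 0ℚ ℚ.≤ Q → Q ^ n ℚ.≤ ½ ^ (k ℕ.* l ℕ.+ κ) → 2 ℕ.^ l ℕ.≤ n → n ℕ.< 2 ℕ.^ suc l →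
    γ ℕ.≤ l → ∀ v → suc k ℕ.* k ℕ.* l ℕ.+ suc k ℕ.* κ ℕ.≤ 2 ℕ.^ v →
    2 ℕ.* suc k ℕ.* (largeConstant k′ η order γ ℕ.+ v) ℕ.≤ l →
    ∀ m .{{_ : NonZero m}} → Scheme R k′ η (k ℕ.* suc l) n m Q
  scheme n l Q 0≤Q Qⁿ≤ 2ˡ≤n n< γ≤l v hv hC m with m ℕ.* 2 ℕ.^ v ℕ.≤? 2 ℕ.^ l
  ... | yes small = smallScheme R k′ η n l κ Q 0≤Q Qⁿ≤ v m refl
    (ℕ.≤-trans (ℕ.≤-reflexive (trans (ℕ.*-distribˡ-+ (suc k) (k ℕ.* l) κ)
      (cong (ℕ._+ suc k ℕ.* κ) (sym (ℕ.*-assoc (suc k) k l))))) hv)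
    (ℕ.≤-trans small 2ˡ≤n)
  ... | no ¬small = largeScheme R k′ η n l κ Q 0≤Q Qⁿ≤ v m γ 2ˡ≤n (ℕ.<⇒≤ n<) (ℕ.<⇒≤ (ℕ.≰⇒> ¬small))
    γ≤l hC (ℕ.<⇒≤ (n<2^n γ))

-- Estimates for the logarithm

∑ℚ-const : ∀ n x → ∑ℚ n (const x) ≡ n ×ℚ x
∑ℚ-const zero    x = refl
∑ℚ-const (suc n) x = trans (cong (ℚ._+ x) (∑ℚ-const n x)) (ℚ.+-comm (n ×ℚ x) x)

×ℚ-recip : ∀ n → suc n ×ℚ recip (suc n) ≡ 1ℚ
×ℚ-recip n = trans (sym (∑ℚ-const (suc n) (recip (suc n))))
  (trans (LogLemmas.∑-const (suc n) (suc n)) (ℚ.≤-antisym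
    (/-mono (suc n) (suc n) 1 1 (ℕ.≤-reflexive (ℕ.*-comm (suc n) 1)))
    (/-mono 1 1 (suc n) (suc n) (ℕ.≤-reflexive (ℕ.*-comm 1 (suc n))))))

fromℕ-×ℚ : ∀ n → + n ℚ./ 1 ≡ n ×ℚ 1ℚ
fromℕ-×ℚ n = trans (sym (LogLemmas.∑-const n 1)) (∑ℚ-const n 1ℚ)

recip-step : ∀ x → (1ℚ ℚ.+ recip (suc x)) ℚ.* recip (suc (suc x)) ≡ recip (suc x)
recip-step x = begin
  (1ℚ ℚ.+ r) ℚ.* r′               ≡⟨ cong (λ y → (y ℚ.+ r) ℚ.* r′) (×ℚ-recip x) ⟨
  (suc x ×ℚ r ℚ.+ r) ℚ.* r′       ≡⟨ cong (ℚ._* r′) (ℚ.+-comm _ r) ⟩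
  (suc (suc x) ×ℚ r) ℚ.* r′       ≡⟨ ×ℚ-assoc-* (suc (suc x)) r r′ ⟩
  suc (suc x) ×ℚ (r ℚ.* r′)       ≡⟨ ×ℚ-comm-* (suc (suc x)) r r′ ⟨
  r ℚ.* (suc (suc x) ×ℚ r′)       ≡⟨ cong (r ℚ.*_) (×ℚ-recip (suc x)) ⟩
  r ℚ.* 1ℚ                        ≡⟨ ℚ.*-identityʳ r ⟩
  r                               ∎
  where
  open ≡-Reasoning
  r = recip (suc x)
  r′ = recip (suc (suc x))

-- Riemann terms with left endpoints, whereas `logSum` uses right endpoints. With these the product
-- of the factors 1 + y telescopes to the argument of the logarithm exactly, whatever the mesh.
upperTerms : ℕ → ℕ → List ℚ
upperTerms x c = List.applyDownFrom (λ i → recip (suc (x ℕ.+ i))) c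

0≤upperTerms : ∀ x c {y} → y ∈ upperTerms x c → 0ℚ ℚ.≤ y
0≤upperTerms x c y∈ with ∈.∈-applyDownFrom⁻ (λ i → recip (suc (x ℕ.+ i))) y∈
... | i , _ , refl = recip≥0 (suc (x ℕ.+ i))

∏-upperTerms : ∀ x c → recip (suc (x ℕ.+ c)) ℚ.* ∏ (upperTerms x c) (1ℚ ℚ.+_) ≡ recip (suc x)
∏-upperTerms x zero    rewrite ℕ.+-identityʳ x = ℚ.*-identityʳ _
∏-upperTerms x (suc c) rewrite ℕ.+-suc x c = begin
  r′ ℚ.* ((1ℚ ℚ.+ r) ℚ.* q)   ≡⟨ ℚ.*-assoc r′ _ q ⟨
  (r′ ℚ.* (1ℚ ℚ.+ r)) ℚ.* q   ≡⟨ cong (ℚ._* q) (trans (ℚ.*-comm r′ _) (recip-step (x ℕ.+ c))) ⟩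
  r ℚ.* q                     ≡⟨ ∏-upperTerms x c ⟩
  recip (suc x)               ∎
  where
  open ≡-Reasoning
  r = recip (suc (x ℕ.+ c))
  r′ = recip (suc (suc (x ℕ.+ c)))
  q = ∏ (upperTerms x c) (1ℚ ℚ.+_)

∏-upperTerms-log : ∀ n M → ∏ (upperTerms M (n ℕ.* suc M)) (1ℚ ℚ.+_) ≡ suc n ×ℚ 1ℚ
∏-upperTerms-log n M = begin
  q                                          ≡⟨ ℚ.*-identityˡ q ⟨
  1ℚ ℚ.* q                                   ≡⟨ cong (ℚ._* q) (×ℚ-recip (M ℕ.+ n ℕ.* suc M)) ⟨
  ((suc n ℕ.* suc M) ×ℚ r) ℚ.* q             ≡⟨ ×ℚ-assoc-* (suc n ℕ.* suc M) r q ⟩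
  (suc n ℕ.* suc M) ×ℚ (r ℚ.* q)             ≡⟨ cong ((suc n ℕ.* suc M) ×ℚ_) (∏-upperTerms M (n ℕ.* suc M)) ⟩
  (suc n ℕ.* suc M) ×ℚ recip (suc M)         ≡⟨ ×ℚ-assocˡ (recip (suc M)) (suc n) (suc M) ⟨
  suc n ×ℚ (suc M ×ℚ recip (suc M))          ≡⟨ cong (suc n ×ℚ_) (×ℚ-recip M) ⟩
  suc n ×ℚ 1ℚ                                ∎
  where
  open ≡-Reasoning
  r = recip (suc (M ℕ.+ n ℕ.* suc M))
  q = ∏ (upperTerms M (n ℕ.* suc M)) (1ℚ ℚ.+_)

∑-upperTerms : ∀ x c → ∑ (upperTerms x c) id ℚ.≤ 1ℚ ℚ.+ ∑ℚ c (λ i → recip (suc (suc x ℕ.+ i)))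
∑-upperTerms x c = ℚ.≤-trans (x≤x+y (recip≥0 (suc (x ℕ.+ c)))) (ℚ.≤-trans (ℚ.≤-reflexive (telescope c))
  (ℚ.+-monoˡ-≤ _ (inv-anti {1} {suc x} (ℕ.s≤s ℕ.z≤n))))
  where
  open ≡-Reasoning
  open +-*-Solver
  telescope : ∀ c → ∑ (upperTerms x c) id ℚ.+ recip (suc (x ℕ.+ c)) ≡
    recip (suc x) ℚ.+ ∑ℚ c (λ i → recip (suc (suc x ℕ.+ i)))
  telescope zero    rewrite ℕ.+-identityʳ x = ℚ.+-comm 0ℚ (recip (suc x))
  telescope (suc c) rewrite ℕ.+-suc x c = begin
    (r ℚ.+ s) ℚ.+ r′                ≡⟨ cong (ℚ._+ r′) (ℚ.+-comm r s) ⟩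
    (s ℚ.+ r) ℚ.+ r′                ≡⟨ cong (ℚ._+ r′) (telescope c) ⟩
    (recip (suc x) ℚ.+ u) ℚ.+ r′    ≡⟨ ℚ.+-assoc (recip (suc x)) u r′ ⟩
    recip (suc x) ℚ.+ (u ℚ.+ r′)    ∎
    where
    r = recip (suc (x ℕ.+ c))
    r′ = recip (suc (suc (x ℕ.+ c)))
    s = ∑ (upperTerms x c) id
    u = ∑ℚ c (λ i → recip (suc (suc x ℕ.+ i)))

bernoulli : ∀ n {y} → 0ℚ ℚ.≤ y → 1ℚ ℚ.+ n ×ℚ y ℚ.≤ (1ℚ ℚ.+ y) ^ n
bernoulli zero    0≤y = ℚ.≤-reflexive (ℚ.+-identityʳ 1ℚ)
bernoulli (suc n) {y} 0≤y = begin
  1ℚ ℚ.+ (y ℚ.+ ny)                     ≤⟨ x≤x+y (0≤* 0≤y (×ℚ-mono-≤ {0} {n} 0≤y ℕ.z≤n)) ⟩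
  (1ℚ ℚ.+ (y ℚ.+ ny)) ℚ.+ y ℚ.* ny      ≡⟨ solve 2 (λ y z → (con 1ℚ :+ (y :+ z)) :+ y :* z
    := (con 1ℚ :+ y) :* (con 1ℚ :+ z)) refl y ny ⟩
  (1ℚ ℚ.+ y) ℚ.* (1ℚ ℚ.+ ny)            ≤⟨ ℚ.*-monoˡ-≤-nonNeg (1ℚ ℚ.+ y)
    {{ℚ.nonNegative (ℚ.≤-trans 0≤1 (x≤x+y 0≤y))}} (bernoulli n 0≤y) ⟩
  (1ℚ ℚ.+ y) ℚ.* (1ℚ ℚ.+ y) ^ n         ∎
  where
  open ℚ.≤-Reasoning
  open +-*-Solver
  ny = n ×ℚ y

∏-mono-≤ : ∀ {a} {A : Set a} (xs : List A) {f g : A → ℚ} → (∀ {x} → x ∈ xs → 0ℚ ℚ.≤ f x × f x ℚ.≤ g x) →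
  0ℚ ℚ.≤ ∏ xs f × ∏ xs f ℚ.≤ ∏ xs g
∏-mono-≤ []       h = 0≤1 , ℚ.≤-refl
∏-mono-≤ (x ∷ xs) h =
  let 0≤f , f≤g = h (here refl)
      0≤∏f , ∏f≤∏g = ∏-mono-≤ xs (h ∘ there)
  in 0≤* 0≤f 0≤∏f , *-mono-≤ 0≤∏f (ℚ.≤-trans 0≤f f≤g) f≤g ∏f≤∏g

∏-^ : ∀ {a} {A : Set a} (xs : List A) (f : A → ℚ) n → ∏ xs (λ x → f x ^ n) ≡ ∏ xs f ^ n
∏-^ []       f n = sym (1^n≡1 n)
∏-^ (x ∷ xs) f n = trans (cong (f x ^ n ℚ.*_) (∏-^ xs f n)) (sym (^-distrib-* (f x) (∏ xs f) n))

∏-map : ∀ {a b} {A : Set a} {B : Set b} (xs : List A) (h : A → B) (f : B → ℚ) → ∏ (List.map h xs) f ≡ ∏ xs (f ∘ h)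
∏-map []       h f = refl
∏-map (x ∷ xs) h f = cong (f (h x) ℚ.*_) (∏-map xs h f)

∏-++ : ∀ {a} {A : Set a} (xs ys : List A) (f : A → ℚ) → ∏ (xs ++ ys) f ≡ ∏ xs f ℚ.* ∏ ys f
∏-++ []       ys f = sym (ℚ.*-identityˡ _)
∏-++ (x ∷ xs) ys f = trans (cong (f x ℚ.*_) (∏-++ xs ys f)) (sym (ℚ.*-assoc (f x) _ _))

-- (1 - x/n)^n ≤ ∏ 1/(1 + y) for x = ∑ y: split x/n into the parts y/n.
1-/n^n*∏≤1 : ∀ n (ys : List ℚ) → (∀ {y} → y ∈ ys → 0ℚ ℚ.≤ y) → ∀ {q} → 0ℚ ℚ.≤ q →
  q ℚ.≤ 1ℚ ℚ.- ∑ ys id ℚ.* recip (suc n) → q ^ suc n ℚ.* ∏ ys (1ℚ ℚ.+_) ℚ.≤ 1ℚ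
1-/n^n*∏≤1 n ys 0≤ys {q} 0≤q q≤ = begin
  q ^ suc n ℚ.* ∏ ys (1ℚ ℚ.+_)
    ≤⟨ ℚ.*-monoˡ-≤-nonNeg (q ^ suc n) {{ℚ.nonNegative (0≤^ (suc n) 0≤q)}}
         (proj₂ (∏-mono-≤ ys (λ y∈ → ℚ.≤-trans 0≤1 (x≤x+y (0≤ys y∈)) , 1+y≤ (0≤ys y∈)))) ⟩
  q ^ suc n ℚ.* ∏ ys (λ y → (1ℚ ℚ.+ y ℚ.* r) ^ suc n)
    ≡⟨ cong (q ^ suc n ℚ.*_) (∏-^ ys (λ y → 1ℚ ℚ.+ y ℚ.* r) (suc n)) ⟩
  q ^ suc n ℚ.* ∏ ys (λ y → 1ℚ ℚ.+ y ℚ.* r) ^ suc n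
    ≡⟨ ^-distrib-* q (∏ ys (λ y → 1ℚ ℚ.+ y ℚ.* r)) (suc n) ⟨
  (q ℚ.* ∏ ys (λ y → 1ℚ ℚ.+ y ℚ.* r)) ^ suc n
    ≤⟨ ^≤1 (suc n) (0≤* 0≤q 0≤P) qP≤1 ⟩
  1ℚ ∎
  where
  open ℚ.≤-Reasoning
  r = recip (suc n)
  0≤yr : ∀ {y} → 0ℚ ℚ.≤ y → 0ℚ ℚ.≤ y ℚ.* r
  0≤yr 0≤y = 0≤* 0≤y (recip≥0 (suc n))
  0≤P : 0ℚ ℚ.≤ ∏ ys (λ y → 1ℚ ℚ.+ y ℚ.* r)
  0≤P = proj₁ (∏-mono-≤ ys (λ y∈ → ℚ.≤-trans 0≤1 (x≤x+y (0≤yr (0≤ys y∈))) , ℚ.≤-refl))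
  1+y≤ : ∀ {y} → 0ℚ ℚ.≤ y → 1ℚ ℚ.+ y ℚ.≤ (1ℚ ℚ.+ y ℚ.* r) ^ suc n
  1+y≤ {y} 0≤y = ℚ.≤-trans (ℚ.≤-reflexive (cong (1ℚ ℚ.+_) (sym (trans (sym (×ℚ-comm-* (suc n) y r))
    (trans (cong (y ℚ.*_) (×ℚ-recip n)) (ℚ.*-identityʳ y)))))) (bernoulli (suc n) (0≤yr 0≤y))
  zs = List.map (ℚ._* r) ys
  0≤zs : ∀ {z} → z ∈ zs → 0ℚ ℚ.≤ z
  0≤zs z∈ with ∈.∈-map⁻ (ℚ._* r) z∈
  ... | _ , y∈ , refl = 0≤yr (0≤ys y∈)
  qP≤1 : q ℚ.* ∏ ys (λ y → 1ℚ ℚ.+ y ℚ.* r) ℚ.≤ 1ℚ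
  qP≤1 = begin
    q ℚ.* ∏ ys (λ y → 1ℚ ℚ.+ y ℚ.* r)
      ≤⟨ ℚ.*-monoʳ-≤-nonNeg _ {{ℚ.nonNegative 0≤P}} q≤ ⟩
    (1ℚ ℚ.- ∑ ys id ℚ.* r) ℚ.* ∏ ys (λ y → 1ℚ ℚ.+ y ℚ.* r)
      ≡⟨ cong₂ (λ s p → (1ℚ ℚ.- s) ℚ.* p) ∑zs (∏-map ys (ℚ._* r) (1ℚ ℚ.+_)) ⟨
    (1ℚ ℚ.- ∑ zs id) ℚ.* ∏ zs (1ℚ ℚ.+_)
      ≤⟨ 1-∑*∏1+≤1 zs 0≤zs ⟩
    1ℚ ∎
    where
    ∑zs : ∑ zs id ≡ ∑ ys id ℚ.* r
    ∑zs = trans (∑-map ys (ℚ._* r) id) (trans (∑-cong ys (λ y → ℚ.*-comm y r)) (trans (∑-*ˡ r ys id) (ℚ.*-comm r _)))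

0≤×ℚ : ∀ n {x} → 0ℚ ℚ.≤ x → 0ℚ ℚ.≤ n ×ℚ x
0≤×ℚ n 0≤x = ×ℚ-mono-≤ {0} {n} 0≤x ℕ.z≤n

×ℚ-mono-arg-≤ : ∀ n {x y} → x ℚ.≤ y → n ×ℚ x ℚ.≤ n ×ℚ y
×ℚ-mono-arg-≤ zero    x≤y = ℚ.≤-refl
×ℚ-mono-arg-≤ (suc n) x≤y = ℚ.+-mono-≤ x≤y (×ℚ-mono-arg-≤ n x≤y)

copies : ℕ → List ℚ → List ℚ
copies zero    ys = []
copies (suc k) ys = ys ++ copies k ys

∑-copies : ∀ k ys → ∑ (copies k ys) id ≡ k ×ℚ ∑ ys id
∑-copies zero    ys = refl
∑-copies (suc k) ys = trans (∑-++ ys (copies k ys) id) (cong (∑ ys id ℚ.+_) (∑-copies k ys))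

∏-copies : ∀ k ys f → ∏ (copies k ys) f ≡ ∏ ys f ^ k
∏-copies zero    ys f = refl
∏-copies (suc k) ys f = trans (∏-++ ys (copies k ys) f) (cong (∏ ys f ℚ.*_) (∏-copies k ys f))

∈-copies⁻ : ∀ k ys {y} → y ∈ copies k ys → y ∈ ys
∈-copies⁻ (suc k) ys y∈ with ∈.∈-++⁻ ys y∈
... | inj₁ i = i
... | inj₂ i = ∈-copies⁻ k ys i

1≤[n×1]^·2^·½^ : ∀ n l k κ → 2 ℕ.^ l ℕ.≤ n →
  1ℚ ℚ.≤ ((n ×ℚ 1ℚ) ^ k ℚ.* (1ℚ ℚ.+ 1ℚ) ^ κ) ℚ.* ½ ^ (k ℕ.* l ℕ.+ κ)
1≤[n×1]^·2^·½^ n l k κ 2ˡ≤n = begin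
  1ℚ
    ≡⟨ trans (cong₂ ℚ._*_ (1^n≡1 k) (1^n≡1 κ)) (ℚ.*-identityˡ 1ℚ) ⟨
  1ℚ ^ k ℚ.* 1ℚ ^ κ
    ≤⟨ ℚ.*-monoʳ-≤-nonNeg (1ℚ ^ κ) {{ℚ.nonNegative (0≤^ κ 0≤1)}} (^-monoˡ-≤ k 0≤1 1≤) ⟩
  ((n ×ℚ 1ℚ) ℚ.* ½ ^ l) ^ k ℚ.* ((1ℚ ℚ.+ 1ℚ) ℚ.* ½) ^ κ
    ≡⟨ cong₂ ℚ._*_ (^-distrib-* (n ×ℚ 1ℚ) (½ ^ l) k) (^-distrib-* (1ℚ ℚ.+ 1ℚ) ½ κ) ⟩
  ((n ×ℚ 1ℚ) ^ k ℚ.* (½ ^ l) ^ k) ℚ.* ((1ℚ ℚ.+ 1ℚ) ^ κ ℚ.* ½ ^ κ)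
    ≡⟨ interchange ((n ×ℚ 1ℚ) ^ k) ((½ ^ l) ^ k) ((1ℚ ℚ.+ 1ℚ) ^ κ) (½ ^ κ) ⟩
  ((n ×ℚ 1ℚ) ^ k ℚ.* (1ℚ ℚ.+ 1ℚ) ^ κ) ℚ.* ((½ ^ l) ^ k ℚ.* ½ ^ κ)
    ≡⟨ cong (((n ×ℚ 1ℚ) ^ k ℚ.* (1ℚ ℚ.+ 1ℚ) ^ κ) ℚ.*_) (trans (^-homo-* ½ (k ℕ.* l) κ)
         (cong (ℚ._* ½ ^ κ) (trans (cong (½ ^_) (ℕ.*-comm k l)) (sym (^-assocʳ ½ l k))))) ⟨
  ((n ×ℚ 1ℚ) ^ k ℚ.* (1ℚ ℚ.+ 1ℚ) ^ κ) ℚ.* ½ ^ (k ℕ.* l ℕ.+ κ) ∎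
  where
  open ℚ.≤-Reasoning
  open import Algebra.Properties.CommutativeSemigroup
    (CommutativeRing.*-commutativeSemigroup ℚ.+-*-commutativeRing) using (interchange)
  1≤ : 1ℚ ℚ.≤ (n ×ℚ 1ℚ) ℚ.* ½ ^ l
  1≤ = begin
    1ℚ                          ≡⟨ 2^n×½^n≡1 l ⟨
    (2 ℕ.^ l) ×ℚ (½ ^ l)        ≤⟨ ×ℚ-mono-≤ (0≤^ l 0≤½) 2ˡ≤n ⟩
    n ×ℚ (½ ^ l)                ≡⟨ cong (n ×ℚ_) (ℚ.*-identityˡ (½ ^ l)) ⟨
    n ×ℚ (1ℚ ℚ.* ½ ^ l)         ≡⟨ ×ℚ-assoc-* n 1ℚ (½ ^ l) ⟨
    (n ×ℚ 1ℚ) ℚ.* ½ ^ l         ∎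

-- k copies of the terms 1/i of an upper Riemann sum of log n, with ∏ (1 + 1/i) = n, and κ ones.
decay : ∀ k κ n l M {q w} → 2 ℕ.^ l ℕ.≤ suc n → 0ℚ ℚ.≤ q → (κ ℕ.+ k) ×ℚ 1ℚ ℚ.≤ w →
  q ≡ 1ℚ ℚ.- ((+ k ℚ./ 1) ℚ.* logSum (suc n) (suc M) ℚ.+ w) ℚ.* (+ 1 ℚ./ suc n) →
  q ^ suc n ℚ.≤ ½ ^ (k ℕ.* l ℕ.+ κ)
decay k κ n l M {q} {w} 2ˡ≤n 0≤q κ+k≤w q≡ = begin
  q ^ suc n
    ≡⟨ ℚ.*-identityʳ _ ⟨
  q ^ suc n ℚ.* 1ℚ
    ≤⟨ ℚ.*-monoˡ-≤-nonNeg (q ^ suc n) {{ℚ.nonNegative (0≤^ (suc n) 0≤q)}} (1≤[n×1]^·2^·½^ (suc n) l k κ 2ˡ≤n) ⟩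
  q ^ suc n ℚ.* (((suc n ×ℚ 1ℚ) ^ k ℚ.* (1ℚ ℚ.+ 1ℚ) ^ κ) ℚ.* ½ ^ G)
    ≡⟨ cong (λ x → q ^ suc n ℚ.* (x ℚ.* ½ ^ G)) ∏ys ⟨
  q ^ suc n ℚ.* (∏ ys (1ℚ ℚ.+_) ℚ.* ½ ^ G)
    ≡⟨ ℚ.*-assoc (q ^ suc n) _ _ ⟨
  (q ^ suc n ℚ.* ∏ ys (1ℚ ℚ.+_)) ℚ.* ½ ^ G
    ≤⟨ ℚ.*-monoʳ-≤-nonNeg (½ ^ G) {{ℚ.nonNegative (0≤^ G 0≤½)}} (1-/n^n*∏≤1 n ys 0≤ys 0≤q q≤) ⟩
  1ℚ ℚ.* ½ ^ G
    ≡⟨ ℚ.*-identityˡ _ ⟩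
  ½ ^ G ∎
  where
  open ℚ.≤-Reasoning
  G = k ℕ.* l ℕ.+ κ
  us = upperTerms M (n ℕ.* suc M)
  ones = List.replicate κ 1ℚ
  ys = copies k us ++ ones
  L = logSum (suc n) (suc M)
  0≤ones : ∀ κ {y} → y ∈ List.replicate κ 1ℚ → 0ℚ ℚ.≤ y
  0≤ones (suc κ) (here refl) = 0≤1
  0≤ones (suc κ) (there y∈)  = 0≤ones κ y∈
  0≤ys : ∀ {y} → y ∈ ys → 0ℚ ℚ.≤ y
  0≤ys y∈ with ∈.∈-++⁻ (copies k us) y∈
  ... | inj₁ i = 0≤upperTerms M (n ℕ.* suc M) (∈-copies⁻ k us i)
  ... | inj₂ i = 0≤ones κ i
  ∏ys : ∏ ys (1ℚ ℚ.+_) ≡ (suc n ×ℚ 1ℚ) ^ k ℚ.* (1ℚ ℚ.+ 1ℚ) ^ κ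
  ∏ys = trans (∏-++ (copies k us) ones (1ℚ ℚ.+_)) (cong₂ ℚ._*_
    (trans (∏-copies k us (1ℚ ℚ.+_)) (cong (_^ k) (∏-upperTerms-log n M))) (∏-replicate κ 1ℚ (1ℚ ℚ.+_)))
  ∑-ones : ∀ κ → ∑ (List.replicate κ 1ℚ) id ≡ κ ×ℚ 1ℚ
  ∑-ones zero    = refl
  ∑-ones (suc κ) = cong (1ℚ ℚ.+_) (∑-ones κ)
  -- Each of the `k` copies of the upper sum exceeds `logSum` by at most 1. The surplus `k` in the
  -- lower bound for `w` makes up for this, and the remaining `κ` pays for the ones.
  ∑ys≤ : ∑ ys id ℚ.≤ (+ k ℚ./ 1) ℚ.* L ℚ.+ w
  ∑ys≤ = begin
    ∑ ys id
      ≡⟨ trans (∑-++ (copies k us) ones id) (cong₂ ℚ._+_ (∑-copies k us) (∑-ones κ)) ⟩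
    k ×ℚ ∑ us id ℚ.+ κ ×ℚ 1ℚ
      ≤⟨ ℚ.+-monoˡ-≤ (κ ×ℚ 1ℚ) (×ℚ-mono-arg-≤ k (∑-upperTerms M (n ℕ.* suc M))) ⟩
    k ×ℚ (1ℚ ℚ.+ L) ℚ.+ κ ×ℚ 1ℚ
      ≡⟨ cong (ℚ._+ κ ×ℚ 1ℚ) (×ℚ-distrib-+ 1ℚ L k) ⟩
    (k ×ℚ 1ℚ ℚ.+ k ×ℚ L) ℚ.+ κ ×ℚ 1ℚ
      ≡⟨ solve 3 (λ a b c → (a :+ b) :+ c := b :+ (c :+ a)) refl (k ×ℚ 1ℚ) (k ×ℚ L) (κ ×ℚ 1ℚ) ⟩
    k ×ℚ L ℚ.+ (κ ×ℚ 1ℚ ℚ.+ k ×ℚ 1ℚ)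
      ≡⟨ cong₂ ℚ._+_ (trans (cong (k ×ℚ_) (sym (ℚ.*-identityˡ L))) (trans (sym (×ℚ-assoc-* k 1ℚ L))
           (cong (ℚ._* L) (sym (fromℕ-×ℚ k))))) (sym (×ℚ-homo-+ 1ℚ κ k)) ⟩
    (+ k ℚ./ 1) ℚ.* L ℚ.+ (κ ℕ.+ k) ×ℚ 1ℚ
      ≤⟨ ℚ.+-monoʳ-≤ ((+ k ℚ./ 1) ℚ.* L) κ+k≤w ⟩
    (+ k ℚ./ 1) ℚ.* L ℚ.+ w ∎
    where open +-*-Solver
  q≤ : q ℚ.≤ 1ℚ ℚ.- ∑ ys id ℚ.* recip (suc n)
  q≤ = ℚ.≤-trans (ℚ.≤-reflexive q≡) (ℚ.+-monoʳ-≤ 1ℚ (ℚ.neg-antimono-≤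
    (ℚ.*-monoʳ-≤-nonNeg (recip (suc n)) {{ℚ.nonNegative (recip≥0 (suc n))}} ∑ys≤)))

-- From rational approximations to real numbers

seq-∑ℝ : ∀ {a} {A : Set a} (xs : List A) (f : A → ℝ) j → seq (∑ℝ xs f) j ≡ ∑ xs (λ x → seq (f x) j)
seq-∑ℝ []       f j = refl
seq-∑ℝ (x ∷ xs) f j = cong (seq (f x) j ℚ.+_) (seq-∑ℝ xs f j)

seq-^ℝ : ∀ x b j → seq (x ^ℝ b) j ≡ seq x j ^ b
seq-^ℝ x zero    j = refl
seq-^ℝ x (suc b) j = cong (seq x j ℚ.*_) (seq-^ℝ x b j)

∣^∣ : ∀ q b → ℚ.∣ q ^ b ∣ ≡ ℚ.∣ q ∣ ^ b
∣^∣ q zero    = refl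
∣^∣ q (suc b) = trans (ℚ.∣p*q∣≡∣p∣*∣q∣ q (q ^ b)) (cong (ℚ.∣ q ∣ ℚ.*_) (∣^∣ q b))

∣∑∣≤∑∣∣ : ∀ {a} {A : Set a} (xs : List A) (f : A → ℚ) → ℚ.∣ ∑ xs f ∣ ℚ.≤ ∑ xs (λ x → ℚ.∣ f x ∣)
∣∑∣≤∑∣∣ []       f = ℚ.≤-refl
∣∑∣≤∑∣∣ (x ∷ xs) f = ℚ.≤-trans (ℚ.∣p+q∣≤∣p∣+∣q∣ (f x) (∑ xs f)) (ℚ.+-monoʳ-≤ ℚ.∣ f x ∣ (∣∑∣≤∑∣∣ xs f))

½^-small : ∀ e .{{_ : ℚ.Positive e}} → ∃[ η ] ½ ^ η ℚ.≤ e
½^-small e = η , ℚ.≤-trans ½^η≤ (inv-small e η ℕ.≤-refl)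
  where
  open ℚ.≤-Reasoning
  η = ℚ.↧ₙ e
  r = recip (suc η)
  ½^η≤ : ½ ^ η ℚ.≤ r
  ½^η≤ = begin
    ½ ^ η                              ≡⟨ trans (cong (½ ^ η ℚ.*_) (×ℚ-recip η)) (ℚ.*-identityʳ _) ⟨
    ½ ^ η ℚ.* (suc η ×ℚ r)             ≡⟨ trans (×ℚ-comm-* (suc η) (½ ^ η) r) (sym (×ℚ-assoc-* (suc η) (½ ^ η) r)) ⟩
    (suc η ×ℚ ½ ^ η) ℚ.* r             ≤⟨ ℚ.*-monoʳ-≤-nonNeg r {{ℚ.nonNegative (recip≥0 (suc η))}}
                                           (ℚ.≤-trans (×ℚ-mono-≤ (0≤^ η 0≤½) (n<2^n η)) (ℚ.≤-reflexive (2^n×½^n≡1 η))) ⟩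
    1ℚ ℚ.* r                           ≡⟨ ℚ.*-identityˡ r ⟩
    r                                  ∎

½^-positive : ∀ n → ℚ.Positive (½ ^ n)
½^-positive zero    = _
½^-positive (suc n) = ℚ.pos*pos⇒pos ½ (½ ^ n) {{½^-positive n}}

-- `x` is a rational approximation of p and may exceed 1 even when p does not, so 1 - x can be
-- negative. If it is, its absolute value is at most the permitted excess, which is already the
-- desired bound; otherwise `decay` applies.
∣1-x∣^1+n≤ : ∀ k κ n l M {w x} → 2 ℕ.^ l ℕ.≤ suc n → (κ ℕ.+ k) ×ℚ 1ℚ ℚ.+ 1ℚ ℚ.≤ w ℚ.+ 1ℚ →
  x ≡ ((+ k ℚ./ 1) ℚ.* logSum (suc n) (suc M) ℚ.+ w) ℚ.* (+ 1 ℚ./ suc n) →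
  x ℚ.≤ 1ℚ ℚ.+ ½ ^ (k ℕ.* l ℕ.+ κ) →
  ℚ.∣ 1ℚ ℚ.- x ∣ ^ suc n ℚ.≤ ½ ^ (k ℕ.* l ℕ.+ κ)
∣1-x∣^1+n≤ k κ n l M {w} {x} 2ˡ≤n w≥ x≡ x≤ with ℚ.≤-total 0ℚ (1ℚ ℚ.- x)
... | inj₁ 0≤q = subst (λ y → y ^ suc n ℚ.≤ ½ ^ (k ℕ.* l ℕ.+ κ)) (sym (ℚ.0≤p⇒∣p∣≡p 0≤q))
  (decay k κ n l M 2ˡ≤n 0≤q (cancel-1 w≥) (cong (λ y → 1ℚ ℚ.- y) x≡))
  where
  open +-*-Solver
  cancel-1 : ∀ {x y} → x ℚ.+ 1ℚ ℚ.≤ y ℚ.+ 1ℚ → x ℚ.≤ y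
  cancel-1 {x} {y} h = subst₂ ℚ._≤_
    (solve 1 (λ x → (x :+ con 1ℚ) :- con 1ℚ := x) refl x)
    (solve 1 (λ x → (x :+ con 1ℚ) :- con 1ℚ := x) refl y) (ℚ.+-monoˡ-≤ (ℚ.- 1ℚ) h)
... | inj₂ q≤0 = begin
  ℚ.∣ q ∣ ^ suc n      ≡⟨ cong (_^ suc n) (trans (sym (ℚ.∣-p∣≡∣p∣ q)) (ℚ.0≤p⇒∣p∣≡p (ℚ.neg-antimono-≤ q≤0))) ⟩
  (ℚ.- q) ^ suc n      ≤⟨ ^-monoˡ-≤ (suc n) (ℚ.neg-antimono-≤ q≤0) -q≤ ⟩
  (½ ^ G) ^ suc n      ≤⟨ ^-anti-≤ {½ ^ G} {1} {suc n} (0≤^ G 0≤½) (^≤1 G 0≤½ ½≤1) (ℕ.s≤s ℕ.z≤n) ⟩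
  (½ ^ G) ^ 1          ≡⟨ ℚ.*-identityʳ (½ ^ G) ⟩
  ½ ^ G                ∎
  where
  open ℚ.≤-Reasoning
  open +-*-Solver
  G = k ℕ.* l ℕ.+ κ
  q = 1ℚ ℚ.- x
  -q≤ : ℚ.- q ℚ.≤ ½ ^ G
  -q≤ = begin
    ℚ.- (1ℚ ℚ.- x)             ≡⟨ solve 1 (λ x → :- (con 1ℚ :- x) := x :- con 1ℚ) refl x ⟩
    x ℚ.- 1ℚ                   ≤⟨ ℚ.+-monoˡ-≤ (ℚ.- 1ℚ) x≤ ⟩
    (1ℚ ℚ.+ ½ ^ G) ℚ.- 1ℚ      ≡⟨ solve 1 (λ x → (con 1ℚ :+ x) :- con 1ℚ := x) refl (½ ^ G) ⟩
    ½ ^ G                      ∎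

∣1-x∣^n≤ : ∀ k κ n .{{_ : NonZero n}} l M {w x} → 2 ℕ.^ l ℕ.≤ n → (κ ℕ.+ k) ×ℚ 1ℚ ℚ.+ 1ℚ ℚ.≤ w ℚ.+ 1ℚ →
  x ≡ ((+ k ℚ./ 1) ℚ.* logSum n (suc M) ℚ.+ w) ℚ.* (+ 1 ℚ./ n) →
  x ℚ.≤ 1ℚ ℚ.+ ½ ^ (k ℕ.* l ℕ.+ κ) →
  ℚ.∣ 1ℚ ℚ.- x ∣ ^ n ℚ.≤ ½ ^ (k ℕ.* l ℕ.+ κ)
∣1-x∣^n≤ k κ (suc n) l M 2ˡ≤n = ∣1-x∣^1+n≤ k κ n l M 2ˡ≤n

∣seq-∑ℝ-^∣≤ : ∀ {a} {A : Set a} (xs : List A) (x : ℝ) (b : A → ℕ) j →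
  ℚ.∣ seq (∑ℝ xs (λ y → x ^ℝ b y)) j ∣ ℚ.≤ ∑ xs (λ y → ℚ.∣ seq x j ∣ ^ b y)
∣seq-∑ℝ-^∣≤ xs x b j = begin
  ℚ.∣ seq (∑ℝ xs (λ y → x ^ℝ b y)) j ∣  ≡⟨ cong ℚ.∣_∣ (trans (seq-∑ℝ xs (λ y → x ^ℝ b y) j)
    (∑-cong xs (λ y → seq-^ℝ x (b y) j))) ⟩
  ℚ.∣ ∑ xs (λ y → seq x j ^ b y) ∣      ≤⟨ ∣∑∣≤∑∣∣ xs (λ y → seq x j ^ b y) ⟩
  ∑ xs (λ y → ℚ.∣ seq x j ^ b y ∣)      ≡⟨ ∑-cong xs (λ y → ∣^∣ (seq x j) (b y)) ⟩
  ∑ xs (λ y → ℚ.∣ seq x j ∣ ^ b y)      ∎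
  where open ℚ.≤-Reasoning

seq-p : ∀ k ω n .{{_ : NonZero n}} j → seq (p k ω n) j ≡
  ((+ k ℚ./ 1) ℚ.* logSum n (suc j) ℚ.+ seq (ω n) j) ℚ.* (+ 1 ℚ./ n)
seq-p k ω n j = refl

q-bound : ∀ k ω κ n .{{n≢0 : NonZero n}} l j →
  2 ℕ.^ l ℕ.≤ n → (κ ℕ.+ k) ×ℚ 1ℚ ℚ.+ 1ℚ ℚ.≤ seq (ω n) j ℚ.+ 1ℚ →
  seq (p k ω n) j ℚ.≤ 1ℚ ℚ.+ ½ ^ (k ℕ.* l ℕ.+ κ) →
  ℚ.∣ seq (1ℝ -ℝ p k ω n) j ∣ ^ n ℚ.≤ ½ ^ (k ℕ.* l ℕ.+ κ)
q-bound k ω κ n l j 2ˡ≤n ω≥ p≤ =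
  ∣1-x∣^n≤ k κ n l j {seq (ω n) j} {seq (p k ω n) j} 2ˡ≤n ω≥ (seq-p k ω n j) p≤

module _ {c ℓ} (R : FiniteAbelianGroup c ℓ) (k : ℕ) .{{k≢0 : NonZero k}} (ω : ℕ → ℝ)
         (e : ℚ) .{{_ : ℚ.Positive e}} (η κ : ℕ) (½^η≤e : ½ ^ η ℚ.≤ e) where

  private
    𝒢-sum : (n : ℕ) .(n≢0 : NonZero n) → ℝ
    𝒢-sum n n≢0 = ∑ℝ (Cochains.𝒢 R n k {{k≢0}}) (λ φ → (1ℝ -ℝ p k ω n {{n≢0}}) ^ℝ Cochains.b R n φ)

    PowerBound : ℕ → ℕ → Set
    PowerBound n l = ∀ Q → 0ℚ ℚ.≤ Q → Q ^ n ℚ.≤ ½ ^ (k ℕ.* l ℕ.+ κ) →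
      ∑ (Cochains.𝒢 R n k {{k≢0}}) (λ φ → Q ^ Cochains.b R n φ) ℚ.≤ ½ ^ η

    seq-𝒢-sum-≤ : ∀ n .(n≢0 : NonZero n) l j → PowerBound n l →
      ℚ.∣ seq (1ℝ -ℝ p k ω n {{n≢0}}) j ∣ ^ n ℚ.≤ ½ ^ (k ℕ.* l ℕ.+ κ) →
      ℚ.∣ seq (𝒢-sum n n≢0) j ∣ ℚ.≤ e
    seq-𝒢-sum-≤ n n≢0 l j bound q≤ = ℚ.≤-trans
      (∣seq-∑ℝ-^∣≤ (Cochains.𝒢 R n k {{k≢0}}) (1ℝ -ℝ p k ω n {{n≢0}}) (Cochains.b R n) j)
      (ℚ.≤-trans (bound ℚ.∣ seq (1ℝ -ℝ p k ω n {{n≢0}}) j ∣ (ℚ.0≤∣p∣ (seq (1ℝ -ℝ p k ω n {{n≢0}}) j)) q≤) ½^η≤e)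

    𝒢-sum-≤ : ∀ n .(n≢0 : NonZero n) → (∃[ l ] 2 ℕ.^ l ℕ.≤ n × PowerBound n l) →
      fromℚ ((κ ℕ.+ k) ×ℚ 1ℚ ℚ.+ 1ℚ) ≤ℝ ω n → p k ω n {{n≢0}} ≤ℝ 1ℝ → ∣ 𝒢-sum n n≢0 ∣ℝ ≤ℝ fromℚ e
    𝒢-sum-≤ n n≢0 (l , 2ˡ≤n , bound) ω≥ p≤1 e′ =
      -- The tolerance 1 is offset by the extra 1 in the lower bound required of ω. The tolerance on
      -- p is exactly the bound wanted for the n-th power, so an approximation above 1 does no harm.
      combine (ω≥ 1ℚ) (p≤1 (½ ^ (k ℕ.* l ℕ.+ κ)) {{½^-positive (k ℕ.* l ℕ.+ κ)}})
      where
      combine : (∃[ N ] ∀ j → N ℕ.≤ j → (κ ℕ.+ k) ×ℚ 1ℚ ℚ.+ 1ℚ ℚ.≤ seq (ω n) j ℚ.+ 1ℚ) →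
        (∃[ N ] ∀ j → N ℕ.≤ j → seq (p k ω n {{n≢0}}) j ℚ.≤ 1ℚ ℚ.+ ½ ^ (k ℕ.* l ℕ.+ κ)) →
        ∃[ N ] ∀ j → N ℕ.≤ j → ℚ.∣ seq (𝒢-sum n n≢0) j ∣ ℚ.≤ e ℚ.+ e′
      combine (j₁ , ω≥) (j₂ , p≤) = j₁ ℕ.⊔ j₂ , λ j j≥ → ℚ.≤-trans
        (seq-𝒢-sum-≤ n n≢0 l j bound (q-bound k ω κ n {{n≢0}} l j 2ˡ≤n
          (ω≥ j (ℕ.≤-trans (ℕ.m≤m⊔n j₁ j₂) j≥)) (p≤ j (ℕ.≤-trans (ℕ.m≤n⊔m j₁ j₂) j≥))))
        (x≤x+y {e} {e′} (ℚ.<⇒≤ (ℚ.positive⁻¹ e′)))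

  𝒢-sum-eventually-≤ : (Eventually λ n → ∃[ l ] 2 ℕ.^ l ℕ.≤ n × PowerBound n l) →
    (Eventually λ n → fromℚ ((κ ℕ.+ k) ×ℚ 1ℚ ℚ.+ 1ℚ) ≤ℝ ω n) → (Eventually λ n {{n≢0}} → p k ω n {{n≢0}} ≤ℝ 1ℝ) →
    Eventually λ n {{n≢0}} → ∣ 𝒢-sum n n≢0 ∣ℝ ≤ℝ fromℚ e
  𝒢-sum-eventually-≤ (n₀ , bound) (n₁ , ω≥) (n₂ , p≤1) = n₀ ℕ.⊔ (n₁ ℕ.⊔ n₂) , λ n {{n≢0}} n≥ → 𝒢-sum-≤ n n≢0
    (bound n {{n≢0}} (ℕ.≤-trans (ℕ.m≤m⊔n n₀ (n₁ ℕ.⊔ n₂)) n≥))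
    (ω≥ n {{n≢0}} (ℕ.≤-trans (ℕ.m≤m⊔n n₁ n₂) (ℕ.≤-trans (ℕ.m≤n⊔m n₀ (n₁ ℕ.⊔ n₂)) n≥)))
    (p≤1 n {{n≢0}} (ℕ.≤-trans (ℕ.m≤n⊔m n₁ n₂) (ℕ.≤-trans (ℕ.m≤n⊔m n₀ (n₁ ℕ.⊔ n₂)) n≥)))

𝒢-power-bound : ∀ {c ℓ} (R : FiniteAbelianGroup c ℓ) k .(k≢0 : NonZero k) η → ∃[ κ ] Eventually λ n {{n≢0}} →
  ∃[ l ] 2 ℕ.^ l ℕ.≤ n × (∀ Q → 0ℚ ℚ.≤ Q → Q ^ n ℚ.≤ ½ ^ (k ℕ.* l ℕ.+ κ) →
    ∑ (Cochains.𝒢 R n k {{k≢0}}) (λ φ → Q ^ Cochains.b R n φ) ℚ.≤ ½ ^ η)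
𝒢-power-bound R (suc k′) k≢0 η = at (∑𝒢-power-bound R k′ η)
  where
  Bound : (κ n l : ℕ) → Set
  Bound κ n l = ∀ Q → 0ℚ ℚ.≤ Q → Q ^ n ℚ.≤ ½ ^ (suc k′ ℕ.* l ℕ.+ κ) →
    ∑ (Cochains.𝒢 R n (suc k′) {{k≢0}}) (λ φ → Q ^ Cochains.b R n φ) ℚ.≤ ½ ^ η
  at : (∃₂ λ κ n₀ → ∀ n l .{{_ : NonZero n}} → n₀ ℕ.≤ n → 2 ℕ.^ l ℕ.≤ n → n ℕ.< 2 ℕ.^ suc l → Bound κ n l) →
    ∃[ κ ] Eventually λ n → ∃[ l ] 2 ℕ.^ l ℕ.≤ n × Bound κ n l
  at (κ , n₀ , bound) = κ , n₀ , λ n {{n≢0}} n₀≤n →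
    let l , 2ˡ≤n , n<2ˡ⁺¹ = binaryOrder n {{n≢0}} in l , 2ˡ≤n , bound n l {{n≢0}} n₀≤n 2ˡ≤n n<2ˡ⁺¹

theorem1p2 : ∀ {c ℓ} (k : ℕ) .{{_ : NonZero k}} (R : FiniteAbelianGroup c ℓ) (ω : ℕ → ℝ) →
    TendsToInfinity ω →
    (Eventually λ n → p k ω n ≤ℝ 1ℝ) →
    IsLittleO1 (λ n → ∑ℝ (Cochains.𝒢 R n k) (λ φ → (1ℝ -ℝ p k ω n) ^ℝ Cochains.b R n φ))
theorem1p2 k {{k≢0}} R ω ω→∞ p≤1 e {{e>0}} = at (½^-small e)
  where
  at : (∃[ η ] ½ ^ η ℚ.≤ e) → Eventually λ n {{n≢0}} →
    ∣ ∑ℝ (Cochains.𝒢 R n k {{k≢0}}) (λ φ → (1ℝ -ℝ p k ω n {{n≢0}}) ^ℝ Cochains.b R n φ) ∣ℝ ≤ℝ fromℚ e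
  at (η , ½^η≤e) = with-κ (𝒢-power-bound R k k≢0 η)
    where
    with-κ : (∃[ κ ] Eventually λ n {{n≢0}} →
        ∃[ l ] 2 ℕ.^ l ℕ.≤ n × (∀ Q → 0ℚ ℚ.≤ Q → Q ^ n ℚ.≤ ½ ^ (k ℕ.* l ℕ.+ κ) →
          ∑ (Cochains.𝒢 R n k {{k≢0}}) (λ φ → Q ^ Cochains.b R n φ) ℚ.≤ ½ ^ η)) →
      Eventually λ n {{n≢0}} →
        ∣ ∑ℝ (Cochains.𝒢 R n k {{k≢0}}) (λ φ → (1ℝ -ℝ p k ω n {{n≢0}}) ^ℝ Cochains.b R n φ) ∣ℝ ≤ℝ fromℚ e
    with-κ (κ , bound) = 𝒢-sum-eventually-≤ R k {{k≢0}} ω e {{e>0}} η κ ½^η≤e bound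
      (ω→∞ ((κ ℕ.+ k) ×ℚ 1ℚ ℚ.+ 1ℚ)) p≤1
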